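{- (i) For every integer $n$ with $6\le n\le 8$, $sat(n,K_{3,3})=2n$. (ii) For every integer $n\ge 9$, $sat_2(n,K_{3,3})=3n-9$ and $sat_5(n,K_{3,3})\ge 3n-9$.
   Context: All graphs are finite and simple. $K_{3,3}$ is the complete bipartite graph with both parts of size $3$, and $\overline{G}$ is the complement of $G$. A graph $G$ is $F$-saturated if $G$ does not contain $F$ as a (not necessarily induced) subgraph, but for every edge $e\in E(\overline{G})$ the graph $G+e$ contains $F$ as a subgraph. The saturation number $sat(n,F)$ is the minimum number of edges in an $n$-vertex $F$-saturated graph. For an integer $\delta$, $sat_\delta(n,F)$ is the minimum number of edges in an $F$-saturated graph with $n$ vertices and minimum degree exactly $\delta$. The inequality $sat_5(n,K_{3,3})\ge 3n-9$ means that every $K_{3,3}$-saturated graph with $n$ vertices and minimum degree $5$ has at least $3n-9$ edges (so it holds vacuously if there is no such graph). -}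

module Defs where

open import Data.Bool using (Bool; true; false)
import Data.Bool.Properties as Bool
open import Data.Fin using (Fin; splitAt; _<?_; _≟_)
open import Data.List using (List; length; filter; allFin; cartesianProduct)
open import Data.Nat using (ℕ; _+_; _≤_)
open import Data.Product using (Σ-syntax; ∃-syntax; _×_; _,_)
open import Data.Sum using (_⊎_; inj₁; inj₂; [_,_]′)
open import Function using (const; _∘_)
open import Function.Definitions using (Injective)
open import Level using (0ℓ)
open import Relation.Binary.Core using (Rel)
open import Relation.Binary.Definitions using (Decidable; Symmetric; Irreflexive)
open import Relation.Binary.PropositionalEquality using (_≡_; _≢_; refl; sym; trans)
open import Relation.Nullary using (¬_; ¬?; _×-dec_; _⊎-dec_)

-- Finite simple graphs; a graph on n vertices has vertex set Fin n.

record Graph (n : ℕ) : Set₁ where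
  infix 4 _~_ _~?_
  field
    _~_      : Rel (Fin n) 0ℓ
    _~?_     : Decidable _~_
    ~-sym    : Symmetric _~_
    ~-irrefl : Irreflexive _≡_ _~_

  degree : Fin n → ℕ
  degree v = length (filter (v ~?_) (allFin n))

  -- The edge {u , v} is listed once, as the pair (u , v) with u < v.
  edges : List (Fin n × Fin n)
  edges = filter (λ (u , v) → (u <? v) ×-dec (u ~? v))
                 (cartesianProduct (allFin n) (allFin n))

  edgeCount : ℕ
  edgeCount = length edges

open Graph

complement : ∀ {n} → Graph n → Graph n
complement G ._~_  u v             = u ≢ v × ¬ (_~_ G u v)
complement G ._~?_ u v             = ¬? (u ≟ v) ×-dec ¬? (_~?_ G u v)
complement G .~-sym (u≢v , ¬uv)    = u≢v ∘ sym , ¬uv ∘ ~-sym G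
complement G .~-irrefl u≡v (u≢v , _) = u≢v u≡v

addEdge : ∀ {n} (G : Graph n) (u v : Fin n) → _~_ (complement G) u v → Graph n
addEdge G u v _ ._~_ x y =
  _~_ G x y ⊎ (x ≡ u × y ≡ v) ⊎ (x ≡ v × y ≡ u)
addEdge G u v _ ._~?_ x y =
  _~?_ G x y ⊎-dec ((x ≟ u) ×-dec (y ≟ v)) ⊎-dec ((x ≟ v) ×-dec (y ≟ u))
addEdge G u v _ .~-sym (inj₁ xy)                = inj₁ (~-sym G xy)
addEdge G u v _ .~-sym (inj₂ (inj₁ (p , q)))    = inj₂ (inj₂ (q , p))
addEdge G u v _ .~-sym (inj₂ (inj₂ (p , q)))    = inj₂ (inj₁ (q , p))
addEdge G u v _ .~-irrefl x≡y (inj₁ xy)         = ~-irrefl G x≡y xy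
addEdge G u v (u≢v , _) .~-irrefl refl (inj₂ (inj₁ (p , q))) = u≢v (trans (sym p) q)
addEdge G u v (u≢v , _) .~-irrefl refl (inj₂ (inj₂ (p , q))) = u≢v (trans (sym q) p)

-- The complete bipartite graph with parts the first s and the last t vertices.
K : (s t : ℕ) → Graph (s + t)
K s t = record
  { _~_      = λ u v → side u ≢ side v
  ; _~?_     = λ u v → ¬? (side u Bool.≟ side v)
  ; ~-sym    = _∘ sym
  ; ~-irrefl = λ { refl u≁u → u≁u refl }
  }
  where
  side : Fin (s + t) → Bool
  side = [ const true , const false ]′ ∘ splitAt s

-- Not necessarily induced: edges of F go to edges of G, with nothing
-- required of non-edges.
_ContainedIn_ : ∀ {m n} → Graph m → Graph n → Set
_ContainedIn_ {m} {n} F G =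
  Σ[ f ∈ (Fin m → Fin n) ] Injective _≡_ _≡_ f × (∀ u v → _~_ F u v → _~_ G (f u) (f v))

Saturated : ∀ {m n} → Graph m → Graph n → Set
Saturated F G =
  ¬ (F ContainedIn G) ×
  (∀ u v (e : _~_ (complement G) u v) → F ContainedIn addEdge G u v e)

MinDegree : ∀ {n} → Graph n → ℕ → Set
MinDegree G δ = (∃[ v ] degree G v ≡ δ) × (∀ v → δ ≤ degree G v)

-- sat(n,F) and sat_δ(n,F) are minima of sets of natural numbers, possibly
-- empty in the second case, so equations and inequalities about them are
-- expressed by IsMinimum and IsLowerBound of the sets of edge counts below.

IsLowerBound : (ℕ → Set₁) → ℕ → Set₁
IsLowerBound P m = ∀ k → P k → m ≤ k

IsMinimum : (ℕ → Set₁) → ℕ → Set₁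
IsMinimum P m = P m × IsLowerBound P m

SatSizes : ∀ {m} → ℕ → Graph m → ℕ → Set₁
SatSizes n F k = Σ[ G ∈ Graph n ] Saturated F G × edgeCount G ≡ k

SatSizesδ : ∀ {m} → ℕ → ℕ → Graph m → ℕ → Set₁
SatSizesδ δ n F k = Σ[ G ∈ Graph n ] Saturated F G × MinDegree G δ × edgeCount G ≡ k

{-# OPTIONS --safe #-}
module Submission where

-- If u and w are nonadjacent in a K₃,₃-saturated graph, then u has neighbours
-- R, S and w has neighbours P, Q such that both P, Q are adjacent to both R, S.
--
-- Minimum degree 2.  Let N(v) = {c, d}, let A be the common neighbours of c, d
-- other than v, and B the remaining vertices.  Every vertex outside N[v] has
-- two neighbours in A, and the edge count falls short of 3n − 7 by at most the
-- number of components of G[B] that are trees all of whose vertices have just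
-- two neighbours in A and none in N(v).  The pairs in A belonging to different
-- trees are disjoint and completely joined, so four trees would give K₃,₃ and
-- three give additional edges inside A.  Equality is preserved by adding a
-- triangle joined to two nonadjacent hubs.
--
-- Minimum degree 5.  Root G at v of degree 5 and let N = N(v).  The vertices x
-- outside N[v] contribute d(x) + |N(x) ∩ N| − 6 to twice the edge count; only
-- vertices without neighbours in N contribute negatively, and these are charged
-- to their neighbours having two neighbours in N.  If there are too few edges,
-- this yields a v all of whose neighbours have degree 5; then exactly ten
-- vertices are at distance two from v, each with two neighbours in N, and
-- linking the pairs in N through 4-cycles among these ten vertices fails.
--
-- For 6 ≤ n ≤ 8 a graph with fewer than 2n edges has a vertex v of degree two
-- or three; fixing the copy of K₃,₃ minus an edge given by v and a nonadjacent
-- vertex leaves a small exhaustive search.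

open import Data.Bool using (Bool; T; T?; _∧_; false; if_then_else_; not; true)
open import Data.Bool.ListAction using (any)
open import Data.Empty using (⊥; ⊥-elim)
open import Data.Fin as Fin using (Fin; _↑ʳ_; _↑ˡ_; punchIn; splitAt; suc; zero)
open import Data.Fin.Patterns
open import Data.List using (List; []; _++_; _∷_; allFin; cartesianProduct; filter; length; map; tabulate)
open import Data.List.Properties using (filter-++; length-++)
open import Data.List.Relation.Unary.All as All using (All; []; _∷_)
open import Data.List.Relation.Unary.AllPairs using ([]; _∷_)
open import Data.List.Relation.Unary.Unique.Propositional using (Unique)
open import Data.Maybe as Maybe using (Maybe; just; nothing)
open import Data.Maybe.Properties using (just-injective)
open import Data.Nat using (_*_; _+_; _<_; _<ᵇ_; _∸_; _≡ᵇ_; _≤?_; _≤_; _≤ᵇ_; _⊔_; suc; s≤s; zero; z≤n; ℕ)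
open import Data.Nat.Properties
open import Data.Product using (_,_; _×_; proj₁; proj₂; Σ-syntax; ∃-syntax)
open import Data.Sum using ([_,_]′; _⊎_; inj₁; inj₂)
open import Data.Unit using (tt; ⊤)
open import Data.Vec as Vec using (Vec; []; _∷_)
open import Data.Vec.Properties using (lookup∘tabulate; lookup∘update; lookup∘updateAt; lookup∘updateAt′; lookup∘update′)
open import Defs
open import Function using (_∘_; id)
open import Level using (0ℓ)
open import Relation.Binary.Definitions using (tri<; tri>; tri≈)
open import Relation.Binary.PropositionalEquality
open import Relation.Nullary using (Dec; _×-dec_; contradiction; does; no; yes; ¬?; ¬_)
open import Relation.Nullary.Decidable using (dec-false; dec-true)
open import Relation.Unary using (Pred)
import Data.Bool.Properties as Bool
import Data.Fin.Properties as Fin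
open import Algebra.Properties.CommutativeSemigroup +-commutativeSemigroup using () renaming (interchange to +-interchange)

-- Certified linear arithmetic: a system of linear inequalities over ℕ is
-- refuted by nonnegative multipliers (a Farkas certificate).

-- For a root v of degree five, with f the sum of |N(x) ∩ N| over N, the degree sum is exactly 6n -
-- 26 + f + Σ (d(x) + |N(x) ∩ N| - 6), summed over the vertices outside N[v]. Charging makes the
-- last sum nonnegative, so for a general root the bound 6n - 18 is still eight short; a 4-cycle
-- inside N supplies just these eight. Hence no single root suffices, and the argument moves the
-- root: to a vertex around which every vertex outside the closed neighbourhood has a neighbour in
-- A, to one whose neighbours all have degree five, and in the last exceptional case into a K₄. All
-- these counts are linear in a few sums over vertex classes. They are combined by explicit
-- nonnegative multipliers, that is, by dual solutions of small linear programs. This is why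
-- inequalities are kept free of subtraction and fractions, if need be by doubling them.

infixl 6 _⊕_
infixr 7 _⊙_

data Expr (k : ℕ) : Set where
  var : Fin k → Expr k
  con : ℕ → Expr k
  _⊕_ : Expr k → Expr k → Expr k
  _⊙_ : ℕ → Expr k → Expr k

-- The value u of the constant 1 is a parameter, because summing a linear
-- inequality over a set S turns it into the size of S.
eval : ∀ {k} → ℕ → Vec ℕ k → Expr k → ℕ
eval u ρ (var i) = Vec.lookup ρ i
eval u ρ (con c) = c * u
eval u ρ (e ⊕ f) = eval u ρ e + eval u ρ f
eval u ρ (c ⊙ e) = c * eval u ρ e

⟦_⟧ : ∀ {k} → Expr k → Vec ℕ k → ℕ
⟦ e ⟧ ρ = eval 1 ρ e

private
  Form : ℕ → Set
  Form k = ℕ × Vec ℕ k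

  value : ∀ {k} → Vec ℕ k → Vec ℕ k → ℕ
  value []       []       = 0
  value (a ∷ as) (x ∷ ρ)  = a * x + value as ρ

  unit : ∀ {k} → Fin k → Vec ℕ k
  unit zero    = 1 ∷ Vec.replicate _ 0
  unit (suc i) = 0 ∷ unit i

  form : ∀ {k} → Expr k → Form k
  form (var i) = 0 , unit i
  form (con c) = c , Vec.replicate _ 0
  form (e ⊕ f) = proj₁ (form e) + proj₁ (form f) , Vec.zipWith _+_ (proj₂ (form e)) (proj₂ (form f))
  form (c ⊙ e) = c * proj₁ (form e) , Vec.map (c *_) (proj₂ (form e))

  value-0 : ∀ {k} (ρ : Vec ℕ k) → value (Vec.replicate k 0) ρ ≡ 0
  value-0 []      = refl
  value-0 (_ ∷ ρ) = value-0 ρ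

  value-unit : ∀ {k} (i : Fin k) ρ → value (unit i) ρ ≡ Vec.lookup ρ i
  value-unit zero (x ∷ ρ) rewrite value-0 ρ = trans (+-identityʳ _) (*-identityˡ x)
  value-unit (suc i) (x ∷ ρ) = value-unit i ρ

  value-+ : ∀ {k} (as bs ρ : Vec ℕ k) → value (Vec.zipWith _+_ as bs) ρ ≡ value as ρ + value bs ρ
  value-+ []       []       []      = refl
  value-+ (a ∷ as) (b ∷ bs) (x ∷ ρ)
    rewrite value-+ as bs ρ | *-distribʳ-+ x a b = +-interchange (a * x) (b * x) (value as ρ) (value bs ρ)

  value-* : ∀ {k} c (as ρ : Vec ℕ k) → value (Vec.map (c *_) as) ρ ≡ c * value as ρ
  value-* c []       []      = sym (*-zeroʳ c)
  value-* c (a ∷ as) (x ∷ ρ)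
    rewrite value-* c as ρ | *-assoc c a x = sym (*-distribˡ-+ c (a * x) (value as ρ))

  form-sound : ∀ {k} (e : Expr k) ρ → ⟦ e ⟧ ρ ≡ proj₁ (form e) + value (proj₂ (form e)) ρ
  form-sound (var i) ρ = sym (value-unit i ρ)
  form-sound (con c) ρ rewrite value-0 ρ = trans (*-identityʳ c) (sym (+-identityʳ c))
  form-sound (e ⊕ f) ρ
    rewrite form-sound e ρ | form-sound f ρ | value-+ (proj₂ (form e)) (proj₂ (form f)) ρ =
      +-interchange (proj₁ (form e)) (value (proj₂ (form e)) ρ) (proj₁ (form f)) (value (proj₂ (form f)) ρ)
  form-sound (c ⊙ e) ρ
    rewrite form-sound e ρ | value-* c (proj₂ (form e)) ρ = *-distribˡ-+ c (proj₁ (form e)) (value (proj₂ (form e)) ρ)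

  _≤ᵛ_ : ∀ {k} → Vec ℕ k → Vec ℕ k → Bool
  []       ≤ᵛ []       = true
  (a ∷ as) ≤ᵛ (b ∷ bs) = if a ≤ᵇ b then as ≤ᵛ bs else false

  value-mono : ∀ {k} (as bs ρ : Vec ℕ k) → T (as ≤ᵛ bs) → value as ρ ≤ value bs ρ
  value-mono []       []       []      _ = z≤n
  value-mono (a ∷ as) (b ∷ bs) (x ∷ ρ) p with a ≤ᵇ b in eq
  ... | true = +-mono-≤ (*-monoˡ-≤ x (≤ᵇ⇒≤ a b (subst T (sym eq) tt))) (value-mono as bs ρ p)

-- A hypothesis c ∙ l ⊑ r stands for l ≤ r taken with multiplier c; in
-- c ∣ d ∙ l ≋ r the equation l ≡ r is used c times as l ≤ r and d times
-- as r ≤ l.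
infix 4 _∙_⊑_ _∣_∙_≋_
data Hyp (k : ℕ) : Set where
  _∙_⊑_   : ℕ → Expr k → Expr k → Hyp k
  _∣_∙_≋_ : ℕ → ℕ → Expr k → Expr k → Hyp k

private
  lhs rhs : ∀ {k} → List (Hyp k) → Expr k
  lhs []                     = con 0
  lhs ((c ∙ l ⊑ r) ∷ hs)     = c ⊙ l ⊕ lhs hs
  lhs ((c ∣ d ∙ l ≋ r) ∷ hs) = c ⊙ l ⊕ (d ⊙ r ⊕ lhs hs)
  rhs []                     = con 0
  rhs ((c ∙ l ⊑ r) ∷ hs)     = c ⊙ r ⊕ rhs hs
  rhs ((c ∣ d ∙ l ≋ r) ∷ hs) = c ⊙ r ⊕ (d ⊙ l ⊕ rhs hs)

  -- The hypotheses add up to `lhs hs` ≤ `rhs hs`. If no coefficient is larger on the right and the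
  -- constant is larger on the left, this fails for all natural values of the variables.
  absurd? : ∀ {k} → List (Hyp k) → Bool
  absurd? hs = if proj₂ (form (rhs hs)) ≤ᵛ proj₂ (form (lhs hs)) then proj₁ (form (rhs hs)) <ᵇ proj₁ (form (lhs hs))
      else false

  absurd-sound : ∀ {k} (hs : List (Hyp k)) ρ → T (absurd? hs) → ⟦ lhs hs ⟧ ρ ≤ ⟦ rhs hs ⟧ ρ → ⊥
  absurd-sound hs ρ p le with proj₂ (form (rhs hs)) ≤ᵛ proj₂ (form (lhs hs)) in eq
  ... | true = <-irrefl refl (begin-strict
    ⟦ rhs hs ⟧ ρ                                                  ≡⟨ form-sound (rhs hs) ρ ⟩
    proj₁ (form (rhs hs)) + value (proj₂ (form (rhs hs))) ρ <⟨ +-mono-<-≤ (<ᵇ⇒< (proj₁ (form (rhs hs))) _ p)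
        (value-mono (proj₂ (form (rhs hs))) (proj₂ (form (lhs hs))) ρ (subst T (sym eq) tt)) ⟩
    proj₁ (form (lhs hs)) + value (proj₂ (form (lhs hs))) ρ       ≡⟨ form-sound (lhs hs) ρ ⟨
    ⟦ lhs hs ⟧ ρ                                                  ≤⟨ le ⟩
    ⟦ rhs hs ⟧ ρ                                                  ∎)
    where open ≤-Reasoning

_⊢_⇒_ : ∀ {k} → Vec ℕ k → List (Hyp k) → Set → Set
ρ ⊢ []                     ⇒ G = G
ρ ⊢ (c ∙ l ⊑ r) ∷ hs       ⇒ G = ⟦ l ⟧ ρ ≤ ⟦ r ⟧ ρ → ρ ⊢ hs ⇒ G
ρ ⊢ (c ∣ d ∙ l ≋ r) ∷ hs   ⇒ G = ⟦ l ⟧ ρ ≡ ⟦ r ⟧ ρ → ρ ⊢ hs ⇒ G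

private
  collect : ∀ {k} (ρ : Vec ℕ k) hs {G : Set} → (⟦ lhs hs ⟧ ρ ≤ ⟦ rhs hs ⟧ ρ → G) → ρ ⊢ hs ⇒ G
  collect ρ []                     f = f z≤n
  collect ρ ((c ∙ l ⊑ r) ∷ hs)     f h = collect ρ hs λ p → f (+-mono-≤ (*-monoʳ-≤ c h) p)
  collect ρ ((c ∣ d ∙ l ≋ r) ∷ hs) f h = collect ρ hs λ p →
    f (+-mono-≤ (*-monoʳ-≤ c (≤-reflexive h)) (+-mono-≤ (*-monoʳ-≤ d (≤-reflexive (sym h))) p))

-- The multipliers are literals, so the hidden argument reduces to the unit type and the certificate
-- is checked by evaluation.
refute : ∀ {k} (ρ : Vec ℕ k) (hs : List (Hyp k)) {_ : T (absurd? hs)} → ρ ⊢ hs ⇒ ⊥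
refute ρ hs {p} = collect ρ hs (absurd-sound hs ρ p)

-- The negated goal enters with multiplier c.
deduce : ∀ {k} (ρ : Vec ℕ k) (hs : List (Hyp k)) (c : ℕ) (l r : Expr k) {_ : T (absurd? ((c ∙ con 1 ⊕ r ⊑ l) ∷ hs))} →
         ρ ⊢ hs ⇒ (⟦ l ⟧ ρ ≤ ⟦ r ⟧ ρ)
deduce ρ hs c l r {p} = collect ρ hs λ q → ≮⇒≥ λ r<l →
  absurd-sound ((c ∙ con 1 ⊕ r ⊑ l) ∷ hs) ρ p (+-mono-≤ (*-monoʳ-≤ c r<l) q)

-- Finite sums of natural numbers

sum : ∀ {n} → (Fin n → ℕ) → ℕ
sum {zero}  f = 0
sum {suc n} f = f zero + sum (f ∘ suc)

sum-cong : ∀ {n} {f g : Fin n → ℕ} → (∀ x → f x ≡ g x) → sum f ≡ sum g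
sum-cong {zero}  h = refl
sum-cong {suc n} h = cong₂ _+_ (h zero) (sum-cong (h ∘ suc))

sum-mono : ∀ {n} {f g : Fin n → ℕ} → (∀ x → f x ≤ g x) → sum f ≤ sum g
sum-mono {zero}  h = z≤n
sum-mono {suc n} h = +-mono-≤ (h zero) (sum-mono (h ∘ suc))

sum-+ : ∀ {n} (f g : Fin n → ℕ) → sum (λ x → f x + g x) ≡ sum f + sum g
sum-+ {zero}  f g = refl
sum-+ {suc n} f g rewrite sum-+ (f ∘ suc) (g ∘ suc) =
  +-interchange (f zero) (g zero) (sum (f ∘ suc)) (sum (g ∘ suc))

sum-const : ∀ n c → sum {n} (λ _ → c) ≡ c * n
sum-const zero    c = sym (*-zeroʳ c)
sum-const (suc n) c rewrite sum-const n c = sym (*-suc c n)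

sum-* : ∀ {n} c (f : Fin n → ℕ) → sum (λ x → c * f x) ≡ c * sum f
sum-* {zero}  c f = sym (*-zeroʳ c)
sum-* {suc n} c f rewrite sum-* c (f ∘ suc) = sym (*-distribˡ-+ c (f zero) (sum (f ∘ suc)))

sum-swap : ∀ {m n} (f : Fin m → Fin n → ℕ) → sum (λ x → sum (f x)) ≡ sum (λ y → sum (λ x → f x y))
sum-swap {zero}  {n} f = sym (sum-const n 0)
sum-swap {suc m} {n} f rewrite sum-swap (f ∘ suc) = sym (sum-+ (f zero) (λ y → sum (λ x → f (suc x) y)))

at : ∀ {n k} → Vec (Fin n → ℕ) k → Fin n → Vec ℕ k
at fs x = Vec.map (λ f → f x) fs

pattern v0 = var 0F
pattern v1 = var 1F
pattern v2 = var 2F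
pattern v3 = var 3F
pattern v4 = var 4F
pattern v5 = var 5F
pattern v6 = var 6F
pattern v7 = var 7F
pattern v8 = var 8F
pattern v9 = var 9F
pattern v10 = var (suc 9F)
pattern v11 = var (suc (suc 9F))
pattern v12 = var (suc (suc (suc 9F)))

-- Counting in finite sets and graphs

Sub : ℕ → Set
Sub n = Fin n → Bool

infix 4 _∈_
_∈_ : ∀ {n} → Fin n → Sub n → Set
x ∈ S = S x ≡ true

ι : Bool → ℕ
ι true  = 1
ι false = 0

#_ : ∀ {n} → Sub n → ℕ
# S = sum (ι ∘ S)

on : ∀ {n} → Sub n → (Fin n → ℕ) → Fin n → ℕ
on S f x = if S x then f x else 0

infixl 7 _∩_
_∩_ : ∀ {n} → Sub n → Sub n → Sub n
(S ∩ T) x = S x ∧ T x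

∩⁺ : ∀ {n} (S T : Sub n) {x} → x ∈ S → x ∈ T → x ∈ S ∩ T
∩⁺ S T p q rewrite p = q

∩ˡ : ∀ {n} (S T : Sub n) {x} → x ∈ S ∩ T → x ∈ S
∩ˡ S T {x} p with S x
... | true = refl

∩ʳ : ∀ {n} (S T : Sub n) {x} → x ∈ S ∩ T → x ∈ T
∩ʳ S T {x} p with S x
... | true = p

is : ∀ {n} → Fin n → Sub n
is x y = does (x Fin.≟ y)

isnt : ∀ {n} → Fin n → Sub n
isnt x y = not (does (x Fin.≟ y))

is-refl : ∀ {n} (x : Fin n) → x ∈ is x
is-refl x = dec-true (x Fin.≟ x) refl

is⇒≡ : ∀ {n} {x y : Fin n} → y ∈ is x → x ≡ y
is⇒≡ {x = x} {y} p with x Fin.≟ y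
... | yes q = q

isnt⇒≢ : ∀ {n} {x y : Fin n} → y ∈ isnt x → x ≢ y
isnt⇒≢ {x = x} {y} p with x Fin.≟ y
... | no q = q

≢⇒isnt : ∀ {n} {x y : Fin n} → x ≢ y → y ∈ isnt x
≢⇒isnt {x = x} {y} p = cong not (dec-false (x Fin.≟ y) p)

ι-≤1 : ∀ b → ι b ≤ 1
ι-≤1 true  = ≤-refl
ι-≤1 false = z≤n

sum-0 : ∀ {n} {f : Fin n → ℕ} → (∀ x → f x ≡ 0) → sum f ≡ 0
sum-0 {n} h = trans (sum-cong h) (sum-const n 0)

sum-split : ∀ {n} (x : Fin n) (f : Fin n → ℕ) → sum f ≡ f x + sum (on (isnt x) f)
sum-split zero f = refl
sum-split (suc x) f = begin
  f zero + sum (f ∘ suc)                                       ≡⟨ cong (f zero +_) (sum-split x (f ∘ suc)) ⟩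
  f zero + (f (suc x) + sum (on (isnt x) (f ∘ suc)))           ≡⟨ +-assoc (f zero) _ _ ⟨
  (f zero + f (suc x)) + sum (on (isnt x) (f ∘ suc)) ≡⟨ cong (_+ sum (on (isnt x) (f ∘ suc))) (+-comm (f zero) (f (suc
      x))) ⟩
  (f (suc x) + f zero) + sum (on (isnt x) (f ∘ suc))           ≡⟨ +-assoc (f (suc x)) _ _ ⟩
  f (suc x) + (f zero + sum (on (isnt x) (f ∘ suc)))           ≡⟨⟩
  f (suc x) + sum (on (isnt (suc x)) f)                        ∎
  where open ≡-Reasoning

≤-sum : ∀ {n} (x : Fin n) (f : Fin n → ℕ) → f x ≤ sum f
≤-sum x f rewrite sum-split x f = m≤m+n (f x) _

sum≥1⇒∃ : ∀ {n} (f : Fin n → ℕ) → 1 ≤ sum f → ∃[ x ] 1 ≤ f x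
sum≥1⇒∃ {suc n} f p with f zero in eq
... | suc _ = zero , subst (1 ≤_) (sym eq) (s≤s z≤n)
... | zero  = let x , q = sum≥1⇒∃ (f ∘ suc) p in suc x , q

ι⁻¹ : ∀ {b} → 1 ≤ ι b → b ≡ true
ι⁻¹ {true} _ = refl

#-split : ∀ {n} (S : Sub n) {x} → x ∈ S → # S ≡ suc (# (S ∩ isnt x))
#-split S {x} p rewrite sum-split x (ι ∘ S) | p = cong suc (sum-cong λ y → lem y)
  where
  lem : ∀ y → on (isnt x) (ι ∘ S) y ≡ ι ((S ∩ isnt x) y)
  lem y with S y | isnt x y
  ... | true  | true  = refl
  ... | true  | false = refl
  ... | false | true  = refl
  ... | false | false = refl

-- The usual source of lower bounds on degrees below: exhibit pairwise distinct members. Removing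
-- the head of the list from `S` lowers both sides by one.
length≤# : ∀ {n} (S : Sub n) {xs} → Unique xs → All (_∈ S) xs → length xs ≤ # S
length≤# S []         []       = z≤n
length≤# S (u ∷ us) (_∷_ {x} p ps) rewrite #-split S p =
  s≤s (length≤# (S ∩ isnt x) us (All.zipWith (λ { (q , x≢y) → ∩⁺ S (isnt x) q (≢⇒isnt x≢y) }) (ps , u)))

#≥1⇒∃ : ∀ {n} (S : Sub n) → 1 ≤ # S → ∃[ x ] x ∈ S
#≥1⇒∃ S p = let x , q = sum≥1⇒∃ (ι ∘ S) p in x , ι⁻¹ q

#≥2⇒∃ : ∀ {n} (S : Sub n) → 2 ≤ # S → ∃[ x ] ∃[ y ] x ∈ S × y ∈ S × x ≢ y
#≥2⇒∃ S p =
  let x , q = #≥1⇒∃ S (≤-trans (s≤s z≤n) p)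
      y , r = #≥1⇒∃ (S ∩ isnt x) (≤-pred (subst (2 ≤_) (#-split S q) p))
  in x , y , q , ∩ˡ S (isnt x) r , isnt⇒≢ (∩ʳ S (isnt x) r)

#-mono : ∀ {n} {S T : Sub n} → (∀ {x} → x ∈ S → x ∈ T) → # S ≤ # T
#-mono {S = S} {T} h = sum-mono λ x → lem x
  where
  lem : ∀ x → ι (S x) ≤ ι (T x)
  lem x with S x in p
  ... | false = z≤n
  ... | true rewrite h p = ≤-refl

#≡0 : ∀ {n} (S : Sub n) → (∀ x → ¬ x ∈ S) → # S ≡ 0
#≡0 S h = sum-0 λ x → lem x
  where
  lem : ∀ x → ι (S x) ≡ 0
  lem x with S x in p
  ... | true  = ⊥-elim (h x p)
  ... | false = refl

¬∈⇒false : ∀ {n} {S : Sub n} {x} → ¬ x ∈ S → S x ≡ false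
¬∈⇒false = Bool.¬-not

length-filter-tabulate : ∀ {A : Set} {P : Pred A 0ℓ} (P? : ∀ x → Dec (P x)) {n} (f : Fin n → A) →
                         length (filter P? (tabulate f)) ≡ sum (λ i → ι (does (P? (f i))))
length-filter-tabulate P? {zero}  f = refl
length-filter-tabulate P? {suc n} f with P? (f zero)
... | yes _ = cong suc (length-filter-tabulate P? (f ∘ suc))
... | no  _ = length-filter-tabulate P? (f ∘ suc)

length-filter-map : ∀ {A B : Set} {P : Pred B 0ℓ} (P? : ∀ x → Dec (P x)) (g : A → B) xs →
                    length (filter P? (map g xs)) ≡ length (filter (P? ∘ g) xs)
length-filter-map P? g [] = refl
length-filter-map P? g (x ∷ xs) with P? (g x)
... | yes _ = cong suc (length-filter-map P? g xs)
... | no  _ = length-filter-map P? g xs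

length-filter-product : ∀ {m n} {A : Set} {P : Pred (A × Fin n) 0ℓ} (P? : ∀ x → Dec (P x)) (f : Fin m → A) →
                        length (filter P? (cartesianProduct (tabulate f) (allFin n))) ≡ sum (λ i → sum (λ j → ι (does
                            (P? (f i , j)))))
length-filter-product {zero}      P? f = refl
length-filter-product {suc m} {n} P? f = begin
  length (filter P? (row ++ rest))                  ≡⟨ cong length (filter-++ P? row rest) ⟩
  length (filter P? row ++ filter P? rest)          ≡⟨ length-++ (filter P? row) ⟩
  length (filter P? row) + length (filter P? rest) ≡⟨ cong₂ _+_ (trans (length-filter-map P? (f zero ,_) (allFin n))
      (length-filter-tabulate (P? ∘ (f zero ,_)) {n} id))
                                                              (length-filter-product P? (f ∘ suc)) ⟩
  sum (λ i → sum (λ j → ι (does (P? (f i , j)))))   ∎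
  where
  open ≡-Reasoning
  row  = map (f zero ,_) (allFin n)
  rest = cartesianProduct (tabulate (f ∘ suc)) (allFin n)

triple : ∀ {X : Set} → X → X → X → Fin 3 → X
triple x y z 0F = x
triple x y z 1F = y
triple x y z 2F = z

triple-injective : ∀ {X : Set} {x y z : X} → x ≢ y → x ≢ z → y ≢ z → ∀ {i j} → triple x y z i ≡ triple x y z j → i ≡ j
triple-injective p q r {0F} {0F} e = refl
triple-injective p q r {0F} {1F} e = ⊥-elim (p e)
triple-injective p q r {0F} {2F} e = ⊥-elim (q e)
triple-injective p q r {1F} {0F} e = ⊥-elim (p (sym e))
triple-injective p q r {1F} {1F} e = refl
triple-injective p q r {1F} {2F} e = ⊥-elim (r e)
triple-injective p q r {2F} {0F} e = ⊥-elim (q (sym e))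
triple-injective p q r {2F} {1F} e = ⊥-elim (r (sym e))
triple-injective p q r {2F} {2F} e = refl

upper : ∀ {n} → (Fin n → Fin n → ℕ) → ℕ
upper e = sum λ x → sum λ y → if does (x Fin.<? y) then e x y else 0

-- The entries above and below the diagonal have equal sums. This serves the handshake identity and
-- the parity of degree sums in induced subgraphs.
sum-symmetric : ∀ {n} (e : Fin n → Fin n → ℕ) → (∀ x y → e x y ≡ e y x) → (∀ x → e x x ≡ 0) →
                sum (λ x → sum (e x)) ≡ 2 * upper e
sum-symmetric {n} e e-sym e-0 = begin
  sum (λ x → sum (e x)) ≡⟨ sum-cong (λ x → trans (sum-cong (split x)) (sum-+ (lo x) (hi x))) ⟩
  sum (λ x → sum (lo x) + sum (hi x))                          ≡⟨ sum-+ (λ x → sum (lo x)) (λ x → sum (hi x)) ⟩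
  upper e + sum (λ x → sum (hi x))                             ≡⟨ cong (upper e +_) (sum-swap hi) ⟩
  upper e + sum (λ y → sum (λ x → hi x y)) ≡⟨ cong (upper e +_) (sum-cong λ y → sum-cong λ x → flip y x) ⟩
  upper e + upper e                                            ≡⟨ cong (upper e +_) (+-identityʳ _) ⟨
  2 * upper e                                                  ∎
  where
  open ≡-Reasoning
  lo hi : Fin n → Fin n → ℕ
  lo x y = if does (x Fin.<? y) then e x y else 0
  hi x y = if does (y Fin.<? x) then e x y else 0
  split : ∀ x y → e x y ≡ lo x y + hi x y
  split x y with Fin.<-cmp x y
  ... | tri< p _ q rewrite dec-true (x Fin.<? y) p | dec-false (y Fin.<? x) q = sym (+-identityʳ _)
  ... | tri≈ p refl q rewrite dec-false (x Fin.<? y) p = e-0 x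
  ... | tri> p _ q rewrite dec-true (y Fin.<? x) q | dec-false (x Fin.<? y) p = refl
  flip : ∀ y x → hi x y ≡ lo y x
  flip y x rewrite e-sym x y = refl

-- Degrees, double counting and links in a graph

module Adjacency {n : ℕ} (G : Graph n) where
  open Graph G

  adj : Fin n → Sub n
  adj x y = does (x ~? y)

  ~⇒adj : ∀ {x y} → x ~ y → y ∈ adj x
  ~⇒adj {x} {y} p = dec-true (x ~? y) p

  adj⇒~ : ∀ {x y} → y ∈ adj x → x ~ y
  adj⇒~ {x} {y} p with x ~? y
  ... | yes q = q

  adj-sym : ∀ x y → adj x y ≡ adj y x
  adj-sym x y with x ~? y
  ... | yes p = sym (~⇒adj (~-sym p))
  ... | no ¬p = sym (dec-false (y ~? x) (¬p ∘ ~-sym))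

  adj-flip : ∀ {x y} → y ∈ adj x → x ∈ adj y
  adj-flip {x} {y} p = trans (adj-sym y x) p

  adj-irrefl : ∀ x → adj x x ≡ false
  adj-irrefl x = dec-false (x ~? x) (~-irrefl refl)

  adj⇒≢ : ∀ {x y} → y ∈ adj x → x ≢ y
  adj⇒≢ p refl = ~-irrefl refl (adj⇒~ p)

  deg-in : Sub n → Fin n → ℕ
  deg-in S x = # (S ∩ adj x)

  d : Fin n → ℕ
  d x = # adj x

  degree≡d : ∀ x → degree x ≡ d x
  degree≡d x = length-filter-tabulate (x ~?_) id

  handshake : sum d ≡ 2 * edgeCount
  handshake = trans (sum-symmetric (λ x y → ι (adj x y)) (λ x y → cong ι (adj-sym x y)) (λ x → cong ι (adj-irrefl x)))
                    (cong (2 *_) (sym (trans (length-filter-product (λ (x , y) → (x Fin.<? y) ×-dec (x ~? y)) id)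
                        (sum-cong λ x → sum-cong λ y → lem x y))))
    where
    lem : ∀ x y → ι (does (x Fin.<? y) ∧ adj x y) ≡ (if does (x Fin.<? y) then ι (adj x y) else 0)
    lem x y with does (x Fin.<? y)
    ... | true  = refl
    ... | false = refl

  private
    on-sum : ∀ (S T : Sub n) x → on S (deg-in T) x ≡ sum (λ y → ι (S x ∧ (T y ∧ adj x y)))
    on-sum S T x with S x
    ... | true  = refl
    ... | false = sym (sum-const n 0)

    ∧-swap : ∀ a b {c c'} → c ≡ c' → ι (a ∧ (b ∧ c)) ≡ ι (b ∧ (a ∧ c'))
    ∧-swap true  true  refl = refl
    ∧-swap true  false refl = refl
    ∧-swap false true  refl = refl
    ∧-swap false false refl = refl

  double-count : ∀ (S T : Sub n) → sum (on S (deg-in T)) ≡ sum (on T (deg-in S))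
  double-count S T = begin
    sum (on S (deg-in T))                                 ≡⟨ sum-cong (on-sum S T) ⟩
    sum (λ x → sum (λ y → ι (S x ∧ (T y ∧ adj x y))))     ≡⟨ sum-swap (λ x y → ι (S x ∧ (T y ∧ adj x y))) ⟩
    sum (λ y → sum (λ x → ι (S x ∧ (T y ∧ adj x y)))) ≡⟨ sum-cong (λ y → sum-cong λ x → ∧-swap (S x) (T y) (adj-sym x
        y)) ⟩
    sum (λ y → sum (λ x → ι (T y ∧ (S x ∧ adj y x))))     ≡⟨ sum-cong (on-sum T S) ⟨
    sum (on T (deg-in S))                                 ∎
    where open ≡-Reasoning

  -- The witness is the number of edges of G[S]. Parity is what makes a degree sum above 20 in G[A]
  -- at least 22 in the case of minimum degree five.
  inner-even : ∀ (S : Sub n) → ∃[ k ] sum (on S (deg-in S)) ≡ 2 * k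
  inner-even S = upper (λ x y → ι (S x ∧ (S y ∧ adj x y))) , trans (sum-cong (on-sum S S)) (sum-symmetric (λ x y → ι
      (S x ∧ (S y ∧ adj x y)))
    (λ x y → ∧-swap (S x) (S y) (adj-sym x y))
    (λ x → trans (cong (λ b → ι (S x ∧ (S x ∧ b))) (adj-irrefl x)) (lem (S x))))
    where
    lem : ∀ b → ι (b ∧ (b ∧ false)) ≡ 0
    lem true  = refl
    lem false = refl

  -- A copy of K₃,₃ in G + uw that uses the new edge: u, P, Q on one side and
  -- w, R, S on the other.
  record Link (u w : Fin n) : Set where
    constructor link
    field
      P Q R S : Fin n
      uR : R ∈ adj u
      uS : S ∈ adj u
      wP : P ∈ adj w
      wQ : Q ∈ adj w
      PR : R ∈ adj P
      PS : S ∈ adj P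
      QR : R ∈ adj Q
      QS : S ∈ adj Q
      P≢Q : P ≢ Q
      R≢S : R ≢ S
      P≢u : P ≢ u
      Q≢u : Q ≢ u
      R≢w : R ≢ w
      S≢w : S ≢ w

  Link-sym : ∀ {u w} → Link u w → Link w u
  Link-sym l = record
    { P = R ; Q = S ; R = P ; S = Q ; uR = wP ; uS = wQ ; wP = uR ; wQ = uS
    ; PR = adj-flip PR ; PS = adj-flip QR ; QR = adj-flip PS ; QS = adj-flip QS
    ; P≢Q = R≢S ; R≢S = P≢Q ; P≢u = R≢w ; Q≢u = S≢w ; R≢w = P≢u ; S≢w = Q≢u }
    where open Link l

  -- Containment unfolded into two triples. That the triples are disjoint need not be demanded,
  -- since adjacent vertices differ.
  K₃₃-free : Set
  K₃₃-free = ∀ (a b : Fin 3 → Fin n) → (∀ {i j} → a i ≡ a j → i ≡ j) → (∀ {i j} → b i ≡ b j → i ≡ j) →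
             (∀ i j → b j ∈ adj (a i)) → ⊥

  private
    l r : Fin 3 → Fin 6
    l = _↑ˡ 3
    r = 3 ↑ʳ_

    l~r : ∀ i j → Graph._~_ (K 3 3) (l i) (r j)
    l~r 0F 0F ()
    l~r 0F 1F ()
    l~r 0F 2F ()
    l~r 1F 0F ()
    l~r 1F 1F ()
    l~r 1F 2F ()
    l~r 2F 0F ()
    l~r 2F 1F ()
    l~r 2F 2F ()

    l≢r : ∀ i j → l i ≢ r j
    l≢r 0F j ()
    l≢r 1F j ()
    l≢r 2F j ()

  K₃₃-copy : (f : Fin 6 → Fin n) → (∀ {x y} → f x ≡ f y → x ≡ y) → (∀ i j → f (r j) ∈ adj (f (l i))) → K 3 3
      ContainedIn G
  K₃₃-copy f inj h = f , inj , edge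
    where
    edge : ∀ x y → Graph._~_ (K 3 3) x y → f x ~ f y
    edge x y p with splitAt 3 x in ex | splitAt 3 y in ey
    ... | inj₁ i | inj₁ j = ⊥-elim (p refl)
    ... | inj₂ i | inj₂ j = ⊥-elim (p refl)
    ... | inj₁ i | inj₂ j = subst₂ (λ x y → f x ~ f y) (Fin.splitAt⁻¹-↑ˡ ex) (Fin.splitAt⁻¹-↑ʳ {3} ey) (adj⇒~ (h i j))
    ... | inj₂ i | inj₁ j = subst₂ (λ x y → f x ~ f y) (Fin.splitAt⁻¹-↑ʳ {3} ex) (Fin.splitAt⁻¹-↑ˡ ey) (~-sym (adj⇒~
        (h j i)))

  K₃₃-build : (a b : Fin 3 → Fin n) → (∀ {i j} → a i ≡ a j → i ≡ j) → (∀ {i j} → b i ≡ b j → i ≡ j) →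
              (∀ i j → b j ∈ adj (a i)) → K 3 3 ContainedIn G
  K₃₃-build a b a-inj b-inj h = K₃₃-copy f f-inj f-adj
    where
    f : Fin 6 → Fin n
    f = [ a , b ]′ ∘ splitAt 3
    f-adj : ∀ i j → f (r j) ∈ adj (f (l i))
    f-adj i j rewrite Fin.splitAt-↑ˡ 3 i 3 = h i j
    f-inj : ∀ {x y} → f x ≡ f y → x ≡ y
    f-inj {x} {y} p with splitAt 3 x in ex | splitAt 3 y in ey
    ... | inj₁ i | inj₁ j = trans (sym (Fin.splitAt⁻¹-↑ˡ ex)) (trans (cong l (a-inj p)) (Fin.splitAt⁻¹-↑ˡ ey))
    ... | inj₂ i | inj₂ j = trans (sym (Fin.splitAt⁻¹-↑ʳ {3} ex)) (trans (cong r (b-inj p)) (Fin.splitAt⁻¹-↑ʳ {3} ey))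
    ... | inj₁ i | inj₂ j = ⊥-elim (adj⇒≢ (h i j) p)
    ... | inj₂ i | inj₁ j = ⊥-elim (adj⇒≢ (h j i) (sym p))

  K₃₃-free⇐ : ¬ (K 3 3 ContainedIn G) → K₃₃-free
  K₃₃-free⇐ free a b a-inj b-inj h = free (K₃₃-build a b a-inj b-inj h)

  K₃₃-free⇒ : K₃₃-free → ¬ (K 3 3 ContainedIn G)
  K₃₃-free⇒ free (f , inj , edge) = free (f ∘ l) (f ∘ r) (Fin.↑ˡ-injective 3 _ _ ∘ inj) (Fin.↑ʳ-injective 3 _ _ ∘ inj)
    (λ i j → ~⇒adj (edge (l i) (r j) (l~r i j)))

  Linked : Set
  Linked = ∀ {u w} → u ≢ w → adj u w ≡ false → Link u w

  module _ {u w : Fin n} (e : Graph._~_ (complement G) u w) where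
    private
      open Graph (addEdge G u w e) using () renaming (_~_ to _~⁺_)

      -- `punchIn i` and `punchIn j` enumerate the other two vertices of each side. By injectivity
      -- of `f`, none of the edges recorded in the link can be the added one.
      extract : (f : Fin 6 → Fin n) → (∀ {x y} → f x ≡ f y → x ≡ y) → (∀ i j → f (l i) ~⁺ f (r j)) →
                ∀ i j → f (l i) ≡ u → f (r j) ≡ w → Link u w
      extract f inj h i j refl refl = record
        { P = f (l (punchIn i 0F)) ; Q = f (l (punchIn i 1F)) ; R = f (r (punchIn j 0F)) ; S = f (r (punchIn j 1F))
        ; uR = old′ _ ; uS = old′ _ ; wP = adj-flip (old _ _) ; wQ = adj-flip (old _ _)
        ; PR = old _ _ ; PS = old _ _ ; QR = old _ _ ; QS = old _ _
        ; P≢Q = λ p → case0≢1 (Fin.punchIn-injective i _ _ (Fin.↑ˡ-injective 3 _ _ (inj p)))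
        ; R≢S = λ p → case0≢1 (Fin.punchIn-injective j _ _ (Fin.↑ʳ-injective 3 _ _ (inj p)))
        ; P≢u = λ p → Fin.punchInᵢ≢i i _ (Fin.↑ˡ-injective 3 _ _ (inj p))
        ; Q≢u = λ p → Fin.punchInᵢ≢i i _ (Fin.↑ˡ-injective 3 _ _ (inj p))
        ; R≢w = λ p → Fin.punchInᵢ≢i j _ (Fin.↑ʳ-injective 3 _ _ (inj p))
        ; S≢w = λ p → Fin.punchInᵢ≢i j _ (Fin.↑ʳ-injective 3 _ _ (inj p)) }
        where
        case0≢1 : ¬ _≡_ {A = Fin 2} 0F 1F
        case0≢1 ()
        old : ∀ k j′ → f (r j′) ∈ adj (f (l (punchIn i k)))
        old k j′ with h (punchIn i k) j′
        ... | inj₁ p = ~⇒adj p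
        ... | inj₂ (inj₁ (p , _)) = ⊥-elim (Fin.punchInᵢ≢i i k (Fin.↑ˡ-injective 3 _ _ (inj p)))
        ... | inj₂ (inj₂ (p , _)) = ⊥-elim (l≢r _ j (inj p))
        old′ : ∀ k → f (r (punchIn j k)) ∈ adj (f (l i))
        old′ k with h i (punchIn j k)
        ... | inj₁ p = ~⇒adj p
        ... | inj₂ (inj₁ (_ , p)) = ⊥-elim (Fin.punchInᵢ≢i j k (Fin.↑ʳ-injective 3 _ _ (inj p)))
        ... | inj₂ (inj₂ (p , _)) = ⊥-elim (l≢r _ j (inj p))

    -- Some edge of the copy is missing from G, as G is K₃,₃-free, and so it is the added one. If
    -- the copy uses it from w to u, its two sides are exchanged.
    copy⇒Link : ¬ (K 3 3 ContainedIn G) → K 3 3 ContainedIn addEdge G u w e → Link u w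
    copy⇒Link free (f , inj , edge) with Fin.all? (λ i → Fin.all? (λ j → f (l i) ~? f (r j)))
    ... | yes all = ⊥-elim (free (K₃₃-copy f inj λ i j → ~⇒adj (all i j)))
    ... | no ¬all with Fin.¬∀⟶∃¬ 3 _ (λ i → Fin.all? (λ j → f (l i) ~? f (r j))) ¬all
    ...   | i , ¬all′ with Fin.¬∀⟶∃¬ 3 _ (λ j → f (l i) ~? f (r j)) ¬all′
    ...     | j , ¬ij with edge (l i) (r j) (l~r i j)
    ...       | inj₁ p = ⊥-elim (¬ij p)
    ...       | inj₂ (inj₁ (p , q)) = extract f inj (λ i j → edge (l i) (r j) (l~r i j)) i j p q
    ...       | inj₂ (inj₂ (p , q)) = Link-sym (extract′ q p)
      where
      swapped : Fin 6 → Fin n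
      swapped = [ f ∘ r , f ∘ l ]′ ∘ splitAt 3
      extract′ : f (r j) ≡ u → f (l i) ≡ w → Link w u
      extract′ p q = Link-sym (extract swapped swapped-inj swapped-edge j i (trans (cong [ f ∘ r , f ∘ l ]′
          (Fin.splitAt-↑ˡ 3 j 3)) p) q)
        where
        swapped-edge : ∀ i j → swapped (l i) ~⁺ swapped (r j)
        swapped-edge i j rewrite Fin.splitAt-↑ˡ 3 i 3 = Graph.~-sym (addEdge G u w e) (edge (l j) (r i) (l~r j i))
        swapped-inj : ∀ {x y} → swapped x ≡ swapped y → x ≡ y
        swapped-inj {x} {y} p with splitAt 3 x in ex | splitAt 3 y in ey
        ... | inj₁ i | inj₁ j = trans (sym (Fin.splitAt⁻¹-↑ˡ ex)) (trans (cong l (Fin.↑ʳ-injective 3 _ _ (inj p)))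
            (Fin.splitAt⁻¹-↑ˡ ey))
        ... | inj₂ i | inj₂ j = trans (sym (Fin.splitAt⁻¹-↑ʳ {3} ex)) (trans (cong r (Fin.↑ˡ-injective 3 _ _ (inj p)))
            (Fin.splitAt⁻¹-↑ʳ {3} ey))
        ... | inj₁ i | inj₂ j = ⊥-elim (l≢r j i (sym (inj p)))
        ... | inj₂ i | inj₁ j = ⊥-elim (l≢r i j (inj p))

  saturated⇒linked : Saturated (K 3 3) G → Linked
  saturated⇒linked (free , sat) {u} {w} u≢w uw = copy⇒Link e free (sat u w e)
    where
    e : Graph._~_ (complement G) u w
    e = u≢w , λ p → contradiction (trans (sym uw) (~⇒adj p)) λ ()

Link⇒copy : ∀ {n} (G : Graph n) {u w} (e : Graph._~_ (complement G) u w) → Adjacency.Link G u w → K 3 3 ContainedIn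
    addEdge G u w e
Link⇒copy {n} G {u} {w} e l = A⁺.K₃₃-build (triple u P Q) (triple w R S)
    (triple-injective (P≢u ∘ sym) (Q≢u ∘ sym) P≢Q) (triple-injective (R≢w ∘ sym) (S≢w ∘ sym) R≢S)
    λ { 0F 0F → A⁺.~⇒adj (inj₂ (inj₁ (refl , refl))) ; 0F 1F → old uR ; 0F 2F → old uS
      ; 1F 0F → old (adj-flip wP) ; 1F 1F → old PR ; 1F 2F → old PS
      ; 2F 0F → old (adj-flip wQ) ; 2F 1F → old QR ; 2F 2F → old QS }
  where
  open Adjacency G
  module A⁺ = Adjacency (addEdge G u w e)
  open Link l
  old : ∀ {x y} → y ∈ adj x → y ∈ A⁺.adj x
  old p = A⁺.~⇒adj (inj₁ (adj⇒~ p))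

linked⇒saturated : ∀ {n} (G : Graph n) → Adjacency.K₃₃-free G → Adjacency.Linked G → Saturated (K 3 3) G
linked⇒saturated G free linked = Adjacency.K₃₃-free⇒ G free , λ u w e → Link⇒copy G e
  (linked (proj₁ e) (¬∈⇒false {S = Adjacency.adj G u} (proj₂ e ∘ Adjacency.adj⇒~ G)))

-- Weighted sums over vertex subsets

Σ : ∀ {n} → Sub n → (Fin n → ℕ) → ℕ
Σ S f = sum (on S f)

Σs : ∀ {n k} → Sub n → Vec (Fin n → ℕ) k → Vec ℕ k
Σs S []       = []
Σs S (f ∷ fs) = Σ S f ∷ Σs S fs

Σ-eval : ∀ {n k} (S : Sub n) (e : Expr k) (fs : Vec (Fin n → ℕ) k) → Σ S (λ x → ⟦ e ⟧ (at fs x)) ≡ eval (# S) (Σs S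
    fs) e
Σ-eval S (var i) fs = go i fs
  where
  go : ∀ {k} (i : Fin k) (fs : Vec (Fin _ → ℕ) k) → Σ S (λ x → Vec.lookup (at fs x) i) ≡ Vec.lookup (Σs S fs) i
  go zero    (f ∷ fs) = refl
  go (suc i) (f ∷ fs) = go i fs
Σ-eval S (con c) fs = trans (sum-cong λ x → lem (S x)) (sum-* c (ι ∘ S))
  where
  lem : ∀ b → (if b then c * 1 else 0) ≡ c * ι b
  lem true  = refl
  lem false = sym (*-zeroʳ c)
Σ-eval S (e ⊕ f) fs = trans (sum-cong λ x → lem (S x)) (trans (sum-+ (on S (λ x → ⟦ e ⟧ (at fs x))) (on S (λ x → ⟦ f ⟧
    (at fs x))))
                            (cong₂ _+_ (Σ-eval S e fs) (Σ-eval S f fs)))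
  where
  lem : ∀ b {p q : ℕ} → (if b then p + q else 0) ≡ (if b then p else 0) + (if b then q else 0)
  lem true  = refl
  lem false = refl
Σ-eval S (c ⊙ e) fs = trans (sum-cong λ x → lem (S x)) (trans (sum-* c (on S (λ x → ⟦ e ⟧ (at fs x)))) (cong (c *_)
    (Σ-eval S e fs)))
  where
  lem : ∀ b {p : ℕ} → (if b then c * p else 0) ≡ c * (if b then p else 0)
  lem true  = refl
  lem false = sym (*-zeroʳ c)

Σ-mono : ∀ {n} (S : Sub n) {f g : Fin n → ℕ} → (∀ x → x ∈ S → f x ≤ g x) → Σ S f ≤ Σ S g
Σ-mono S {f} {g} h = sum-mono λ x → lem x
  where
  lem : ∀ x → on S f x ≤ on S g x
  lem x with S x in eq
  ... | true  = h x eq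
  ... | false = z≤n

Σ-cong : ∀ {n} (S : Sub n) {f g : Fin n → ℕ} → (∀ x → x ∈ S → f x ≡ g x) → Σ S f ≡ Σ S g
Σ-cong S h = ≤-antisym (Σ-mono S λ x p → ≤-reflexive (h x p)) (Σ-mono S λ x p → ≤-reflexive (sym (h x p)))

-- A linear relation between functions, valid pointwise on S, may be summed
-- over S: constants are multiplied by # S.
Σ-⊑ : ∀ {n k} (S : Sub n) (fs : Vec (Fin n → ℕ) k) (l r : Expr k) →
      (∀ x → x ∈ S → ⟦ l ⟧ (at fs x) ≤ ⟦ r ⟧ (at fs x)) → eval (# S) (Σs S fs) l ≤ eval (# S) (Σs S fs) r
Σ-⊑ S fs l r h = subst₂ _≤_ (Σ-eval S l fs) (Σ-eval S r fs) (Σ-mono S h)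

Σ-≋ : ∀ {n k} (S : Sub n) (fs : Vec (Fin n → ℕ) k) (l r : Expr k) →
      (∀ x → x ∈ S → ⟦ l ⟧ (at fs x) ≡ ⟦ r ⟧ (at fs x)) → eval (# S) (Σs S fs) l ≡ eval (# S) (Σs S fs) r
Σ-≋ S fs l r h = trans (sym (Σ-eval S l fs)) (trans (Σ-cong S h) (Σ-eval S r fs))

∁ : ∀ {n} → Sub n → Sub n
∁ S x = not (S x)

∁⁺ : ∀ {n} (S : Sub n) {x} → ¬ x ∈ S → x ∈ ∁ S
∁⁺ S p = cong not (¬∈⇒false {S = S} p)

∁⁻ : ∀ {n} (S : Sub n) {x} → x ∈ ∁ S → ¬ x ∈ S
∁⁻ S {x} p q with S x
∁⁻ S () q | true

∈? : ∀ {n} (S : Sub n) x → Dec (x ∈ S)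
∈? S x = S x Bool.≟ true

Σ-split : ∀ {n} (S P : Sub n) f → Σ S f ≡ Σ (S ∩ P) f + Σ (S ∩ ∁ P) f
Σ-split S P f = trans (sum-cong λ x → lem (S x) (P x)) (sum-+ (on (S ∩ P) f) (on (S ∩ ∁ P) f))
  where
  lem : ∀ a b {p : ℕ} → (if a then p else 0) ≡ (if a ∧ b then p else 0) + (if a ∧ not b then p else 0)
  lem true  true  = sym (+-identityʳ _)
  lem true  false = refl
  lem false _     = refl

#≡Σ : ∀ {n} (S : Sub n) → # S ≡ Σ S (λ _ → 1)
#≡Σ S = sum-cong λ x → lem (S x)
  where
  lem : ∀ b → ι b ≡ (if b then 1 else 0)
  lem true  = refl
  lem false = refl

#-∩∁ : ∀ {n} (S P : Sub n) → # S ≡ # (S ∩ P) + # (S ∩ ∁ P)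
#-∩∁ S P = trans (#≡Σ S) (trans (Σ-split S P _) (sym (cong₂ _+_ (#≡Σ (S ∩ P)) (#≡Σ (S ∩ ∁ P)))))

Σ-⊆ : ∀ {n} (S T : Sub n) f → (∀ {x} → x ∈ S → x ∈ T) → Σ S f ≤ Σ T f
Σ-⊆ S T f h = sum-mono λ x → lem x
  where
  lem : ∀ x → on S f x ≤ on T f x
  lem x with S x in eq
  ... | false = z≤n
  ... | true rewrite h eq = ≤-refl

∈⇒≤Σ : ∀ {n} (S : Sub n) f {x} → x ∈ S → f x ≤ Σ S f
∈⇒≤Σ S f {x} p = ≤-trans (≤-reflexive (sym (lem p))) (≤-sum x (on S f))
  where
  lem : x ∈ S → on S f x ≡ f x
  lem p rewrite p = refl

Σ-remove : ∀ {n} (S : Sub n) f {x} → x ∈ S → Σ S f ≡ f x + Σ (S ∩ isnt x) f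
Σ-remove S f {x} p = trans (sum-split x (on S f)) (cong₂ _+_ (cong (λ b → if b then f x else 0) p) (sum-cong λ y → lem
    (isnt x y) (S y)))
  where
  lem : ∀ a b {p : ℕ} → (if a then (if b then p else 0) else 0) ≡ (if b ∧ a then p else 0)
  lem true  true  = refl
  lem true  false = refl
  lem false true  = refl
  lem false false = refl

≥? : ∀ {n} → ℕ → (Fin n → ℕ) → Sub n
≥? k f x = k ≤ᵇ f x

≥?⁺ : ∀ {n} k (f : Fin n → ℕ) {x} → k ≤ f x → x ∈ ≥? k f
≥?⁺ k f {x} p with k ≤ᵇ f x in eq
... | true  = refl
... | false = ⊥-elim (subst T eq (≤⇒≤ᵇ p))

≥?⁻ : ∀ {n} k (f : Fin n → ℕ) {x} → x ∈ ≥? k f → k ≤ f x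
≥?⁻ k f {x} p = ≤ᵇ⇒≤ k (f x) (subst T (sym p) tt)

∁≥?⁻ : ∀ {n} k (f : Fin n → ℕ) {x} → x ∈ ∁ (≥? k f) → f x < k
∁≥?⁻ k f p = ≰⇒> λ q → ∁⁻ (≥? k f) p (≥?⁺ k f q)

-- Classes of vertices around a root

module Rooted {n : ℕ} (G : Graph n) (v : Fin n) where
  open Adjacency G

  N O : Sub n
  N   = adj v
  O x = not (does (v Fin.≟ x)) ∧ not (adj v x)

  dN dO : Fin n → ℕ
  dN = deg-in N
  dO = deg-in O

  v∉N : adj v v ≡ false
  v∉N = adj-irrefl v

  O⇒≢ : ∀ {x} → x ∈ O → x ≢ v
  O⇒≢ p q = isnt⇒≢ (∩ˡ (isnt v) (∁ N) p) (sym q)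

  O⇒∉N : ∀ {x} → x ∈ O → adj v x ≡ false
  O⇒∉N p = ¬∈⇒false {S = N} (∁⁻ N (∩ʳ (isnt v) (∁ N) p))

  O⁺ : ∀ {x} → x ≢ v → ¬ x ∈ N → x ∈ O
  O⁺ p q = ∩⁺ (isnt v) (∁ N) (≢⇒isnt (p ∘ sym)) (∁⁺ N q)

  O⇒¬v : ∀ {x} → x ∈ O → adj x v ≡ false
  O⇒¬v p = trans (adj-sym _ v) (O⇒∉N p)

  trichotomy : ∀ x → x ≡ v ⊎ x ∈ N ⊎ x ∈ O
  trichotomy x with x Fin.≟ v | ∈? N x
  ... | yes p | _     = inj₁ p
  ... | no _  | yes q = inj₂ (inj₁ q)
  ... | no p  | no q  = inj₂ (inj₂ (O⁺ p q))

  total : ∀ f → sum f ≡ f v + (Σ N f + Σ O f)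
  total f = trans (sum-split v f) (cong (f v +_) (trans (sum-cong lem) (sum-+ (on N f) (on O f))))
    where
    lem : ∀ x → on (isnt v) f x ≡ on N f x + on O f x
    lem x with v Fin.≟ x
    ... | yes refl rewrite v∉N = refl
    ... | no _ with adj v x
    ...   | true  = sym (+-identityʳ _)
    ...   | false = refl

  order : n ≡ 1 + (# N + # O)
  order = trans (sym (trans (sum-const n 1) (*-identityˡ n))) (trans (total (λ _ → 1))
                (cong suc (sym (cong₂ _+_ (#≡Σ N) (#≡Σ O)))))

  d-split : ∀ x → d x ≡ ι (adj x v) + (dN x + dO x)
  d-split x = trans (total (ι ∘ adj x)) (cong (ι (adj x v) +_) (cong₂ _+_ (sum-cong λ y → lem (N y)) (sum-cong λ y →
      lem (O y))))
    where
    lem : ∀ a {b} → (if a then ι b else 0) ≡ ι (a ∧ b)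
    lem true  = refl
    lem false = refl

  d-N : ∀ {x} → x ∈ N → d x ≡ 1 + (dN x + dO x)
  d-N {x} p = trans (d-split x) (cong (λ b → ι b + (dN x + dO x)) (adj-flip p))

  d-O : ∀ {x} → x ∈ O → d x ≡ dN x + dO x
  d-O {x} p = trans (d-split x) (cong (λ b → ι b + (dN x + dO x)) (O⇒¬v p))

  deg-in-∩ : ∀ S P x → deg-in S x ≡ deg-in (S ∩ P) x + deg-in (S ∩ ∁ P) x
  deg-in-∩ S P x = trans (sum-cong λ y → lem (S y) (P y) (adj x y)) (sum-+ (ι ∘ ((S ∩ P) ∩ adj x)) (ι ∘ ((S ∩ ∁ P) ∩
      adj x)))
    where
    lem : ∀ a b c → ι (a ∧ c) ≡ ι ((a ∧ b) ∧ c) + ι ((a ∧ not b) ∧ c)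
    lem true  true  true  = refl
    lem true  true  false = refl
    lem true  false _     = refl
    lem false _     _     = refl

  -- Vertices other than v with two neighbours in N are the only candidates for `P` and `Q` in a
  -- link from v; they form `A` outside N[v] and `N₂` inside N. The rest of `O` consists of `C`,
  -- with one neighbour in N, and `Z`, with none.
  A O₁ C Z N₂ : Sub n
  A  = O ∩ ≥? 2 dN
  O₁ = O ∩ ∁ (≥? 2 dN)
  C  = O₁ ∩ ≥? 1 dN
  Z  = O₁ ∩ ∁ (≥? 1 dN)
  N₂ = N ∩ ≥? 2 dN

  dA dC dZ : Fin n → ℕ
  dA = deg-in A
  dC = deg-in C
  dZ = deg-in Z

  A⇒O : ∀ {x} → x ∈ A → x ∈ O
  A⇒O = ∩ˡ O (≥? 2 dN)

  A⇒2≤dN : ∀ {x} → x ∈ A → 2 ≤ dN x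
  A⇒2≤dN p = ≥?⁻ 2 dN (∩ʳ O (≥? 2 dN) p)

  A⁺ : ∀ {x} → x ∈ O → 2 ≤ dN x → x ∈ A
  A⁺ p q = ∩⁺ O (≥? 2 dN) p (≥?⁺ 2 dN q)

  O₁⇒O : ∀ {x} → x ∈ O₁ → x ∈ O
  O₁⇒O = ∩ˡ O (∁ (≥? 2 dN))

  O₁⇒dN<2 : ∀ {x} → x ∈ O₁ → dN x < 2
  O₁⇒dN<2 p = ∁≥?⁻ 2 dN (∩ʳ O (∁ (≥? 2 dN)) p)

  C⇒O : ∀ {x} → x ∈ C → x ∈ O
  C⇒O p = O₁⇒O (∩ˡ O₁ (≥? 1 dN) p)

  C⇒dN≡1 : ∀ {x} → x ∈ C → dN x ≡ 1
  C⇒dN≡1 p = ≤-antisym (≤-pred (O₁⇒dN<2 (∩ˡ O₁ (≥? 1 dN) p))) (≥?⁻ 1 dN (∩ʳ O₁ (≥? 1 dN) p))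

  Z⇒O : ∀ {x} → x ∈ Z → x ∈ O
  Z⇒O p = O₁⇒O (∩ˡ O₁ (∁ (≥? 1 dN)) p)

  Z⇒dN≡0 : ∀ {x} → x ∈ Z → dN x ≡ 0
  Z⇒dN≡0 p = n≤0⇒n≡0 (≤-pred (∁≥?⁻ 1 dN (∩ʳ O₁ (∁ (≥? 1 dN)) p)))

  N₂⇒N : ∀ {x} → x ∈ N₂ → x ∈ N
  N₂⇒N = ∩ˡ N (≥? 2 dN)

  N₂⇒2≤dN : ∀ {x} → x ∈ N₂ → 2 ≤ dN x
  N₂⇒2≤dN p = ≥?⁻ 2 dN (∩ʳ N (≥? 2 dN) p)

  Z-N : ∀ {z c} → z ∈ Z → c ∈ N → adj z c ≡ false
  Z-N {z} {c} p q = ¬∈⇒false {S = adj z} λ r →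
    contradiction (length≤# (N ∩ adj z) ([] ∷ []) (∩⁺ N (adj z) q r ∷ [])) (<⇒≱ (s≤s (≤-reflexive (Z⇒dN≡0 p))))

  Σ-classes : ∀ f → Σ O f ≡ Σ A f + (Σ C f + Σ Z f)
  Σ-classes f = trans (Σ-split O (≥? 2 dN) f) (cong (Σ A f +_) (Σ-split O₁ (≥? 1 dN) f))

  #-classes : # O ≡ # A + (# C + # Z)
  #-classes = trans (#-∩∁ O (≥? 2 dN)) (cong (# A +_) (#-∩∁ O₁ (≥? 1 dN)))

  dO-classes : ∀ x → dO x ≡ dA x + (dC x + dZ x)
  dO-classes x = trans (deg-in-∩ O (≥? 2 dN) x) (cong (dA x +_) (deg-in-∩ O₁ (≥? 1 dN) x))

  -- In a copy of K₃,₃ created by joining v to w, the two vertices on the side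
  -- of v have two neighbours in N each.
  module _ (linked : Linked) where
    link-O : ∀ {w} → w ∈ O → Link v w
    link-O p = linked (O⇒≢ p ∘ sym) (O⇒∉N p)

    2≤dN-P : ∀ {w} (l : Link v w) → 2 ≤ dN (Link.P l) × 2 ≤ dN (Link.Q l)
    2≤dN-P l = length≤# (N ∩ adj P) ((R≢S ∷ []) ∷ [] ∷ []) (∩⁺ N (adj P) uR PR ∷ ∩⁺ N (adj P) uS PS ∷ [])
             , length≤# (N ∩ adj Q) ((R≢S ∷ []) ∷ [] ∷ []) (∩⁺ N (adj Q) uR QR ∷ ∩⁺ N (adj Q) uS QS ∷ [])
      where open Link l

    -- `P` and `Q` are distinct neighbours of w, and `A` and `N₂` partition the set
    -- `isnt v ∩ ≥? 2 dN` containing them.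
    served : ∀ {w} → w ∈ O → 2 ≤ dA w + deg-in N₂ w
    served {w} p = subst (2 ≤_) (sym (trans (sym (sum-+ (ι ∘ (A ∩ adj w)) (ι ∘ (N₂ ∩ adj w)))) (sum-cong lem)))
      (length≤# (isnt v ∩ ≥? 2 dN ∩ adj w) ((P≢Q ∷ []) ∷ [] ∷ [])
        ( ∩⁺ (isnt v ∩ ≥? 2 dN) (adj w) (∩⁺ (isnt v) (≥? 2 dN) (≢⇒isnt (P≢u ∘ sym)) (≥?⁺ 2 dN (proj₁ (2≤dN-P l)))) wP
        ∷ ∩⁺ (isnt v ∩ ≥? 2 dN) (adj w) (∩⁺ (isnt v) (≥? 2 dN) (≢⇒isnt (Q≢u ∘ sym)) (≥?⁺ 2 dN (proj₂ (2≤dN-P l)))) wQ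
            ∷ []))
      where
      l = link-O p
      open Link l
      lem : ∀ x → ι ((A ∩ adj w) x) + ι ((N₂ ∩ adj w) x) ≡ ι ((isnt v ∩ ≥? 2 dN ∩ adj w) x)
      lem x with v Fin.≟ x
      ... | yes refl rewrite v∉N = refl
      ... | no _ with adj v x
      ...   | true = refl
      ...   | false = +-identityʳ _

-- Minimum degree five

-- Fewer than 3n − 9 edges means degree sum at most 6n − 20, since the degree
-- sum is even.
module Five {n : ℕ} (G : Graph n) (linked : Adjacency.Linked G) (5≤d : ∀ x → 5 ≤ Adjacency.d G x)
            (few : sum (Adjacency.d G) + 20 ≤ 6 * n) where
  open Adjacency G

  h : Fin n → ℕ
  h x = d x ∸ 5

  d≡5+h : ∀ x → d x ≡ 5 + h x
  d≡5+h x = sym (m+[n∸m]≡n (5≤d x))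

  module At (v : Fin n) (dv : d v ≡ 5) where
    open Rooted G v public

    private
      Σd-N : Σ N d ≡ 25 + Σ N h
      Σd-N = trans (Σ-≋ N (d ∷ h ∷ []) v0 (con 5 ⊕ v1) (λ x _ → d≡5+h x)) (cong (λ s → 5 * s + Σ N h) dv)

      Σd-O : Σ O d ≡ 5 * # O + Σ O h
      Σd-O = Σ-≋ O (d ∷ h ∷ []) v0 (con 5 ⊕ v1) (λ x _ → d≡5+h x)

      n≡6+m : n ≡ 1 + (5 + # O)
      n≡6+m = trans order (cong (λ s → 1 + (s + # O)) dv)

      Σd : sum d ≡ 5 + (Σ N d + Σ O d)
      Σd = trans (total d) (cong (_+ (Σ N d + Σ O d)) dv)

    ΣO-h : Σ O h ≡ Σ A h + (Σ C h + Σ Z h)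
    ΣO-h = Σ-classes h

    -- 14 = 5 + 25 + 20 - 36: the least degrees of v and of N, the assumed deficit, and six for each
    -- vertex of N[v].
    excess : Σ N h + Σ O h + 14 ≤ # O
    excess = (deduce (sum d ∷ n ∷ # O ∷ Σ N d ∷ Σ O d ∷ Σ N h ∷ Σ O h ∷ []) ((1 ∙ v0 ⊕ con 20 ⊑ 6 ⊙ v1) ∷ (0 ∣ 1 ∙ v0
        ≋ con 5 ⊕ (v3 ⊕ v4)) ∷ (0 ∣ 1 ∙ v3 ≋ con 25 ⊕ v5) ∷ (0 ∣ 1 ∙ v4 ≋ 5 ⊙ v2 ⊕ v6) ∷ (6 ∣ 0 ∙ v1 ≋ con 6 ⊕ v2) ∷
        []) 1 (v5 ⊕ v6 ⊕ con 14) (v2) few Σd Σd-N Σd-O n≡6+m)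

    private
      ΣN-d : Σ N d ≡ 1 * # N + (Σ N dN + Σ N dO)
      ΣN-d = Σ-≋ N (d ∷ dN ∷ dO ∷ []) v0 (con 1 ⊕ (v1 ⊕ v2)) (λ _ → d-N)

    ΣO-dN : Σ O dN ≡ Σ A dN + # C
    ΣO-dN = trans (Σ-classes dN) (cong (Σ A dN +_) (trans (cong₂ _+_ C1 Z0) (trans (+-identityʳ _) (*-identityˡ (#
        C)))))
      where
      C1 : Σ C dN ≡ 1 * # C
      C1 = Σ-≋ C (dN ∷ []) v0 (con 1) (λ _ → C⇒dN≡1)
      Z0 : Σ Z dN ≡ 0 * # Z
      Z0 = Σ-≋ Z (dN ∷ []) v0 (con 0) (λ _ → Z⇒dN≡0)

    -- Each of the five neighbours of v has 4 + h further neighbours, in N or in `O`. In the names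
    -- below, f stands for `Σ N dN`, k for `Σ N h` and e for `Σ N₂ dO`.
    ΣO-dN+f : Σ O dN + Σ N dN ≡ 20 + Σ N h
    ΣO-dN+f = ≤-antisym (deduce (Σ N d ∷ Σ N h ∷ # N ∷ Σ N dN ∷ Σ N dO ∷ Σ O dN ∷ []) ((1 ∣ 0 ∙ v0 ≋ con 25 ⊕ v1) ∷ (0
        ∣ 1 ∙ v0 ≋ 1 ⊙ v2 ⊕ (v3 ⊕ v4)) ∷ (0 ∣ 1 ∙ v2 ≋ con 5) ∷ (0 ∣ 1 ∙ v4 ≋ v5) ∷ []) 1 (v5 ⊕ v3) (con 20 ⊕ v1) Σd-N
        ΣN-d dv (double-count N O))
                        (deduce (Σ N d ∷ Σ N h ∷ # N ∷ Σ N dN ∷ Σ N dO ∷ Σ O dN ∷ []) ((0 ∣ 1 ∙ v0 ≋ con 25 ⊕ v1) ∷ (1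
                            ∣ 0 ∙ v0 ≋ 1 ⊙ v2 ⊕ (v3 ⊕ v4)) ∷ (1 ∣ 0 ∙ v2 ≋ con 5) ∷ (1 ∣ 0 ∙ v4 ≋ v5) ∷ []) 1 (con 20
                            ⊕ v1) (v5 ⊕ v3) Σd-N ΣN-d dv (double-count N O))

    ΣA-d : 5 * # A + Σ A h ≡ Σ A dN + Σ A dO
    ΣA-d = trans (sym (Σ-≋ A (d ∷ h ∷ []) v0 (con 5 ⊕ v1) (λ x _ → d≡5+h x)))
                 (Σ-≋ A (d ∷ dN ∷ dO ∷ []) v0 (v1 ⊕ v2) (λ _ → d-O ∘ A⇒O))

    ΣA-dN≥ : 2 * # A ≤ Σ A dN
    ΣA-dN≥ = Σ-⊑ A (dN ∷ []) (con 2) v0 (λ _ → A⇒2≤dN)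

    all-served : 2 * # O ≤ Σ A dO + Σ N₂ dO
    all-served = subst (2 * # O ≤_) (cong₂ _+_ (double-count O A) (double-count O N₂))
                       (Σ-⊑ O (dA ∷ deg-in N₂ ∷ []) (con 2) (v0 ⊕ v1) (λ _ → served linked))

    dO-N : ∀ {c} → c ∈ N → dO c + dN c ≡ 4 + h c
    dO-N {c} p = suc-injective (trans (cong suc (+-comm (dO c) (dN c))) (trans (sym (d-N p)) (d≡5+h c)))

    -- Of the 4 + h neighbours besides v at least two lie in N, so at most 2 + h ≤ dN + h lie in
    -- `O`.
    ΣN₂-dO≤ : Σ N₂ dO ≤ Σ N₂ dN + Σ N₂ h
    ΣN₂-dO≤ = Σ-⊑ N₂ (dO ∷ dN ∷ h ∷ []) v0 (v1 ⊕ v2) λ x p →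
      (deduce (dO x ∷ dN x ∷ h x ∷ []) ((1 ∣ 0 ∙ v0 ⊕ v1 ≋ con 4 ⊕ v2) ∷ (2 ∙ con 2 ⊑ v1) ∷ []) 1 (v0) (v1 ⊕ v2) (dO-N
          (N₂⇒N p)) (N₂⇒2≤dN p))

    ΣN₂-dO≤f+k : Σ N₂ dO ≤ Σ N dN + Σ N h
    ΣN₂-dO≤f+k = ≤-trans ΣN₂-dO≤ (+-mono-≤ (Σ-⊆ N₂ N dN N₂⇒N) (Σ-⊆ N₂ N h N₂⇒N))

    -- Both neighbours of c in N have c itself as a neighbour in N, so the three terms are at least
    -- 2, 1 and 1; this is the 4 of the name.
    N₂⇒4≤f : ∀ {c} → c ∈ N₂ → ∃[ x ] ∃[ y ] (x ∈ N × y ∈ N × x ≢ y × c ∈ adj x × c ∈ adj y) × dN c + (dN x + dN y) ≤ Σ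
        N dN
    N₂⇒4≤f {c} p =
      let x , y , px , py , x≢y = #≥2⇒∃ (N ∩ adj c) (N₂⇒2≤dN p)
          x∈N = ∩ˡ N (adj c) px ; y∈N = ∩ˡ N (adj c) py
          cx  = ∩ʳ N (adj c) px ; cy  = ∩ʳ N (adj c) py
      in x , y , (x∈N , y∈N , x≢y , adj-flip cx , adj-flip cy) ,
         three (N₂⇒N p) x∈N y∈N (adj⇒≢ cx) (adj⇒≢ cy) x≢y
      where
      three : ∀ {x y z} → x ∈ N → y ∈ N → z ∈ N → x ≢ y → x ≢ z → y ≢ z → dN x + (dN y + dN z) ≤ Σ N dN
      three {x} {y} {z} p q r x≢y x≢z y≢z
        rewrite sum-split x (on N dN) | p
              | sum-split y (on (isnt x) (on N dN)) | ≢⇒isnt x≢y | q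
              | sum-split z (on (isnt y) (on (isnt x) (on N dN))) | ≢⇒isnt y≢z | ≢⇒isnt x≢z | r
        = +-monoʳ-≤ (dN x) (+-monoʳ-≤ (dN y) (m≤m+n (dN z) _))

    1≤dN : ∀ {x c} → c ∈ N → c ∈ adj x → 1 ≤ dN x
    1≤dN {x} p q = length≤# (N ∩ adj x) ([] ∷ []) (∩⁺ N (adj x) p q ∷ [])

    N₂-empty : (∀ x → ¬ x ∈ N₂) → Σ N₂ dO ≡ 0
    N₂-empty none = sum-0 λ x → lem x
      where
      lem : ∀ x → on N₂ dO x ≡ 0
      lem x with N₂ x in eq
      ... | true  = ⊥-elim (none x eq)
      ... | false = refl

    N₂? : (∃[ c ] c ∈ N₂) ⊎ (∀ x → ¬ x ∈ N₂)
    N₂? with Fin.any? (∈? N₂)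
    ... | yes p = inj₁ p
    ... | no ¬p = inj₂ λ x q → ¬p (x , q)

    dA≥2-Z : ∀ {z} → z ∈ Z → 2 ≤ dA z
    dA≥2-Z {z} p = ≤-trans (served linked (Z⇒O p)) (≤-reflexive (trans (cong (dA z +_) (#≡0 (N₂ ∩ adj z) λ c q →
      contradiction (trans (sym (Z-N {z} {c} p (N₂⇒N (∩ˡ N₂ (adj z) q)))) (∩ʳ N₂ (adj z) q)) λ ())) (+-identityʳ _)))

    neighbour-class : ∀ {a x} → a ∈ O → x ∈ adj a → x ∈ N ⊎ x ∈ A ⊎ x ∈ C ⊎ x ∈ Z
    neighbour-class {a} {x} p q with trichotomy x | ∈? (≥? 2 dN) x | ∈? (≥? 1 dN) x
    ... | inj₁ refl     | _     | _     = contradiction (trans (sym (O⇒¬v p)) q) λ ()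
    ... | inj₂ (inj₁ r) | _     | _     = inj₁ r
    ... | inj₂ (inj₂ r) | yes s | _     = inj₂ (inj₁ (∩⁺ O (≥? 2 dN) r s))
    ... | inj₂ (inj₂ r) | no s | yes t = inj₂ (inj₂ (inj₁ (∩⁺ O₁ (≥? 1 dN) (∩⁺ O (∁ (≥? 2 dN)) r (∁⁺ (≥? 2 dN) s))
        t)))
    ... | inj₂ (inj₂ r) | no s | no t = inj₂ (inj₂ (inj₂ (∩⁺ O₁ (∁ (≥? 1 dN)) (∩⁺ O (∁ (≥? 2 dN)) r (∁⁺ (≥? 2 dN) s))
        (∁⁺ (≥? 1 dN) t))))

    neighbour-O : ∀ {z x} → z ∈ Z → x ∈ adj z → x ∈ O
    neighbour-O {z} {x} p q with trichotomy x
    ... | inj₁ refl     = contradiction (trans (sym (O⇒¬v (Z⇒O p))) q) λ ()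
    ... | inj₂ (inj₁ r) = contradiction (trans (sym (Z-N p r)) q) λ ()
    ... | inj₂ (inj₂ r) = r

    -- Positive if x or a neighbour of x in O has degree above five.
    touch : Fin n → ℕ
    touch x = h x + deg-in (O ∩ ≥? 1 h) x

    -- Such a neighbour takes up one more unit of degree, so that at most 2 + h neighbours in `Z`
    -- remain for a vertex of `A`, and at most 3 + h for a vertex of `C`.
    Good : Set
    Good = ∀ {w} → w ∈ O → 1 ≤ dA w

    -- The neighbourhood of a bad vertex splits into two vertices of N and three
    -- of Z without edges between them, so it contains no 4-cycle.
    Bad : Fin n → Set
    Bad a = a ∈ A × d a ≡ 5 × 3 ≤ dZ a

  -- Degree five forces two neighbours in N and three in `Z`. In a link from a, `P` and `Q` cannot
  -- both be neighbours of a, as they would form a 4-cycle with `R` and `S`; the one outside lies in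
  -- the class `A` of the new root a.
  good-at-bad : ∀ v (dv : d v ≡ 5) {a} → At.Bad v dv a → Σ[ da ∈ d a ≡ 5 ] At.Good a da
  good-at-bad v dv {a} (a∈A , da , 3≤dZ) = da , good
    where
    open At v dv
    module B = At a da
    split : dN a + (dA a + (dC a + dZ a)) ≡ 5
    split = trans (cong (dN a +_) (sym (dO-classes a))) (trans (sym (d-O (A⇒O a∈A))) da)
    dN≤2 : dN a ≤ 2
    dN≤2 = (deduce (dN a ∷ dA a ∷ dC a ∷ dZ a ∷ []) ((1 ∣ 0 ∙ v0 ⊕ (v1 ⊕ (v2 ⊕ v3)) ≋ con 5) ∷ (1 ∙ con 3 ⊑ v3) ∷ [])
        1 (v0) (con 2) split 3≤dZ)
    dZ≤3 : dZ a ≤ 3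
    dZ≤3 = (deduce (dN a ∷ dA a ∷ dC a ∷ dZ a ∷ []) ((1 ∣ 0 ∙ v0 ⊕ (v1 ⊕ (v2 ⊕ v3)) ≋ con 5) ∷ (1 ∙ con 2 ⊑ v0) ∷ [])
        1 (v3) (con 3) split (A⇒2≤dN a∈A))
    dA≤0 : dA a ≤ 0
    dA≤0 = (deduce (dN a ∷ dA a ∷ dC a ∷ dZ a ∷ []) ((1 ∣ 0 ∙ v0 ⊕ (v1 ⊕ (v2 ⊕ v3)) ≋ con 5) ∷ (1 ∙ con 2 ⊑ v0) ∷ (1 ∙
        con 3 ⊑ v3) ∷ []) 1 (v1) (con 0) split (A⇒2≤dN a∈A) 3≤dZ)
    dC≤0 : dC a ≤ 0
    dC≤0 = (deduce (dN a ∷ dA a ∷ dC a ∷ dZ a ∷ []) ((1 ∣ 0 ∙ v0 ⊕ (v1 ⊕ (v2 ⊕ v3)) ≋ con 5) ∷ (1 ∙ con 2 ⊑ v0) ∷ (1 ∙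
        con 3 ⊑ v3) ∷ []) 1 (v2) (con 0) split (A⇒2≤dN a∈A) 3≤dZ)
    N⊎Z : ∀ {x} → x ∈ adj a → x ∈ N ⊎ x ∈ Z
    N⊎Z {x} p with neighbour-class (A⇒O a∈A) p
    ... | inj₁ q = inj₁ q
    ... | inj₂ (inj₁ q) = contradiction (≤-trans (length≤# (A ∩ adj a) ([] ∷ []) (∩⁺ A (adj a) q p ∷ [])) dA≤0) λ ()
    ... | inj₂ (inj₂ (inj₁ q)) = contradiction (≤-trans (length≤# (C ∩ adj a) ([] ∷ []) (∩⁺ C (adj a) q p ∷ [])) dC≤0)
        λ ()
    ... | inj₂ (inj₂ (inj₂ q)) = inj₂ q
    N-closed : ∀ {x y} → x ∈ N → y ∈ adj a → y ∈ adj x → y ∈ N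
    N-closed p q r with N⊎Z q
    ... | inj₁ s = s
    ... | inj₂ s = contradiction (trans (sym (Z-N s p)) (adj-flip r)) λ ()
    Z-closed : ∀ {x y} → x ∈ Z → y ∈ adj a → y ∈ adj x → y ∈ Z
    Z-closed p q r with N⊎Z q
    ... | inj₂ s = s
    ... | inj₁ s = contradiction (trans (sym (Z-N p s)) r) λ ()
    no-C₄ : ∀ {w} (l : Link a w) → Link.P l ∈ adj a → Link.Q l ∈ adj a → ⊥
    no-C₄ l p q with N⊎Z p
    ... | inj₁ s = contradiction (≤-trans (length≤# (N ∩ adj a) ((adj⇒≢ PR ∷ adj⇒≢ PS ∷ []) ∷ (R≢S ∷ []) ∷ [] ∷ [])
                     (∩⁺ N (adj a) s p ∷ ∩⁺ N (adj a) (N-closed s uR PR) uR ∷ ∩⁺ N (adj a) (N-closed s uS PS) uS ∷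
                         [])) dN≤2) λ { (s≤s (s≤s ())) }
      where open Link l
    ... | inj₂ s = contradiction (≤-trans (length≤# (Z ∩ adj a) ((adj⇒≢ PR ∷ adj⇒≢ PS ∷ P≢Q ∷ []) ∷ (R≢S ∷ (adj⇒≢ QR ∘
        sym) ∷ []) ∷ ((adj⇒≢ QS ∘ sym) ∷ []) ∷ [] ∷ [])
                     (∩⁺ Z (adj a) s p ∷ ∩⁺ Z (adj a) r uR ∷ ∩⁺ Z (adj a) (Z-closed s uS PS) uS ∷ ∩⁺ Z (adj a)
                         (Z-closed r q (adj-flip QR)) q ∷ [])) dZ≤3) λ { (s≤s (s≤s (s≤s ()))) }
      where open Link l
            r = Z-closed s uR PR
    good : B.Good
    good {w} p with ∈? (adj a) (Link.P l) | ∈? (adj a) (Link.Q l)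
      where l = B.link-O linked p
    ... | yes q | yes r = ⊥-elim (no-C₄ (B.link-O linked p) q r)
    ... | no q | _ = length≤# (B.A ∩ adj w) ([] ∷ []) (∩⁺ B.A (adj w) (B.A⁺ (B.O⁺ (Link.P≢u l) q) (proj₁ (B.2≤dN-P
        linked l))) (Link.wP l) ∷ [])
      where l = B.link-O linked p
    ... | yes _ | no q = length≤# (B.A ∩ adj w) ([] ∷ []) (∩⁺ B.A (adj w) (B.A⁺ (B.O⁺ (Link.Q≢u l) q) (proj₂ (B.2≤dN-P
        linked l))) (Link.wQ l) ∷ [])
      where l = B.link-O linked p

  -- If v is not good, then N contains a 4-cycle; without bad vertices the
  -- degree sum would then exceed 6n − 20.
  good-root : ∀ v → d v ≡ 5 → ∃[ v′ ] Σ[ dv′ ∈ d v′ ≡ 5 ] At.Good v′ dv′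
  good-root v dv with Fin.any? (∈? (O ∩ ∁ (≥? 1 dA)))
    where open At v dv
  ... | no none = v , dv , good
    where
    open At v dv
    good : Good
    good {w} p with ∈? (≥? 1 dA) w
    ... | yes q = ≥?⁻ 1 dA q
    ... | no  q = ⊥-elim (none (w , ∩⁺ O (∁ (≥? 1 dA)) p (∁⁺ (≥? 1 dA) q)))
  ... | yes (w , p) with Fin.any? (∈? (A ∩ ≥? 3 dZ ∩ ∁ (≥? 6 d)))
    where open At v dv
  ...   | yes (a , q) = a , good-at-bad v dv {a} (∩ˡ A (≥? 3 dZ) (∩ˡ (A ∩ ≥? 3 dZ) (∁ (≥? 6 d)) q) ,
          ≤-antisym (≤-pred (∁≥?⁻ 6 d (∩ʳ (A ∩ ≥? 3 dZ) (∁ (≥? 6 d)) q))) (5≤d a) ,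
          ≥?⁻ 3 dZ (∩ʳ A (≥? 3 dZ) (∩ˡ (A ∩ ≥? 3 dZ) (∁ (≥? 6 d)) q)))
    where open At v dv
  ...   | no none = ⊥-elim
            (refute (# A ∷ # C ∷ # Z ∷ # O ∷ Σ N h ∷ Σ N dN ∷ Σ A dN ∷ Σ A h ∷ Σ C h ∷ Σ Z h ∷ Σ A dZ ∷ Σ Z dA ∷ Σ O h
                ∷ []) ((2 ∙ v4 ⊕ v12 ⊕ con 14 ⊑ v3) ∷ (0 ∣ 2 ∙ v12 ≋ v7 ⊕ (v8 ⊕ v9)) ∷ (2 ∣ 0 ∙ v3 ≋ v0 ⊕ (v1 ⊕ v2)) ∷
                (2 ∙ v6 ⊕ v1 ⊕ v5 ⊑ con 20 ⊕ v4) ∷ (2 ∙ con 8 ⊑ v5) ∷ (1 ∙ 12 ⊙ v0 ⊕ v10 ⊑ 10 ⊙ v0 ⊕ 2 ⊙ v7 ⊕ 2 ⊙ v6)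
                ∷ (1 ∙ 12 ⊙ v2 ⊑ 10 ⊙ v2 ⊕ 2 ⊙ v9 ⊕ v11) ∷ (0 ∣ 1 ∙ v10 ≋ v11) ∷ []) excess ΣO-h #-classes
                (≤-reflexive (trans (cong (_+ Σ N dN) (sym ΣO-dN)) ΣO-dN+f)) 8≤f sumA sumZ (double-count A Z))
    where
    open At v dv
    l = link-O linked (∩ˡ O (∁ (≥? 1 dA)) p)
    open Link l
    inN₂ : ∀ {x} → x ≢ v → 2 ≤ dN x → x ∈ adj w → x ∈ N₂
    inN₂ {x} x≢v q r with trichotomy x
    ... | inj₁ s = ⊥-elim (x≢v s)
    ... | inj₂ (inj₁ s) = ∩⁺ N (≥? 2 dN) s (≥?⁺ 2 dN q)
    ... | inj₂ (inj₂ s) = contradiction (length≤# (A ∩ adj w) ([] ∷ []) (∩⁺ A (adj w) (A⁺ s q) r ∷ [])) (<⇒≱ (∁≥?⁻ 1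
        dA (∩ʳ O (∁ (≥? 1 dA)) p)))
    P∈N₂ = inN₂ P≢u (proj₁ (2≤dN-P linked l)) wP
    Q∈N₂ = inN₂ Q≢u (proj₂ (2≤dN-P linked l)) wQ
    twoN : ∀ {x} → P ∈ adj x → Q ∈ adj x → 2 ≤ dN x
    twoN {x} q r = length≤# (N ∩ adj x) ((P≢Q ∷ []) ∷ [] ∷ []) (∩⁺ N (adj x) (N₂⇒N P∈N₂) q ∷ ∩⁺ N (adj x) (N₂⇒N Q∈N₂)
        r ∷ [])
    -- `P`, `R`, `Q`, `S` form a 4-cycle in N, and each of the four has two neighbours in N.
    8≤f : 8 ≤ Σ N dN
    8≤f = ≤-trans (*-monoʳ-≤ 2 (length≤# N₂ ((P≢Q ∷ adj⇒≢ PR ∷ adj⇒≢ PS ∷ []) ∷ (adj⇒≢ QR ∷ adj⇒≢ QS ∷ []) ∷ (R≢S ∷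
        []) ∷ [] ∷ [])
            (P∈N₂ ∷ Q∈N₂ ∷ ∩⁺ N (≥? 2 dN) uR (≥?⁺ 2 dN (twoN (adj-flip PR) (adj-flip QR))) ∷ ∩⁺ N (≥? 2 dN) uS (≥?⁺ 2
                dN (twoN (adj-flip PS) (adj-flip QS))) ∷ [])))
          (≤-trans (Σ-⊑ N₂ (dN ∷ []) (con 2) v0 (λ _ → N₂⇒2≤dN)) (Σ-⊆ N₂ N dN N₂⇒N))
    -- This says dZ ≤ 2(d + dN - 6), with d = 5 + h. Thus a vertex of `A` can give one unit to each
    -- neighbour in `Z`, while `sumZ` says that the two or more units arriving at a vertex of `Z`
    -- cover its doubled deficit 2 - 2h.
    sumA : 12 * # A + Σ A dZ ≤ 10 * # A + 2 * Σ A h + 2 * Σ A dN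
    sumA = Σ-⊑ A (h ∷ dN ∷ dZ ∷ []) (con 12 ⊕ v2) (con 10 ⊕ 2 ⊙ v0 ⊕ 2 ⊙ v1) λ x q → lem q
      where
      lem : ∀ {x} → x ∈ A → 12 + dZ x ≤ 10 + 2 * h x + 2 * dN x
      lem {x} q with ∈? (≥? 3 dZ) x | ∈? (≥? 6 d) x
      ... | yes r | yes s = (deduce (d x ∷ h x ∷ dN x ∷ dA x ∷ dC x ∷ dZ x ∷ dO x ∷ []) ((2 ∣ 0 ∙ v0 ≋ con 5 ⊕ v1) ∷
          (0 ∣ 1 ∙ v0 ≋ v2 ⊕ v6) ∷ (0 ∣ 1 ∙ v6 ≋ v3 ⊕ (v4 ⊕ v5)) ∷ (3 ∙ con 2 ⊑ v2) ∷ (1 ∙ con 6 ⊑ v0) ∷ []) 1 (con 12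
          ⊕ v5) (con 10 ⊕ 2 ⊙ v1 ⊕ 2 ⊙ v2) (d≡5+h x) (d-O (A⇒O q)) (dO-classes x) (A⇒2≤dN q) (≥?⁻ 6 d s))
      ... | yes r | no s  = ⊥-elim (none (x , ∩⁺ (A ∩ ≥? 3 dZ) (∁ (≥? 6 d)) (∩⁺ A (≥? 3 dZ) q r) (∁⁺ (≥? 6 d) s)))
      ... | no r | _ = (deduce (h x ∷ dN x ∷ dZ x ∷ []) ((1 ∙ con 1 ⊕ v2 ⊑ con 3) ∷ (2 ∙ con 2 ⊑ v1) ∷ []) 1 (con 12 ⊕
          v2) (con 10 ⊕ 2 ⊙ v0 ⊕ 2 ⊙ v1) (∁≥?⁻ 3 dZ (∁⁺ (≥? 3 dZ) r)) (A⇒2≤dN q))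
    sumZ : 12 * # Z ≤ 10 * # Z + 2 * Σ Z h + Σ Z dA
    sumZ = Σ-⊑ Z (h ∷ dA ∷ []) (con 12) (con 10 ⊕ 2 ⊙ v0 ⊕ v1) λ x q → (deduce (h x ∷ dA x ∷ []) ((1 ∙ con 2 ⊑ v1) ∷
        []) 1 (con 12) (con 10 ⊕ 2 ⊙ v0 ⊕ v1) (dA≥2-Z q))

  record Tame : Set where
    field
      u      : Fin n
      du     : d u ≡ 5
      tame   : Σ (adj u) h ≡ 0

  -- Otherwise every vertex of Z has degree above five or such a neighbour. But
  -- charging each vertex of Z to its two neighbours in A bounds the excess
  -- degrees (budget), while Z is large.
  tame-vertex : ∀ v (dv : d v ≡ 5) → At.Good v dv → Tame
  tame-vertex v dv good with 1 ≤? Σ N h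
    where open At v dv
  ... | no k<1 = record { u = v ; du = dv ; tame = n≤0⇒n≡0 (≤-pred (≰⇒> k<1)) }
    where open At v dv
  ... | yes 1≤k with Fin.any? (∈? (Z ∩ ∁ (≥? 1 touch)))
    where open At v dv
  ...   | yes (z , p) = record { u = z ; du = trans (d≡5+h z) (cong (5 +_) hz) ; tame = sum-0 quiet }
    where
    open At v dv
    touch≡0 : h z + deg-in (O ∩ ≥? 1 h) z ≡ 0
    touch≡0 = n≤0⇒n≡0 (≤-pred (∁≥?⁻ 1 touch (∩ʳ Z (∁ (≥? 1 touch)) p)))
    hz : h z ≡ 0
    hz = m+n≡0⇒m≡0 (h z) touch≡0
    z∈Z : z ∈ Z
    z∈Z = ∩ˡ Z (∁ (≥? 1 touch)) p
    quiet : ∀ x → on (adj z) h x ≡ 0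
    quiet x with adj z x in q
    ... | false = refl
    ... | true with ∈? (≥? 1 h) x
    ...   | no r  = n≤0⇒n≡0 (≤-pred (∁≥?⁻ 1 h (∁⁺ (≥? 1 h) r)))
    ... | yes r = contradiction (≤-trans (length≤# ((O ∩ ≥? 1 h) ∩ adj z) ([] ∷ []) (∩⁺ (O ∩ ≥? 1 h) (adj z) (∩⁺ O (≥?
        1 h) (neighbour-O z∈Z q) r) q ∷ []))
                                           (≤-reflexive (m+n≡0⇒n≡0 (h z) touch≡0))) λ ()
  ...   | no none = ⊥-elim (case N₂?)
    where
    open At v dv
    H : Sub n
    H = O ∩ ≥? 1 h
    touched : # Z ≤ Σ Z h + Σ Z (deg-in H)
    touched = ≤-trans (≤-reflexive (sym (*-identityˡ (# Z)))) (Σ-⊑ Z (h ∷ deg-in H ∷ []) (con 1) (v0 ⊕ v1) λ x q → lem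
        q)
      where
      lem : ∀ {x} → x ∈ Z → 1 ≤ h x + deg-in H x
      lem {x} q with ∈? (≥? 1 touch) x
      ... | yes r = ≥?⁻ 1 touch r
      ... | no r = ⊥-elim (none (x , ∩⁺ Z (∁ (≥? 1 touch)) q (∁⁺ (≥? 1 touch) r)))
    noisy : Fin n → ℕ
    noisy = on (≥? 1 h) dZ
    ΣH : Σ H dZ ≡ Σ A noisy + (Σ C noisy + Σ Z noisy)
    ΣH = trans (sum-cong λ x → lem (O x) (≥? 1 h x)) (Σ-classes noisy)
      where
      lem : ∀ a b {p : ℕ} → (if a ∧ b then p else 0) ≡ (if a then (if b then p else 0) else 0)
      lem true  _ = refl
      lem false _ = refl
    if-noisy : ∀ x {r} → (1 ≤ h x → dZ x ≤ r) → noisy x ≤ r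
    if-noisy x f with ≥? 1 h x in q
    ... | true  = f (≥?⁻ 1 h q)
    ... | false = z≤n
    -- For h ≥ 1 a vertex of `A` has dZ ≤ 5 + h - 2 - 1 ≤ 3h. In `C` and in `Z` only two neighbours
    -- are known to lie elsewhere, whence 3 + h ≤ 4h.
    noisyA : Σ A noisy ≤ 3 * Σ A h
    noisyA = Σ-⊑ A (noisy ∷ h ∷ []) v0 (3 ⊙ v1) λ x q → if-noisy x λ r →
      (deduce (d x ∷ h x ∷ dN x ∷ dA x ∷ dC x ∷ dZ x ∷ dO x ∷ []) ((1 ∣ 0 ∙ v0 ≋ con 5 ⊕ v1) ∷ (0 ∣ 1 ∙ v0 ≋ v2 ⊕ v6)
          ∷ (0 ∣ 1 ∙ v6 ≋ v3 ⊕ (v4 ⊕ v5)) ∷ (1 ∙ con 2 ⊑ v2) ∷ (1 ∙ con 1 ⊑ v3) ∷ (2 ∙ con 1 ⊑ v1) ∷ []) 1 (v5) (3 ⊙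
          v1) (d≡5+h x) (d-O (A⇒O q)) (dO-classes x) (A⇒2≤dN q) (good (A⇒O q)) r)
    noisyC : Σ C noisy ≤ 4 * Σ C h
    noisyC = Σ-⊑ C (noisy ∷ h ∷ []) v0 (4 ⊙ v1) λ x q → if-noisy x λ r →
      (deduce (d x ∷ h x ∷ dN x ∷ dA x ∷ dC x ∷ dZ x ∷ dO x ∷ []) ((1 ∣ 0 ∙ v0 ≋ con 5 ⊕ v1) ∷ (0 ∣ 1 ∙ v0 ≋ v2 ⊕ v6)
          ∷ (0 ∣ 1 ∙ v6 ≋ v3 ⊕ (v4 ⊕ v5)) ∷ (0 ∣ 1 ∙ v2 ≋ con 1) ∷ (1 ∙ con 1 ⊑ v3) ∷ (3 ∙ con 1 ⊑ v1) ∷ []) 1 (v5) (4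
          ⊙ v1) (d≡5+h x) (d-O (C⇒O q)) (dO-classes x) (C⇒dN≡1 q) (good (C⇒O q)) r)
    noisyZ : Σ Z noisy ≤ 4 * Σ Z h
    noisyZ = Σ-⊑ Z (noisy ∷ h ∷ []) v0 (4 ⊙ v1) λ x q → if-noisy x λ r →
      (deduce (d x ∷ h x ∷ dN x ∷ dA x ∷ dC x ∷ dZ x ∷ dO x ∷ []) ((1 ∣ 0 ∙ v0 ≋ con 5 ⊕ v1) ∷ (0 ∣ 1 ∙ v0 ≋ v2 ⊕ v6)
          ∷ (0 ∣ 1 ∙ v6 ≋ v3 ⊕ (v4 ⊕ v5)) ∷ (1 ∙ con 2 ⊑ v3) ∷ (3 ∙ con 1 ⊑ v1) ∷ []) 1 (v5) (4 ⊙ v1) (d≡5+h x) (d-O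
          (Z⇒O q)) (dO-classes x) (dA≥2-Z q) r)
    z≤ : # Z ≤ 3 * Σ A h + 4 * Σ C h + 5 * Σ Z h
    z≤ = (deduce (# Z ∷ Σ A h ∷ Σ C h ∷ Σ Z h ∷ Σ H dZ ∷ Σ Z (deg-in H) ∷ Σ A noisy ∷ Σ C noisy ∷ Σ Z noisy ∷ []) ((1
        ∙ v0 ⊑ v3 ⊕ v5) ∷ (1 ∣ 0 ∙ v5 ≋ v4) ∷ (1 ∣ 0 ∙ v4 ≋ v6 ⊕ (v7 ⊕ v8)) ∷ (1 ∙ v6 ⊑ 3 ⊙ v1) ∷ (1 ∙ v7 ⊑ 4 ⊙ v2) ∷
        (1 ∙ v8 ⊑ 4 ⊙ v3) ∷ []) 1 (v0) (3 ⊙ v1 ⊕ 4 ⊙ v2 ⊕ 5 ⊙ v3) touched (double-count Z H) ΣH noisyA noisyC noisyZ)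
    -- The charge of `good-root`, now without exceptional vertices: the neighbour in `A` leaves h to
    -- spare after paying `Z`.
    sumA : 12 * # A + (Σ A dZ + Σ A h) ≤ 10 * # A + 2 * Σ A h + 2 * Σ A dN
    sumA = Σ-⊑ A (h ∷ dN ∷ dZ ∷ []) (con 12 ⊕ (v2 ⊕ v0)) (con 10 ⊕ 2 ⊙ v0 ⊕ 2 ⊙ v1) λ x q →
      (deduce (d x ∷ h x ∷ dN x ∷ dA x ∷ dC x ∷ dZ x ∷ dO x ∷ []) ((1 ∣ 0 ∙ v0 ≋ con 5 ⊕ v1) ∷ (0 ∣ 1 ∙ v0 ≋ v2 ⊕ v6)
          ∷ (0 ∣ 1 ∙ v6 ≋ v3 ⊕ (v4 ⊕ v5)) ∷ (3 ∙ con 2 ⊑ v2) ∷ (1 ∙ con 1 ⊑ v3) ∷ []) 1 (con 12 ⊕ (v5 ⊕ v1)) (con 10 ⊕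
          2 ⊙ v1 ⊕ 2 ⊙ v2) (d≡5+h x) (d-O (A⇒O q)) (dO-classes x) (A⇒2≤dN q) (good (A⇒O q)))
    sumZ : 2 * # Z ≤ Σ Z dA
    sumZ = Σ-⊑ Z (dA ∷ []) (con 2) v0 λ x q → dA≥2-Z q
    -- 12 = 2(26 - 20): twice the gap between the exact formula for the degree sum and the assumed
    -- bound.
    budget : 2 * Σ N dN + (Σ A h + 2 * Σ C h + 2 * Σ Z h) ≤ 12
    budget = (deduce (# A ∷ # C ∷ # Z ∷ # O ∷ Σ N h ∷ Σ N dN ∷ Σ A dN ∷ Σ A h ∷ Σ C h ∷ Σ Z h ∷ Σ A dZ ∷ Σ Z dA ∷ Σ O
        h ∷ []) ((2 ∙ v4 ⊕ v12 ⊕ con 14 ⊑ v3) ∷ (0 ∣ 2 ∙ v12 ≋ v7 ⊕ (v8 ⊕ v9)) ∷ (2 ∣ 0 ∙ v3 ≋ v0 ⊕ (v1 ⊕ v2)) ∷ (2 ∙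
        v6 ⊕ v1 ⊕ v5 ⊑ con 20 ⊕ v4) ∷ (1 ∙ 12 ⊙ v0 ⊕ (v10 ⊕ v7) ⊑ 10 ⊙ v0 ⊕ 2 ⊙ v7 ⊕ 2 ⊙ v6) ∷ (1 ∙ 2 ⊙ v2 ⊑ v11) ∷ (0
        ∣ 1 ∙ v10 ≋ v11) ∷ []) 1 (2 ⊙ v5 ⊕ (v7 ⊕ 2 ⊙ v8 ⊕ 2 ⊙ v9)) (con 12) excess ΣO-h #-classes (≤-reflexive (trans
        (cong (_+ Σ N dN) (sym ΣO-dN)) ΣO-dN+f)) sumA sumZ (double-count A Z))
    -- Every vertex of `O` has two neighbours in `A` or `N₂`, which bounds 2|O| by the degrees of
    -- these classes into `O`. Eliminating `Σ A dN` by `ΣO-dN+f` introduces the 20.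
    mass : 2 * # O + 20 + Σ N h ≤ 5 * # A + Σ A h + (# C + Σ N dN + Σ N₂ dO)
    mass = (deduce (# A ∷ Σ A h ∷ # C ∷ Σ N dN ∷ Σ N₂ dO ∷ # O ∷ Σ N h ∷ Σ A dN ∷ Σ A dO ∷ []) ((0 ∣ 1 ∙ 5 ⊙ v0 ⊕ v1 ≋
        v7 ⊕ v8) ∷ (1 ∙ 2 ⊙ v5 ⊑ v8 ⊕ v4) ∷ (1 ∙ con 20 ⊕ v6 ⊑ v7 ⊕ v2 ⊕ v3) ∷ []) 1 (2 ⊙ v5 ⊕ con 20 ⊕ v6) (5 ⊙ v0 ⊕
        v1 ⊕ (v2 ⊕ v3 ⊕ v4)) ΣA-d all-served (≤-reflexive (trans (sym ΣO-dN+f) (cong (_+ Σ N dN) ΣO-dN))))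
    case : (∃[ c ] c ∈ N₂) ⊎ (∀ x → ¬ x ∈ N₂) → ⊥
    case (inj₁ (c , p)) = let x , y , (_ , _ , _ , cx , cy) , q = N₂⇒4≤f p in
      (refute (# A ∷ # C ∷ # Z ∷ # O ∷ Σ N h ∷ Σ N dN ∷ Σ A dN ∷ Σ A h ∷ Σ C h ∷ Σ Z h ∷ Σ N₂ dO ∷ Σ O h ∷ []) ((1 ∙
          v2 ⊑ 3 ⊙ v7 ⊕ 4 ⊙ v8 ⊕ 5 ⊙ v9) ∷ (1 ∙ 2 ⊙ v5 ⊕ (v7 ⊕ 2 ⊙ v8 ⊕ 2 ⊙ v9) ⊑ con 12) ∷ (1 ∣ 0 ∙ v3 ≋ v0 ⊕ (v1 ⊕
          v2)) ∷ (3 ∙ v4 ⊕ v11 ⊕ con 14 ⊑ v3) ∷ (0 ∣ 3 ∙ v11 ≋ v7 ⊕ (v8 ⊕ v9)) ∷ (1 ∙ 2 ⊙ v3 ⊕ con 20 ⊕ v4 ⊑ 5 ⊙ v0 ⊕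
          v7 ⊕ (v1 ⊕ v5 ⊕ v10)) ∷ (3 ∙ v6 ⊕ v1 ⊕ v5 ⊑ con 20 ⊕ v4) ∷ (3 ∙ 2 ⊙ v0 ⊑ v6) ∷ (1 ∙ v10 ⊑ v5 ⊕ v4) ∷ (3 ∙
          con 4 ⊑ v5) ∷ []) z≤ budget #-classes excess ΣO-h mass (≤-reflexive (trans (cong (_+ Σ N dN) (sym ΣO-dN))
          ΣO-dN+f)) ΣA-dN≥ ΣN₂-dO≤f+k (≤-trans (+-mono-≤ (N₂⇒2≤dN p) (+-mono-≤ (1≤dN (N₂⇒N p) cx) (1≤dN (N₂⇒N p) cy)))
          q))
    case (inj₂ none) =
      (refute (# A ∷ # C ∷ # Z ∷ # O ∷ Σ N h ∷ Σ N dN ∷ Σ A dN ∷ Σ A h ∷ Σ C h ∷ Σ Z h ∷ Σ N₂ dO ∷ Σ O h ∷ []) ((2 ∙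
          v2 ⊑ 3 ⊙ v7 ⊕ 4 ⊙ v8 ⊕ 5 ⊙ v9) ∷ (2 ∣ 0 ∙ v3 ≋ v0 ⊕ (v1 ⊕ v2)) ∷ (10 ∙ v4 ⊕ v11 ⊕ con 14 ⊑ v3) ∷ (0 ∣ 10 ∙
          v11 ≋ v7 ⊕ (v8 ⊕ v9)) ∷ (4 ∙ 2 ⊙ v3 ⊕ con 20 ⊕ v4 ⊑ 5 ⊙ v0 ⊕ v7 ⊕ (v1 ⊕ v5 ⊕ v10)) ∷ (11 ∙ v6 ⊕ v1 ⊕ v5 ⊑
          con 20 ⊕ v4) ∷ (11 ∙ 2 ⊙ v0 ⊑ v6) ∷ (4 ∙ v10 ⊑ con 0) ∷ (3 ∙ con 1 ⊑ v4) ∷ []) z≤ #-classes excess ΣO-h mass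
          (≤-reflexive (trans (cong (_+ Σ N dN) (sym ΣO-dN)) ΣO-dN+f)) ΣA-dN≥ (≤-reflexive (N₂-empty none)) 1≤k)

  -- Removing x leaves at least c for each other element, so nothing above c remains for x.
  Σ-tight : ∀ (S : Sub n) (f : Fin n → ℕ) c → (∀ {x} → x ∈ S → c ≤ f x) → Σ S f ≤ c * # S → ∀ {x} → x ∈ S → f x ≤ c
  Σ-tight S f c lower upper {x} p = (deduce (Σ S f ∷ f x ∷ Σ (S ∩ isnt x) f ∷ c * # S ∷ c ∷ c * # (S ∩ isnt x) ∷ [])
      ((1 ∙ v0 ⊑ v3) ∷ (1 ∙ v1 ⊕ v2 ⊑ v0) ∷ (1 ∙ v5 ⊑ v2) ∷ (1 ∙ v3 ⊑ v4 ⊕ v5) ∷ []) 1 (v1) (v4) upper (≤-reflexive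
      (sym (Σ-remove S f p))) rest (≤-reflexive (trans (cong (c *_) (#-split S p)) (*-suc c _))))
    where
    rest : c * # (S ∩ isnt x) ≤ Σ (S ∩ isnt x) f
    rest = Σ-⊑ (S ∩ isnt x) (f ∷ []) (con c) v0 λ y q → ≤-trans (≤-reflexive (*-identityʳ c)) (lower (∩ˡ S (isnt x)
        q))

  module Tamed (v : Fin n) (dv : d v ≡ 5) (k≡0 : Σ (adj v) h ≡ 0) where
    open At v dv public

    mass : 2 * # O + 20 ≤ 5 * # A + Σ A h + (# C + Σ N dN + Σ N₂ dO)
    mass = (deduce (# A ∷ Σ A h ∷ # C ∷ Σ N dN ∷ Σ N₂ dO ∷ # O ∷ Σ N h ∷ Σ A dN ∷ Σ A dO ∷ []) ((0 ∣ 1 ∙ 5 ⊙ v0 ⊕ v1 ≋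
        v7 ⊕ v8) ∷ (1 ∙ 2 ⊙ v5 ⊑ v8 ⊕ v4) ∷ (1 ∙ con 20 ⊕ v6 ⊑ v7 ⊕ v2 ⊕ v3) ∷ []) 1 (2 ⊙ v5 ⊕ con 20) (5 ⊙ v0 ⊕ v1 ⊕
        (v2 ⊕ v3 ⊕ v4)) ΣA-d all-served (≤-reflexive (trans (sym ΣO-dN+f) (cong (_+ Σ N dN) ΣO-dN))))

    budget : Σ A dN + # C + Σ N dN ≤ 20
    budget = ≤-reflexive (trans (cong (_+ Σ N dN) (sym ΣO-dN)) (trans ΣO-dN+f (cong (20 +_) k≡0)))

    -- Eliminating |O| and |A| from `excess`, `mass` and `budget` gives 3f ≤ 4 + 2e. Here e ≤ f is
    -- inserted; `N₂-∅` uses e ≤ f - 2 in its last case, and `N-independent` uses e = 0.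
    f<5 : Σ N dN ≤ 4
    f<5 = (deduce (# A ∷ # C ∷ # O ∷ Σ N h ∷ Σ N dN ∷ Σ A dN ∷ Σ A h ∷ Σ C h ∷ Σ Z h ∷ Σ N₂ dO ∷ Σ O h ∷ []) ((4 ∙ v3
        ⊕ v10 ⊕ con 14 ⊑ v2) ∷ (0 ∣ 2 ∙ v10 ≋ v6 ⊕ (v7 ⊕ v8)) ∷ (2 ∙ 2 ⊙ v2 ⊕ con 20 ⊑ 5 ⊙ v0 ⊕ v6 ⊕ (v1 ⊕ v4 ⊕ v9)) ∷
        (5 ∙ v5 ⊕ v1 ⊕ v4 ⊑ con 20) ∷ (5 ∙ 2 ⊙ v0 ⊑ v5) ∷ (2 ∙ v9 ⊑ v4 ⊕ v3) ∷ []) 1 (v4) (con 4) excess ΣO-h mass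
        budget ΣA-dN≥ ΣN₂-dO≤f+k)

    N₂-∅ : ∀ {c} → ¬ c ∈ N₂
    N₂-∅ {c} p with N₂⇒4≤f p
    ... | x , y , (x∈N , y∈N , x≢y , cx , cy) , q with ∈? (≥? 2 dN) x | ∈? (≥? 2 dN) y
    ... | yes r | _ = (refute (Σ N dN ∷ dN c ∷ dN x ∷ dN y ∷ []) ((1 ∙ v0 ⊑ con 4) ∷ (1 ∙ v1 ⊕ (v2 ⊕ v3) ⊑ v0) ∷ (1 ∙
        con 2 ⊑ v1) ∷ (1 ∙ con 2 ⊑ v2) ∷ (1 ∙ con 1 ⊑ v3) ∷ []) f<5 q (N₂⇒2≤dN p) (≥?⁻ 2 dN r) (1≤dN (N₂⇒N p) cy))
    ... | _ | yes r = (refute (Σ N dN ∷ dN c ∷ dN x ∷ dN y ∷ []) ((1 ∙ v0 ⊑ con 4) ∷ (1 ∙ v1 ⊕ (v2 ⊕ v3) ⊑ v0) ∷ (1 ∙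
        con 2 ⊑ v1) ∷ (1 ∙ con 2 ⊑ v3) ∷ (1 ∙ con 1 ⊑ v2) ∷ []) f<5 q (N₂⇒2≤dN p) (≥?⁻ 2 dN r) (1≤dN (N₂⇒N p) cx))
    ... | no r | no s = (refute (# A ∷ # C ∷ # O ∷ Σ N h ∷ Σ N dN ∷ Σ A dN ∷ Σ A h ∷ Σ N₂ dO ∷ Σ O h ∷ Σ N₂ dN ∷ Σ N₂
        h ∷ []) ((4 ∙ v3 ⊕ v8 ⊕ con 14 ⊑ v2) ∷ (2 ∙ v6 ⊑ v8) ∷ (2 ∙ 2 ⊙ v2 ⊕ con 20 ⊑ 5 ⊙ v0 ⊕ v6 ⊕ (v1 ⊕ v4 ⊕ v7)) ∷
        (5 ∙ v5 ⊕ v1 ⊕ v4 ⊑ con 20) ∷ (5 ∙ 2 ⊙ v0 ⊑ v5) ∷ (2 ∙ v7 ⊑ v9 ⊕ v10) ∷ (2 ∙ v10 ⊑ v3) ∷ (3 ∙ v9 ⊕ con 2 ⊑ v4)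
        ∷ []) excess (Σ-⊆ A O h A⇒O) mass budget ΣA-dN≥ ΣN₂-dO≤ (Σ-⊆ N₂ N h N₂⇒N) g+2≤f)
      where
      N₁ : Sub n
      N₁ = N ∩ ∁ (≥? 2 dN)
      -- x and y lie outside `N₂`, yet each has the neighbour c in N.
      g+2≤f : Σ N₂ dN + 2 ≤ Σ N dN
      g+2≤f = (deduce (Σ N dN ∷ Σ N₂ dN ∷ Σ N₁ dN ∷ Σ (N₁ ∩ ≥? 1 dN) dN ∷ # (N₁ ∩ ≥? 1 dN) ∷ []) ((0 ∣ 1 ∙ v0 ≋ v1 ⊕
          v2) ∷ (1 ∙ v3 ⊑ v2) ∷ (1 ∙ 1 ⊙ v4 ⊑ v3) ∷ (1 ∙ con 2 ⊑ v4) ∷ []) 1 (v1 ⊕ con 2) (v0) (Σ-split N (≥? 2 dN)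
          dN) (Σ-⊆ (N₁ ∩ ≥? 1 dN) N₁ dN (∩ˡ N₁ (≥? 1 dN))) (Σ-⊑ (N₁ ∩ ≥? 1 dN) (dN ∷ []) (con 1) v0 (λ _ → ≥?⁻ 1 dN ∘
          ∩ʳ N₁ (≥? 1 dN))) (length≤# (N₁ ∩ ≥? 1 dN) ((x≢y ∷ []) ∷ [] ∷ []) (∩⁺ N₁ (≥? 1 dN) (∩⁺ N (∁ (≥? 2 dN)) x∈N
          (∁⁺ (≥? 2 dN) r)) (≥?⁺ 1 dN (1≤dN (N₂⇒N p) cx)) ∷ ∩⁺ N₁ (≥? 1 dN) (∩⁺ N (∁ (≥? 2 dN)) y∈N (∁⁺ (≥? 2 dN) s))
          (≥?⁺ 1 dN (1≤dN (N₂⇒N p) cy)) ∷ [])))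

    e≡0 : Σ N₂ dO ≤ 0
    e≡0 = ≤-reflexive (N₂-empty λ _ → N₂-∅)

    N-independent : ∀ {x y} → x ∈ N → y ∈ N → ¬ y ∈ adj x
    N-independent {x} {y} p q r = (refute (# A ∷ # C ∷ # O ∷ Σ N h ∷ Σ N dN ∷ Σ A dN ∷ Σ A h ∷ Σ N₂ dO ∷ Σ O h ∷ # (N
        ∩ ≥? 1 dN) ∷ Σ (N ∩ ≥? 1 dN) dN ∷ []) ((4 ∙ v3 ⊕ v8 ⊕ con 14 ⊑ v2) ∷ (2 ∙ v6 ⊑ v8) ∷ (2 ∙ 2 ⊙ v2 ⊕ con 20 ⊑ 5
        ⊙ v0 ⊕ v6 ⊕ (v1 ⊕ v4 ⊕ v7)) ∷ (5 ∙ v5 ⊕ v1 ⊕ v4 ⊑ con 20) ∷ (5 ∙ 2 ⊙ v0 ⊑ v5) ∷ (2 ∙ v7 ⊑ con 0) ∷ (3 ∙ v10 ⊑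
        v4) ∷ (3 ∙ 1 ⊙ v9 ⊑ v10) ∷ (3 ∙ con 2 ⊑ v9) ∷ []) excess (Σ-⊆ A O h A⇒O) mass budget ΣA-dN≥ e≡0 (Σ-⊆ (N ∩ ≥? 1
        dN) N dN (∩ˡ N (≥? 1 dN))) (Σ-⊑ (N ∩ ≥? 1 dN) (dN ∷ []) (con 1) v0 (λ _ → ≥?⁻ 1 dN ∘ ∩ʳ N (≥? 1 dN)))
        (length≤# (N ∩ ≥? 1 dN) ((adj⇒≢ r ∷ []) ∷ [] ∷ []) (∩⁺ N (≥? 1 dN) p (≥?⁺ 1 dN (1≤dN q r)) ∷ ∩⁺ N (≥? 1 dN) q
        (≥?⁺ 1 dN (1≤dN p (adj-flip r))) ∷ [])))

    dN-N : ∀ {x} → x ∈ N → dN x ≡ 0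
    dN-N {x} p = #≡0 (N ∩ adj x) λ y q → N-independent p (∩ˡ N (adj x) q) (∩ʳ N (adj x) q)

    -- At most twenty edges join N to `O`, and each vertex of `A` takes two. Conversely `excess`,
    -- `mass` and `budget` with e = 0 give 3|A| ≥ 28.
    a≡10 : # A ≡ 10
    a≡10 = ≤-antisym (deduce (# A ∷ Σ A dN ∷ # C ∷ Σ N dN ∷ []) ((1 ∙ v1 ⊕ v2 ⊕ v3 ⊑ con 20) ∷ (1 ∙ 2 ⊙ v0 ⊑ v1) ∷ [])
        2 (v0) (con 10) budget ΣA-dN≥)
                     (≰⇒> λ a<10 → (refute (# A ∷ # C ∷ # O ∷ Σ N h ∷ Σ N dN ∷ Σ A dN ∷ Σ A h ∷ Σ N₂ dO ∷ Σ O h ∷ Σ A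
                         dO ∷ []) ((2 ∙ v3 ⊕ v8 ⊕ con 14 ⊑ v2) ∷ (1 ∙ v6 ⊑ v8) ∷ (1 ∙ 2 ⊙ v2 ⊕ con 20 ⊑ 5 ⊙ v0 ⊕ v6 ⊕
                         (v1 ⊕ v4 ⊕ v7)) ∷ (1 ∙ v5 ⊕ v1 ⊕ v4 ⊑ con 20) ∷ (1 ∙ 2 ⊙ v0 ⊑ v5) ∷ (1 ∙ v7 ⊑ con 0) ∷ (3 ∙
                         v0 ⊑ con 9) ∷ []) excess (Σ-⊆ A O h A⇒O) mass budget ΣA-dN≥ e≡0 a<10))

    ΣA-dN≤20 : Σ A dN ≤ 20
    ΣA-dN≤20 = (deduce (Σ A dN ∷ # C ∷ Σ N dN ∷ []) ((1 ∙ v0 ⊕ v1 ⊕ v2 ⊑ con 20) ∷ []) 1 (v0) (con 20) budget)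

    c≡0 : # C ≤ 0
    c≡0 = (deduce (# A ∷ Σ A dN ∷ # C ∷ Σ N dN ∷ []) ((1 ∙ v1 ⊕ v2 ⊕ v3 ⊑ con 20) ∷ (1 ∙ 2 ⊙ v0 ⊑ v1) ∷ (0 ∣ 2 ∙ v0 ≋
        con 10) ∷ []) 1 (v2) (con 0) budget ΣA-dN≥ a≡10)

    C-∅ : ∀ {x} → ¬ x ∈ C
    C-∅ p = contradiction (≤-trans (length≤# C ([] ∷ []) (p ∷ [])) c≡0) λ ()

    dN≤2-A : ∀ {x} → x ∈ A → dN x ≤ 2
    dN≤2-A = Σ-tight A dN 2 A⇒2≤dN (≤-trans ΣA-dN≤20 (≤-reflexive (cong (2 *_) (sym a≡10))))

    2≤dA : ∀ {w} → w ∈ O → 2 ≤ dA w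
    2≤dA {w} p = ≤-trans (served linked p) (≤-reflexive (trans (cong (dA w +_) (#≡0 (N₂ ∩ adj w) λ c q → N₂-∅ (∩ˡ N₂
        (adj w) q))) (+-identityʳ _)))

    -- The ten vertices of `A` have total degree 50 + `Σ A h`, of which at least 20 goes to N, and
    -- every vertex of `Z` takes two from the rest.
    ΣA-dA : Σ A dA + 2 * # Z ≤ 30 + Σ A h
    ΣA-dA = (deduce (Σ A dA ∷ Σ O dA ∷ # Z ∷ Σ A h ∷ Σ C dA ∷ Σ Z dA ∷ Σ A dO ∷ # A ∷ Σ A dN ∷ []) ((0 ∣ 1 ∙ v1 ≋ v0 ⊕
        (v4 ⊕ v5)) ∷ (1 ∙ 2 ⊙ v2 ⊑ v5) ∷ (1 ∣ 0 ∙ v1 ≋ v6) ∷ (0 ∣ 1 ∙ 5 ⊙ v7 ⊕ v3 ≋ v8 ⊕ v6) ∷ (1 ∙ 2 ⊙ v7 ⊑ v8) ∷ (3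
        ∣ 0 ∙ v7 ≋ con 10) ∷ []) 1 (v0 ⊕ 2 ⊙ v2) (con 30 ⊕ v3) (Σ-classes dA) (Σ-⊑ Z (dA ∷ []) (con 2) v0 (λ _ →
        dA≥2-Z)) (double-count O A) ΣA-d ΣA-dN≥ a≡10)

    4+H≤z : 4 + Σ O h ≤ # Z
    4+H≤z = (deduce (# Z ∷ # A ∷ # C ∷ # O ∷ Σ N h ∷ Σ O h ∷ []) ((1 ∙ v4 ⊕ v5 ⊕ con 14 ⊑ v3) ∷ (1 ∣ 0 ∙ v3 ≋ v1 ⊕ (v2
        ⊕ v0)) ∷ (1 ∣ 0 ∙ v1 ≋ con 10) ∷ (1 ∙ v2 ⊑ con 0) ∷ []) 1 (con 4 ⊕ v5) (v0) excess #-classes a≡10 c≡0)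

    -- Double counting the four-cycles forced between p and the other
    -- neighbours of v inside A when A induces a 2-regular graph.
    module 2-Regular (ΣA≤20 : Σ A dA ≤ 20) {p : Fin n} (p∈N : p ∈ N) where
      dA≤2 : ∀ {x} → x ∈ A → dA x ≤ 2
      dA≤2 = Σ-tight A dA 2 (2≤dA ∘ A⇒O) (≤-trans ΣA≤20 (≤-reflexive (cong (2 *_) (sym a≡10))))
      N⇒A : ∀ {c x} → c ∈ N → x ∈ adj c → x ≢ v → x ∈ A
      N⇒A {c} {x} q r x≢v with trichotomy x
      ... | inj₁ s        = ⊥-elim (x≢v s)
      ... | inj₂ (inj₁ s) = ⊥-elim (N-independent q s r)
      ... | inj₂ (inj₂ s) with neighbour-O₁ s
        where
        neighbour-O₁ : x ∈ O → x ∈ A ⊎ ¬ x ∈ ≥? 2 dN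
        neighbour-O₁ s with ∈? (≥? 2 dN) x
        ... | yes t = inj₁ (∩⁺ O (≥? 2 dN) s t)
        ... | no t  = inj₂ t
      ...   | inj₁ t = t
      ... | inj₂ t = ⊥-elim (C-∅ (∩⁺ O₁ (≥? 1 dN) (∩⁺ O (∁ (≥? 2 dN)) s (∁⁺ (≥? 2 dN) t)) (≥?⁺ 1 dN (1≤dN q (adj-flip
          r)))))
      RA Q M : Sub n
      RA = A ∩ adj p
      Q  = ≥? 2 (deg-in RA)
      M  = A ∩ Q
      N′ : Sub n
      N′ = N ∩ isnt p
      dA-p : # RA ≡ 4
      dA-p = trans (≤-antisym (#-mono {S = RA} {T = O ∩ adj p} λ {x} q → ∩⁺ O (adj p) (A⇒O (∩ˡ A (adj p) q)) (∩ʳ A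
          (adj p) q))
                              (#-mono {S = O ∩ adj p} {T = RA} λ {x} q → ∩⁺ A (adj p) (N⇒A p∈N (∩ʳ O (adj p) q) (O⇒≢
                                  (∩ˡ O (adj p) q))) (∩ʳ O (adj p) q)))
                   (≤-antisym (deduce (dO p ∷ dN p ∷ h p ∷ Σ N h ∷ []) ((1 ∣ 0 ∙ v0 ⊕ v1 ≋ con 4 ⊕ v2) ∷ (1 ∙ v2 ⊑ v3)
                       ∷ (1 ∣ 0 ∙ v3 ≋ con 0) ∷ []) 1 (v0) (con 4) (dO-N p∈N) (∈⇒≤Σ N h p∈N) k≡0)
                              (deduce (dO p ∷ dN p ∷ h p ∷ []) ((0 ∣ 1 ∙ v0 ⊕ v1 ≋ con 4 ⊕ v2) ∷ (1 ∣ 0 ∙ v1 ≋ con 0)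
                                  ∷ []) 1 (con 4) (v0) (dO-N p∈N) (dN-N p∈N)))
      -- No vertex of a link between p and q can be v, because N is independent. So `R` and `S` lie
      -- in `RA`, while `P` and `Q` are neighbours of q in `M`.
      2≤M : ∀ {q} → q ∈ N′ → 2 ≤ deg-in M q
      2≤M {q} r = length≤# (M ∩ adj q) ((P≢Q ∷ []) ∷ [] ∷ []) (in-M wP PR PS ∷ in-M wQ QR QS ∷ [])
        where
        q∈N = ∩ˡ N (isnt p) r
        l : Link p q
        l = linked (isnt⇒≢ (∩ʳ N (isnt p) r)) (¬∈⇒false {S = adj p} (N-independent p∈N q∈N))
        open Link l hiding (Q)
        Q′ = Link.Q l
        not-v : ∀ {c x y} → c ∈ N → y ∈ adj x → y ∈ adj c → x ≢ v
        not-v s t u refl = N-independent s t u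
        in-RA : ∀ {x y} → x ∈ adj p → y ∈ adj q → y ∈ adj x → x ∈ RA
        in-RA s t u = ∩⁺ A (adj p) (N⇒A p∈N s (not-v q∈N u t)) s
        in-M : ∀ {x} → x ∈ adj q → R ∈ adj x → S ∈ adj x → x ∈ M ∩ adj q
        in-M {x} s t u = ∩⁺ M (adj q) (∩⁺ A Q (N⇒A q∈N s (not-v p∈N t uR))
          (≥?⁺ 2 (deg-in RA) (length≤# (RA ∩ adj x) ((R≢S ∷ []) ∷ [] ∷ [])
            (∩⁺ RA (adj x) (in-RA uR s (adj-flip t)) t ∷ ∩⁺ RA (adj x) (in-RA uS s (adj-flip u)) u ∷ [])))) s
      ΣM-N′ : 8 ≤ Σ M (deg-in N′)
      ΣM-N′ = (deduce (Σ M (deg-in N′) ∷ Σ N′ (deg-in M) ∷ # N′ ∷ # N ∷ []) ((0 ∣ 1 ∙ v0 ≋ v1) ∷ (1 ∙ 2 ⊙ v2 ⊑ v1) ∷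
          (2 ∣ 0 ∙ v3 ≋ con 1 ⊕ v2) ∷ (0 ∣ 2 ∙ v3 ≋ con 5) ∷ []) 1 (con 8) (v0) (double-count M N′) (Σ-⊑ N′ (deg-in M
          ∷ []) (con 2) v0 (λ _ → 2≤M)) (#-split N {p} p∈N) dv)
      N′≤2 : ∀ {x} → x ∈ M → deg-in N′ x ≤ 2
      N′≤2 {x} q = ≤-trans (#-mono {S = N′ ∩ adj x} {T = N ∩ adj x} λ r → ∩⁺ N (adj x) (∩ˡ N (isnt p) (∩ˡ N′ (adj x)
          r)) (∩ʳ N′ (adj x) r)) (dN≤2-A (∩ˡ A Q q))
      -- These eight incidences allow |M| ≤ 4, whereas the other four neighbours of v require |M| ≥
      -- 4. Everything is therefore tight: all edges of G[A] at `RA` end in `M`, and `M` avoids the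
      -- neighbours of p.
      ΣA-RA : Σ A (deg-in RA) ≤ 8
      ΣA-RA = (deduce (Σ A (deg-in RA) ∷ Σ RA dA ∷ # RA ∷ []) ((1 ∣ 0 ∙ v0 ≋ v1) ∷ (1 ∙ v1 ⊑ 2 ⊙ v2) ∷ (2 ∣ 0 ∙ v2 ≋
          con 4) ∷ []) 1 (v0) (con 8) (double-count A RA) (Σ-⊑ RA (dA ∷ []) v0 (con 2) (λ _ → dA≤2 ∘ ∩ˡ A (adj p)))
          dA-p)
      ΣM-RA : 2 * # M ≤ Σ M (deg-in RA)
      ΣM-RA = Σ-⊑ M (deg-in RA ∷ []) (con 2) v0 λ _ → ≥?⁻ 2 (deg-in RA) ∘ ∩ʳ A Q
      M≥4 : 4 ≤ # M
      M≥4 = (deduce (Σ M (deg-in N′) ∷ # M ∷ []) ((1 ∙ con 8 ⊑ v0) ∷ (1 ∙ v0 ⊑ 2 ⊙ v1) ∷ []) 2 (con 4) (v1) ΣM-N′ (Σ-⊑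
          M (deg-in N′ ∷ []) v0 (con 2) (λ _ → N′≤2)))
      A∖M W : Sub n
      A∖M = A ∩ ∁ Q
      W   = A∖M ∩ ∁ (adj p)
      Σrest : Σ A∖M (deg-in RA) ≤ 0
      Σrest = (deduce (Σ A (deg-in RA) ∷ Σ M (deg-in RA) ∷ Σ A∖M (deg-in RA) ∷ # M ∷ []) ((0 ∣ 1 ∙ v0 ≋ v1 ⊕ v2) ∷ (1
          ∙ v0 ⊑ con 8) ∷ (1 ∙ 2 ⊙ v3 ⊑ v1) ∷ (2 ∙ con 4 ⊑ v3) ∷ []) 1 (v2) (con 0) (Σ-split A Q (deg-in RA)) ΣA-RA
          ΣM-RA M≥4)
      M-RA≥2 : ∀ {x} → x ∈ M → 2 ≤ deg-in N′ x
      M-RA≥2 {x} q = ≮⇒≥ λ lt → (refute (Σ M (deg-in N′) ∷ Σ (M ∩ isnt x) (deg-in N′) ∷ deg-in N′ x ∷ # M ∷ # (M ∩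
          isnt x) ∷ Σ M (deg-in RA) ∷ Σ A (deg-in RA) ∷ []) ((1 ∙ con 8 ⊑ v0) ∷ (1 ∣ 0 ∙ v0 ≋ v2 ⊕ v1) ∷ (1 ∙ v1 ⊑ 2 ⊙
          v4) ∷ (0 ∣ 2 ∙ v3 ≋ con 1 ⊕ v4) ∷ (1 ∙ 2 ⊙ v3 ⊑ v5) ∷ (1 ∙ v5 ⊑ v6) ∷ (1 ∙ v6 ⊑ con 8) ∷ (1 ∙ con 1 ⊕ v2 ⊑
          con 2) ∷ []) ΣM-N′ (Σ-remove M (deg-in N′) {x} q) (Σ-⊑ (M ∩ isnt x) (deg-in N′ ∷ []) v0 (con 2) (λ _ → N′≤2
          ∘ ∩ˡ M (isnt x))) (#-split M {x} q) ΣM-RA (Σ-⊆ M A (deg-in RA) (∩ˡ A Q)) ΣA-RA lt)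
      M∩p : ∀ {x} → x ∈ M → ¬ x ∈ adj p
      M∩p {x} q r = contradiction (≤-trans (≤-trans (s≤s (M-RA≥2 q)) (≤-trans (s≤s (#-mono {S = N′ ∩ adj x} {T = N ∩
          adj x ∩ isnt p} λ t →
          ∩⁺ (N ∩ adj x) (isnt p) (∩⁺ N (adj x) (∩ˡ N (isnt p) (∩ˡ N′ (adj x) t)) (∩ʳ N′ (adj x) t)) (∩ʳ N (isnt p)
              (∩ˡ N′ (adj x) t))))
          (≤-reflexive (sym (#-split (N ∩ adj x) {p} (∩⁺ N (adj x) p∈N (adj-flip r))))))) (dN≤2-A (∩ˡ A Q q))) λ {
              (s≤s (s≤s ())) }
      RA⊆ : ∀ {x} → x ∈ RA → x ∈ A∖M ∩ adj p
      RA⊆ {x} q = ∩⁺ A∖M (adj p) (∩⁺ A (∁ Q) (∩ˡ A (adj p) q) (∁⁺ Q λ r → M∩p (∩⁺ A Q (∩ˡ A (adj p) q) r) (∩ʳ A (adj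
          p) q))) (∩ʳ A (adj p) q)
      sizes : # A ≡ # M + (# (A∖M ∩ adj p) + # W)
      sizes = trans (#-∩∁ A Q) (cong (# M +_) (#-∩∁ A∖M (adj p)))
      W≤2 : # W ≤ 2
      W≤2 = (deduce (# A ∷ # M ∷ # RA ∷ # (A∖M ∩ adj p) ∷ # W ∷ []) ((0 ∣ 1 ∙ v0 ≋ v1 ⊕ (v3 ⊕ v4)) ∷ (1 ∣ 0 ∙ v0 ≋ con
          10) ∷ (1 ∙ con 4 ⊑ v1) ∷ (0 ∣ 1 ∙ v2 ≋ con 4) ∷ (1 ∙ v2 ⊑ v3) ∷ []) 1 (v4) (con 2) sizes a≡10 M≥4 dA-p
          (#-mono {S = RA} RA⊆))
      M≤4 : # M ≤ 4
      M≤4 = (deduce (# M ∷ Σ M (deg-in RA) ∷ Σ A (deg-in RA) ∷ []) ((1 ∙ 2 ⊙ v0 ⊑ v1) ∷ (1 ∙ v1 ⊑ v2) ∷ (1 ∙ v2 ⊑ con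
          8) ∷ []) 2 (v0) (con 4) ΣM-RA (Σ-⊆ M A (deg-in RA) (∩ˡ A Q)) ΣA-RA)
      W≥1 : 1 ≤ # W
      W≥1 = (deduce (# A ∷ # M ∷ # RA ∷ # (A∖M ∩ adj p) ∷ # W ∷ []) ((1 ∣ 0 ∙ v0 ≋ v1 ⊕ (v3 ⊕ v4)) ∷ (0 ∣ 1 ∙ v0 ≋ con
          10) ∷ (1 ∙ v1 ⊑ con 4) ∷ (1 ∣ 0 ∙ v2 ≋ con 4) ∷ (1 ∙ v3 ⊑ v2) ∷ []) 1 (con 1) (v4) sizes a≡10 M≤4 dA-p
          (#-mono {S = A∖M ∩ adj p} {T = RA} (λ q → ∩⁺ A (adj p) (∩ˡ A (∁ Q) (∩ˡ A∖M (adj p) q)) (∩ʳ A∖M (adj p) q))))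
      module _ {w : Fin n} (w∈W : w ∈ W) where
        w∈A∖M : w ∈ A∖M
        w∈A∖M = ∩ˡ A∖M (∁ (adj p)) w∈W
        w∈A : w ∈ A
        w∈A = ∩ˡ A (∁ Q) w∈A∖M
        -- In G[A] the vertices of `RA` have all their neighbours in `M`, and those of `M` have both
        -- of theirs in `RA`. So a vertex of `W` needs two neighbours within `W`, which has at most
        -- two vertices.
        W-closed : ∀ {x} → x ∈ A → x ∈ adj w → x ∈ W
        W-closed {x} q r = ∩⁺ A∖M (∁ (adj p)) (∩⁺ A (∁ Q) q (∁⁺ Q x∉Q)) (∁⁺ (adj p) x∉p)
          where
          x∉p : ¬ x ∈ adj p
          x∉p s = contradiction (≤-trans (length≤# (RA ∩ adj w) ([] ∷ []) (∩⁺ RA (adj w) (∩⁺ A (adj p) q s) r ∷ []))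
              (≤-trans (∈⇒≤Σ A∖M (deg-in RA) w∈A∖M) Σrest)) λ ()
          x∉Q : ¬ x ∈ Q
          x∉Q s = contradiction (≤-trans (s≤s (≥?⁻ 2 (deg-in RA) s)) (≤-trans (s≤s (#-mono {S = RA ∩ adj x} {T = A ∩
              adj x ∩ isnt w} λ {y} t →
              ∩⁺ (A ∩ adj x) (isnt w) (∩⁺ A (adj x) (∩ˡ A (adj p) (∩ˡ RA (adj x) t)) (∩ʳ RA (adj x) t))
                (≢⇒isnt {x = w} {y} λ { refl → ∁⁻ (adj p) (∩ʳ A∖M (∁ (adj p)) w∈W) (∩ʳ A (adj p) (∩ˡ RA (adj x) t))
                    })))
              (≤-trans (≤-reflexive (sym (#-split (A ∩ adj x) {w} (∩⁺ A (adj x) w∈A (adj-flip r))))) (dA≤2 q)))) λ {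
                  (s≤s (s≤s ())) }
        w-nbrs : 3 ≤ # W
        w-nbrs = ≤-trans (s≤s (≤-trans (2≤dA (A⇒O w∈A)) (#-mono {S = A ∩ adj w} {T = W ∩ isnt w} λ q →
          ∩⁺ W (isnt w) (W-closed (∩ˡ A (adj w) q) (∩ʳ A (adj w) q)) (≢⇒isnt (adj⇒≢ {w} (∩ʳ A (adj w) q))))))
              (≤-reflexive (sym (#-split W {w} w∈W)))

      contra : ⊥
      contra = let w , w∈W = #≥1⇒∃ W W≥1 in contradiction (≤-trans (w-nbrs w∈W) W≤2) λ { (s≤s (s≤s ())) }

    not-2-regular : ¬ (Σ A dA ≤ 20)
    not-2-regular ΣA≤20 = 2-Regular.contra ΣA≤20 (proj₂ (#≥1⇒∃ N (≤-trans (s≤s z≤n) (≤-reflexive (sym dv)))))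

    -- `ΣA-dA` and `4+H≤z` bound the degree sum of G[A] by 30 - 8 = 22. Being even, it is at most 20
    -- or equal to 22, and in the latter case all estimates used are equalities.
    2-regular : Σ A dA ≤ 20 ⊎ (Σ O h ≤ 0 × # Z ≤ 4 × 1 ≤ # Z × Σ Z dA ≤ 8)
    2-regular with inner-even A
    ... | k , even with k ≤? 10
    ...   | yes k≤10 = inj₁ (≤-trans (≤-reflexive even) (*-monoʳ-≤ 2 k≤10))
    ...   | no k≰10 = inj₂
      ( (deduce (k ∷ Σ A dA ∷ # Z ∷ Σ A h ∷ Σ O h ∷ []) ((2 ∙ con 11 ⊑ v0) ∷ (0 ∣ 1 ∙ v1 ≋ 2 ⊙ v0) ∷ (1 ∙ v1 ⊕ 2 ⊙ v2
          ⊑ con 30 ⊕ v3) ∷ (2 ∙ con 4 ⊕ v4 ⊑ v2) ∷ (1 ∙ v3 ⊑ v4) ∷ []) 1 (v4) (con 0) (≰⇒> k≰10) even ΣA-dA 4+H≤z (Σ-⊆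
          A O h A⇒O))
      , (deduce (k ∷ Σ A dA ∷ # Z ∷ Σ A h ∷ Σ O h ∷ []) ((2 ∙ con 11 ⊑ v0) ∷ (0 ∣ 1 ∙ v1 ≋ 2 ⊙ v0) ∷ (1 ∙ v1 ⊕ 2 ⊙ v2
          ⊑ con 30 ⊕ v3) ∷ (1 ∙ con 4 ⊕ v4 ⊑ v2) ∷ (1 ∙ v3 ⊑ v4) ∷ []) 1 (v2) (con 4) (≰⇒> k≰10) even ΣA-dA 4+H≤z (Σ-⊆
          A O h A⇒O))
      , ≤-trans (s≤s z≤n) 4+H≤z
      , (deduce (k ∷ Σ A dA ∷ Σ O dA ∷ # Z ∷ Σ A h ∷ Σ C dA ∷ Σ Z dA ∷ Σ A dO ∷ # A ∷ Σ A dN ∷ Σ O h ∷ []) ((4 ∙ con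
          11 ⊑ v0) ∷ (0 ∣ 2 ∙ v1 ≋ 2 ⊙ v0) ∷ (0 ∣ 1 ∙ v2 ≋ v1 ⊕ (v5 ⊕ v6)) ∷ (1 ∣ 0 ∙ v2 ≋ v7) ∷ (0 ∣ 1 ∙ 5 ⊙ v8 ⊕ v4
          ≋ v9 ⊕ v7) ∷ (1 ∙ 2 ⊙ v8 ⊑ v9) ∷ (3 ∣ 0 ∙ v8 ≋ con 10) ∷ (1 ∙ v1 ⊕ 2 ⊙ v3 ⊑ con 30 ⊕ v4) ∷ (2 ∙ con 4 ⊕ v10
          ⊑ v3) ∷ (2 ∙ v4 ⊑ v10) ∷ []) 1 (v6) (con 8) (≰⇒> k≰10) even (Σ-classes dA) (double-count O A) ΣA-d ΣA-dN≥
          a≡10 ΣA-dA 4+H≤z (Σ-⊆ A O h A⇒O)) )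

  -- Now G is 5-regular and Z induces K₄, whose vertices lie in triangles.
  module K₄ (v : Fin n) (dv : d v ≡ 5) (k≡0 : Σ (adj v) h ≡ 0) where
    open Tamed v dv k≡0

    module _ (H≤0 : Σ O h ≤ 0) (Z≤4 : # Z ≤ 4) (ZA≤8 : Σ Z dA ≤ 8) where
      hO : ∀ {x} → x ∈ O → h x ≡ 0
      hO p = n≤0⇒n≡0 (≤-trans (∈⇒≤Σ O h p) H≤0)

      4≤Z : 4 ≤ # Z
      4≤Z = ≤-trans (m≤m+n 4 _) 4+H≤z

      dA≤2 : ∀ {z} → z ∈ Z → dA z ≤ 2
      dA≤2 = Σ-tight Z dA 2 dA≥2-Z (≤-trans ZA≤8 (*-monoʳ-≤ 2 4≤Z))

      3≤dZ : ∀ {z} → z ∈ Z → 3 ≤ dZ z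
      3≤dZ {z} p = (deduce (d z ∷ h z ∷ dN z ∷ dO z ∷ dA z ∷ dC z ∷ dZ z ∷ []) ((0 ∣ 1 ∙ v0 ≋ con 5 ⊕ v1) ∷ (1 ∣ 0 ∙
          v0 ≋ v2 ⊕ v3) ∷ (1 ∣ 0 ∙ v3 ≋ v4 ⊕ (v5 ⊕ v6)) ∷ (1 ∣ 0 ∙ v2 ≋ con 0) ∷ (1 ∙ v4 ⊑ con 2) ∷ (1 ∣ 0 ∙ v5 ≋ con
          0) ∷ []) 1 (con 3) (v6) (d≡5+h z) (d-O (Z⇒O p)) (dO-classes z) (Z⇒dN≡0 p) (dA≤2 p) (#≡0 (C ∩ adj z) λ y q →
          C-∅ (∩ˡ C (adj z) q)))

      tame : ∀ {z} → z ∈ Z → Σ (adj z) h ≡ 0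
      tame {z} z∈Z = n≤0⇒n≡0 (Σ-⊑ (adj z) (h ∷ []) v0 (con 0) λ x q → ≤-reflexive (hO (neighbour-O z∈Z q)))

      Z-clique : ∀ {x y} → x ∈ Z → y ∈ Z → x ≢ y → y ∈ adj x
      Z-clique {x} {y} x∈Z y∈Z x≢y with ∈? (adj x) y
      ... | yes xy = xy
      ... | no ¬xy = ⊥-elim (refute (# Z ∷ # (Z ∩ isnt x) ∷ # (Z ∩ isnt x ∩ isnt y) ∷ dZ x ∷ []) ((1 ∙ v0 ⊑ con 4) ∷
          (0 ∣ 1 ∙ v0 ≋ con 1 ⊕ v1) ∷ (0 ∣ 1 ∙ v1 ≋ con 1 ⊕ v2) ∷ (1 ∙ con 3 ⊑ v3) ∷ (1 ∙ v3 ⊑ v2) ∷ []) Z≤4 (#-split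
          Z {x} x∈Z) (#-split (Z ∩ isnt x) {y} (∩⁺ Z (isnt x) y∈Z (≢⇒isnt x≢y))) (3≤dZ x∈Z) sub)
        where
        sub : dZ x ≤ # (Z ∩ isnt x ∩ isnt y)
        sub = #-mono {S = Z ∩ adj x} {T = Z ∩ isnt x ∩ isnt y} λ {w} q →
          ∩⁺ (Z ∩ isnt x) (isnt y) (∩⁺ Z (isnt x) (∩ˡ Z (adj x) q) (≢⇒isnt (adj⇒≢ {x} (∩ʳ Z (adj x) q))))
             (≢⇒isnt {x = y} {w} λ { refl → ¬xy (∩ʳ Z (adj x) q) })

      -- With all its neighbours of degree five, z can itself be the root, so its neighbourhood
      -- would be independent; but z lies in a triangle of `Z`.
      no-K₄ : ∀ {z} → z ∈ Z → ⊥
      no-K₄ {z} z∈Z =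
        let x , y , px , py , x≢y = #≥2⇒∃ (Z ∩ adj z) (≤-trans (s≤s (s≤s z≤n)) (3≤dZ z∈Z))
        in Tamed.N-independent z (trans (d≡5+h z) (cong (5 +_) (hO (Z⇒O z∈Z)))) (tame z∈Z)
             (∩ʳ Z (adj z) px) (∩ʳ Z (adj z) py) (Z-clique (∩ˡ Z (adj z) px) (∩ˡ Z (adj z) py) x≢y)

  impossible : ∀ v → d v ≡ 5 → ⊥
  impossible v₀ dv₀ =
    let v , dv , good = good-root v₀ dv₀
        t = tame-vertex v dv good
    in finish (Tame.u t) (Tame.du t) (Tame.tame t)
    where
    finish : ∀ v (dv : d v ≡ 5) → Σ (adj v) h ≡ 0 → ⊥
    finish v dv k≡0 =
      [ Tamed.not-2-regular v dv k≡0
      , (λ (H≤0 , Z≤4 , 1≤Z , ZA≤8) → K₄.no-K₄ v dv k≡0 H≤0 Z≤4 ZA≤8 (proj₂ (#≥1⇒∃ (At.Z v dv) 1≤Z)))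
      ]′ (Tamed.2-regular v dv k≡0)

-- Minimum degree two, lower bound

module _ {n : ℕ} {B : Set} (b : Fin n) (u : B) (f : Fin n → B) where
  update : Fin n → B
  update x = if is b x then u else f x

  update-same : update b ≡ u
  update-same = cong (if_then u else f b) (is-refl b)

  update-other : ∀ {x} → b ≢ x → update x ≡ f x
  update-other {x} p with b Fin.≟ x
  ... | yes q = ⊥-elim (p q)
  ... | no _  = refl

module Peeling {n : ℕ} (G : Graph n) (wt : Fin n → ℕ) where
  open Adjacency G

  -- The components of G[X] that are trees of weight 0 are labelled by Fin κ.
  -- The rank is the order in which the labelled vertices can be removed, each
  -- having at most one neighbour left at that moment.
  record Forest (X : Sub n) : Set where
    field
      κ         : ℕ
      label     : Fin n → Maybe (Fin κ)
      rank      : Fin n → ℕ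
      rep       : Fin κ → Fin n
      rep-label : ∀ i → label (rep i) ≡ just i
      label-∈   : ∀ {x i} → label x ≡ just i → x ∈ X
      label-0   : ∀ {x i} → label x ≡ just i → wt x ≡ 0
      edge      : ∀ {x y} → x ∈ X → y ∈ X → y ∈ adj x → label x ≡ label y
      up        : ∀ {x y z i} → label x ≡ just i → y ∈ X → z ∈ X → y ∈ adj x → z ∈ adj x →
                  rank x ≤ rank y → rank x ≤ rank z → y ≡ z
      count     : 2 * # X ≤ Σ X (λ x → 2 * wt x + deg-in X x) + 2 * κ

  -- Halved, `count` says that vertices are at most weights plus edges plus trees. Here every vertex
  -- pays for itself, by weight one or by two half-edges.
  core : ∀ X → (∀ {x} → x ∈ X → 1 ≤ wt x ⊎ 2 ≤ deg-in X x) → Forest X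
  core X h = record
    { κ = 0 ; label = λ _ → nothing ; rank = λ _ → 0 ; rep = λ () ; rep-label = λ () ; label-∈ = λ () ; label-0 = λ ()
    ; edge = λ _ _ _ → refl ; up = λ ()
    ; count = ≤-trans (Σ-⊑ X ((λ x → 2 * wt x + deg-in X x) ∷ []) (con 2) v0 λ x p → lem (h p)) (m≤m+n _ 0) }
    where
    lem : ∀ {p q} → 1 ≤ p ⊎ 2 ≤ q → 2 ≤ 2 * p + q
    lem {p} {q} (inj₁ r) = (deduce (p ∷ q ∷ []) ((2 ∙ con 1 ⊑ v0) ∷ []) 1 (con 2) (2 ⊙ v0 ⊕ v1) r)
    lem {p} {q} (inj₂ r) = (deduce (p ∷ q ∷ []) ((1 ∙ con 2 ⊑ v1) ∷ []) 1 (con 2) (2 ⊙ v0 ⊕ v1) r)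

  module _ (X : Sub n) {b : Fin n} (b∈X : b ∈ X) (b-0 : wt b ≡ 0) (b≤1 : deg-in X b ≤ 1) where
    X∖b : Sub n
    X∖b = X ∩ isnt b

    private
      X∖b⁺ : ∀ {x} → x ∈ X → b ≢ x → x ∈ X∖b
      X∖b⁺ p q = ∩⁺ X (isnt b) p (≢⇒isnt q)

      b-nbr : ∀ {y z} → y ∈ X → z ∈ X → y ∈ adj b → z ∈ adj b → y ≡ z
      b-nbr {y} {z} p q r s with y Fin.≟ z
      ... | yes t = t
      ... | no t = contradiction (≤-trans (length≤# (X ∩ adj b) ((t ∷ []) ∷ [] ∷ []) (∩⁺ X (adj b) p r ∷ ∩⁺ X (adj b)
          q s ∷ [])) b≤1) λ { (s≤s ()) }

      score score′ : Fin n → ℕ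
      score  x = 2 * wt x + deg-in X x
      score′ x = 2 * wt x + deg-in X∖b x

      -- Deleting b loses its own degree and, once more, one at each of its neighbours.
      score-split : Σ X∖b score′ + (deg-in X b + deg-in X∖b b) ≤ Σ X score
      score-split = (deduce (Σ X score ∷ Σ X∖b score ∷ Σ X∖b score′ ∷ Σ X∖b wt ∷ Σ X∖b (deg-in X) ∷ Σ X∖b (deg-in X∖b)
          ∷ Σ X (deg-in X∖b) ∷ deg-in X b ∷ deg-in X∖b b ∷ wt b ∷ []) ((0 ∣ 1 ∙ v0 ≋ 2 ⊙ v9 ⊕ v7 ⊕ v1) ∷ (0 ∣ 1 ∙ v1 ≋
          2 ⊙ v3 ⊕ v4) ∷ (1 ∣ 0 ∙ v2 ≋ 2 ⊙ v3 ⊕ v5) ∷ (0 ∣ 1 ∙ v4 ≋ v6) ∷ (0 ∣ 1 ∙ v6 ≋ v8 ⊕ v5) ∷ []) 1 (v2 ⊕ (v7 ⊕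
          v8)) (v0) (Σ-remove X score {b} b∈X) (Σ-≋ X∖b (score ∷ wt ∷ deg-in X ∷ []) v0 (2 ⊙ v1 ⊕ v2) (λ _ _ → refl))
          (Σ-≋ X∖b (score′ ∷ wt ∷ deg-in X∖b ∷ []) v0 (2 ⊙ v1 ⊕ v2) (λ _ _ → refl)) (double-count X∖b X) (Σ-remove X
          (deg-in X∖b) {b} b∈X))

      module Extend (F : Forest X∖b) where
        open Forest F

        -- b is peeled before everything that remains, so it receives rank 0 and all other ranks
        -- move up.
        rank′ : Fin n → ℕ
        rank′ = update b 0 (suc ∘ rank)

        above : ∀ {x y} → b ≢ x → rank′ x ≤ rank′ y → b ≢ y × rank x ≤ rank y
        above {x} b≢x p rewrite update-other b 0 (suc ∘ rank) b≢x = lem p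
          where
          lem : ∀ {y} → suc (rank x) ≤ rank′ y → b ≢ y × rank x ≤ rank y
          lem {y} q with b Fin.≟ y
          ... | no b≢y = b≢y , ≤-pred q

      -- b starts a new tree; the two units it lacks in `count` come from the increase of κ.
      isolated : (∀ {y} → y ∈ X → ¬ y ∈ adj b) → Forest X∖b → Forest X
      isolated none F = record
        { κ = suc κ ; label = label′ ; rank = rank′ ; rep = rep′ ; rep-label = rep-label′ ; label-∈ = ∈′ ; label-0 =
            zero′ ; edge = edge′ ; up = up′
        ; count = (deduce (# X ∷ # X∖b ∷ Σ X score ∷ Σ X∖b score′ ∷ deg-in X b ∷ deg-in X∖b b ∷ κ ∷ suc κ ∷ []) ((2 ∣
            0 ∙ v0 ≋ con 1 ⊕ v1) ∷ (1 ∙ 2 ⊙ v1 ⊑ v3 ⊕ 2 ⊙ v6) ∷ (1 ∙ v3 ⊕ (v4 ⊕ v5) ⊑ v2) ∷ (0 ∣ 2 ∙ v7 ≋ con 1 ⊕ v6)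
            ∷ []) 1 (2 ⊙ v0) (v2 ⊕ 2 ⊙ v7) (#-split X {b} b∈X) count score-split refl) }
        where
        open Forest F
        open Extend F
        label′ : Fin n → Maybe (Fin (suc κ))
        label′ = update b (just zero) (Maybe.map suc ∘ label)
        other : ∀ {x} → b ≢ x → label′ x ≡ Maybe.map suc (label x)
        other = update-other b (just zero) (Maybe.map suc ∘ label)
        rep′ : Fin (suc κ) → Fin n
        rep′ zero    = b
        rep′ (suc i) = rep i
        b≢ : ∀ {x i} → label x ≡ just i → b ≢ x
        b≢ p = isnt⇒≢ (∩ʳ X (isnt b) (label-∈ p))
        rep-label′ : ∀ i → label′ (rep′ i) ≡ just i
        rep-label′ zero    = update-same b (just zero) (Maybe.map suc ∘ label)
        rep-label′ (suc i) = trans (other (b≢ (rep-label i))) (cong (Maybe.map suc) (rep-label i))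
        old : ∀ {x i} → b ≢ x → label′ x ≡ just i → ∃[ j ] label x ≡ just j
        old {x} p q with label x | trans (sym (other p)) q
        ... | just j | _ = j , refl
        ∈′ : ∀ {x i} → label′ x ≡ just i → x ∈ X
        ∈′ {x} p with b Fin.≟ x
        ... | yes refl = b∈X
        ... | no q     = ∩ˡ X (isnt b) (label-∈ (proj₂ (old q (trans (other q) p))))
        zero′ : ∀ {x i} → label′ x ≡ just i → wt x ≡ 0
        zero′ {x} p with b Fin.≟ x
        ... | yes refl = b-0
        ... | no q     = label-0 (proj₂ (old q (trans (other q) p)))
        edge′ : ∀ {x y} → x ∈ X → y ∈ X → y ∈ adj x → label′ x ≡ label′ y
        edge′ {x} {y} p q r with b Fin.≟ x | b Fin.≟ y
        ... | yes refl | _        = ⊥-elim (none q r)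
        ... | no _     | yes refl = ⊥-elim (none p (adj-flip r))
        ... | no s     | no t     = cong (Maybe.map suc) (edge (X∖b⁺ p s) (X∖b⁺ q t) r)
        up′ : ∀ {x y z i} → label′ x ≡ just i → y ∈ X → z ∈ X → y ∈ adj x → z ∈ adj x → rank′ x ≤ rank′ y → rank′ x ≤
            rank′ z → y ≡ z
        up′ {x} p q r s t u w = go (b Fin.≟ x)
          where
          go : Dec (b ≡ x) → _
          go (yes refl) = ⊥-elim (none q s)
          go (no b≢x) = up (proj₂ (old b≢x p)) (X∖b⁺ q (proj₁ (above b≢x u))) (X∖b⁺ r (proj₁ (above b≢x w))) s t
              (proj₂ (above b≢x u)) (proj₂ (above b≢x w))

      -- b joins the component of its only remaining neighbour y and copies its label, `nothing`
      -- included. The edge from b to y pays two units.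
      pendant : ∀ {y} → y ∈ X → y ∈ adj b → Forest X∖b → Forest X
      pendant {y} y∈X e F = record
        { κ = κ ; label = label′ ; rank = rank′ ; rep = rep ; rep-label = rep-label′ ; label-∈ = ∈′ ; label-0 = zero′
            ; edge = edge′ ; up = up′
        ; count = (deduce (# X ∷ # X∖b ∷ Σ X score ∷ Σ X∖b score′ ∷ deg-in X b ∷ deg-in X∖b b ∷ κ ∷ []) ((2 ∣ 0 ∙ v0 ≋
            con 1 ⊕ v1) ∷ (1 ∙ 2 ⊙ v1 ⊑ v3 ⊕ 2 ⊙ v6) ∷ (1 ∙ v3 ⊕ (v4 ⊕ v5) ⊑ v2) ∷ (1 ∙ con 1 ⊑ v4) ∷ (1 ∙ con 1 ⊑ v5)
            ∷ []) 1 (2 ⊙ v0) (v2 ⊕ 2 ⊙ v6) (#-split X {b} b∈X) count score-split (length≤# (X ∩ adj b) ([] ∷ []) (∩⁺ X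
            (adj b) y∈X e ∷ [])) (length≤# (X∖b ∩ adj b) ([] ∷ []) (∩⁺ X∖b (adj b) (X∖b⁺ y∈X (adj⇒≢ e)) e ∷ []))) }
        where
        open Forest F
        open Extend F
        label′ : Fin n → Maybe (Fin κ)
        label′ = update b (label y) label
        other : ∀ {x} → b ≢ x → label′ x ≡ label x
        other = update-other b (label y) label
        b≢ : ∀ {x i} → label x ≡ just i → b ≢ x
        b≢ p = isnt⇒≢ (∩ʳ X (isnt b) (label-∈ p))
        rep-label′ : ∀ i → label′ (rep i) ≡ just i
        rep-label′ i = trans (other (b≢ (rep-label i))) (rep-label i)
        ∈′ : ∀ {x i} → label′ x ≡ just i → x ∈ X
        ∈′ {x} p with b Fin.≟ x
        ... | yes refl = b∈X
        ... | no q     = ∩ˡ X (isnt b) (label-∈ p)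
        zero′ : ∀ {x i} → label′ x ≡ just i → wt x ≡ 0
        zero′ {x} p with b Fin.≟ x
        ... | yes refl = b-0
        ... | no q     = label-0 p
        edge′ : ∀ {x z} → x ∈ X → z ∈ X → z ∈ adj x → label′ x ≡ label′ z
        edge′ {x} {z} p q r with b Fin.≟ x | b Fin.≟ z
        ... | yes refl | yes refl = refl
        ... | yes refl | no _     = cong label (b-nbr y∈X q e r)
        ... | no _     | yes refl = cong label (b-nbr p y∈X (adj-flip r) e)
        ... | no s     | no t     = edge (X∖b⁺ p s) (X∖b⁺ q t) r
        up′ : ∀ {x y z i} → label′ x ≡ just i → y ∈ X → z ∈ X → y ∈ adj x → z ∈ adj x → rank′ x ≤ rank′ y → rank′ x ≤
            rank′ z → y ≡ z
        up′ {x} p q r s t u w = go (b Fin.≟ x)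
          where
          go : Dec (b ≡ x) → _
          go (yes refl) = b-nbr q r s t
          go (no b≢x) = up (trans (sym (other b≢x)) p) (X∖b⁺ q (proj₁ (above b≢x u))) (X∖b⁺ r (proj₁ (above b≢x w))) s
              t (proj₂ (above b≢x u)) (proj₂ (above b≢x w))

    extend : Forest X∖b → Forest X
    extend F with Fin.any? (∈? (X ∩ adj b))
    ... | yes (y , p) = pendant (∩ˡ X (adj b) p) (∩ʳ X (adj b) p) F
    ... | no none     = isolated (λ {y} p q → none (y , ∩⁺ X (adj b) p q)) F

  -- Vertices of weight 0 with at most one remaining neighbour are peeled off; what resists is a
  -- core and carries no label. The size k drives the recursion.
  forest : ∀ k X → # X ≡ k → Forest X
  forest k X eq with Fin.any? (∈? (X ∩ ∁ (≥? 1 wt) ∩ ∁ (≥? 2 (deg-in X))))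
  ... | no none = core X λ {x} p → lem p (∈? (≥? 1 wt) x) (∈? (≥? 2 (deg-in X)) x)
    where
    lem : ∀ {x} → x ∈ X → Dec (x ∈ ≥? 1 wt) → Dec (x ∈ ≥? 2 (deg-in X)) → 1 ≤ wt x ⊎ 2 ≤ deg-in X x
    lem p (yes q) _ = inj₁ (≥?⁻ 1 wt q)
    lem p (no _) (yes r) = inj₂ (≥?⁻ 2 (deg-in X) r)
    lem {x} p (no q) (no r) = ⊥-elim (none (x , ∩⁺ (X ∩ ∁ (≥? 1 wt)) (∁ (≥? 2 (deg-in X))) (∩⁺ X (∁ (≥? 1 wt)) p (∁⁺
        (≥? 1 wt) q)) (∁⁺ (≥? 2 (deg-in X)) r)))
  forest zero X eq | yes (b , p) = contradiction (≤-trans (length≤# X ([] ∷ []) (∩ˡ X (∁ (≥? 1 wt)) (∩ˡ (X ∩ ∁ (≥? 1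
      wt)) (∁ (≥? 2 (deg-in X))) p) ∷ [])) (≤-reflexive eq)) λ ()
  forest (suc k) X eq | yes (b , p) = extend X b∈X
      (n≤0⇒n≡0 (≤-pred (∁≥?⁻ 1 wt (∩ʳ X (∁ (≥? 1 wt)) (∩ˡ (X ∩ ∁ (≥? 1 wt)) (∁ (≥? 2 (deg-in X))) p)))))
      (≤-pred (∁≥?⁻ 2 (deg-in X) (∩ʳ (X ∩ ∁ (≥? 1 wt)) (∁ (≥? 2 (deg-in X))) p)))
      (forest k (X ∩ isnt b) (suc-injective (trans (sym (#-split X {b} b∈X)) eq)))
    where
    b∈X : b ∈ X
    b∈X = ∩ˡ X (∁ (≥? 1 wt)) (∩ˡ (X ∩ ∁ (≥? 1 wt)) (∁ (≥? 2 (deg-in X))) p)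

module Two {n : ℕ} (G : Graph n) (linked : Adjacency.Linked G) (free : Adjacency.K₃₃-free G)
           (v : Fin n) (dv : Adjacency.d G v ≡ 2) where
  open Adjacency G
  open Rooted G v

  B : Sub n
  B = O₁

  dB : Fin n → ℕ
  dB = deg-in B

  N₂-∅ : ∀ {c} → ¬ c ∈ N₂
  N₂-∅ {c} p =
    let x , y , px , py , x≢y = #≥2⇒∃ (N ∩ adj c) (N₂⇒2≤dN p)
    in contradiction (≤-trans (length≤# N ((adj⇒≢ (∩ʳ N (adj c) px) ∷ adj⇒≢ (∩ʳ N (adj c) py) ∷ []) ∷ (x≢y ∷ []) ∷ []
        ∷ [])
                       (N₂⇒N p ∷ ∩ˡ N (adj c) px ∷ ∩ˡ N (adj c) py ∷ [])) (≤-reflexive dv)) λ { (s≤s (s≤s ())) }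

  2≤dA : ∀ {w} → w ∈ O → 2 ≤ dA w
  2≤dA {w} p = ≤-trans (served linked p) (≤-reflexive (trans (cong (dA w +_) (#≡0 (N₂ ∩ adj w) λ c q → N₂-∅ (∩ˡ N₂
      (adj w) q))) (+-identityʳ _)))

  -- The surplus over the two neighbours in `A` that every vertex of `O` has; there the truncated
  -- subtraction is exact. Weight 0 thus means two neighbours in `A` and none in N.
  wt : Fin n → ℕ
  wt x = dN x + dA x ∸ 2

  wt+2 : ∀ {x} → x ∈ O → wt x + 2 ≡ dN x + dA x
  wt+2 {x} p = m∸n+n≡m (≤-trans (2≤dA p) (m≤n+m (dA x) (dN x)))

  open Peeling G wt
  open Forest (forest (# B) B refl)

  module _ {x : Fin n} {i : Fin κ} (lx : label x ≡ just i) where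
    private
      x∈O : x ∈ O
      x∈O = O₁⇒O (label-∈ lx)

    dA≤2 : dA x ≤ 2
    dA≤2 = (deduce (wt x ∷ dN x ∷ dA x ∷ []) ((0 ∣ 1 ∙ v0 ⊕ con 2 ≋ v1 ⊕ v2) ∷ (1 ∣ 0 ∙ v0 ≋ con 0) ∷ []) 1 (v2) (con
        2) (wt+2 x∈O) (label-0 lx))

    dN≤0 : dN x ≤ 0
    dN≤0 = (deduce (wt x ∷ dN x ∷ dA x ∷ []) ((0 ∣ 1 ∙ v0 ⊕ con 2 ≋ v1 ⊕ v2) ∷ (1 ∣ 0 ∙ v0 ≋ con 0) ∷ (1 ∙ con 2 ⊑ v2)
        ∷ []) 1 (v1) (con 0) (wt+2 x∈O) (label-0 lx) (2≤dA x∈O))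

    A⊎B : ∀ {y} → y ∈ adj x → y ∈ A ⊎ y ∈ B
    A⊎B {y} p with trichotomy y | ∈? (≥? 2 dN) y
    ... | inj₁ refl     | _     = contradiction (trans (sym (O⇒¬v x∈O)) p) λ ()
    ... | inj₂ (inj₁ q) | _ = contradiction (≤-trans (length≤# (N ∩ adj x) ([] ∷ []) (∩⁺ N (adj x) q p ∷ [])) dN≤0) λ
        ()
    ... | inj₂ (inj₂ q) | yes r = inj₁ (∩⁺ O (≥? 2 dN) q r)
    ... | inj₂ (inj₂ q) | no r  = inj₂ (∩⁺ O (∁ (≥? 2 dN)) q (∁⁺ (≥? 2 dN) r))

    same-tree : ∀ {y} → y ∈ B → y ∈ adj x → label y ≡ just i
    same-tree p q = trans (sym (edge (label-∈ lx) p q)) lx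

    pair : ∀ {r s u} → r ∈ A → s ∈ A → u ∈ A → r ∈ adj x → s ∈ adj x → u ∈ adj x → r ≢ s → u ≡ r ⊎ u ≡ s
    pair {r} {s} {u} r∈A s∈A u∈A xr xs xu r≢s with u Fin.≟ r | u Fin.≟ s
    ... | yes p | _     = inj₁ p
    ... | no _  | yes q = inj₂ q
    ... | no p  | no q  = contradiction (≤-trans (length≤# (A ∩ adj x) ((p ∷ q ∷ []) ∷ (r≢s ∷ []) ∷ [] ∷ [])
                            (∩⁺ A (adj x) u∈A xu ∷ ∩⁺ A (adj x) r∈A xr ∷ ∩⁺ A (adj x) s∈A xs ∷ [])) dA≤2) λ { (s≤s
                                (s≤s ())) }

    -- x has only two neighbours in A, so a common neighbour of both is a
    -- neighbour of each.
    transfer : ∀ {r s u t} → r ∈ A → s ∈ A → u ∈ A → r ∈ adj x → s ∈ adj x → u ∈ adj x → r ≢ s → r ∈ adj t → s ∈ adj t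
        → u ∈ adj t
    transfer r∈A s∈A u∈A xr xs xu r≢s tr ts with pair r∈A s∈A u∈A xr xs xu r≢s
    ... | inj₁ refl = tr
    ... | inj₂ refl = ts

  module _ {i j : Fin κ} (i≢j : i ≢ j) where
    private
      non-adjacent : ∀ {x y} → label x ≡ just i → label y ≡ just j → ¬ y ∈ adj x
      non-adjacent lx ly p = i≢j (just-injective (trans (sym lx) (trans (edge (label-∈ lx) (label-∈ ly) p) ly)))

      distinct : ∀ {x y} → label x ≡ just i → label y ≡ just j → x ≢ y
      distinct lx ly refl = i≢j (just-injective (trans (sym lx) ly))

      loop : ∀ {x} → ¬ x ∈ adj x
      loop p = adj⇒≢ p refl

    -- Among the vertices of two different trees with the same neighbours r, s
    -- in A the ones of lowest rank have at most one neighbour of that kind.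
    no-common-pair : ∀ m {x y r s} → rank x + rank y < m → label x ≡ just i → label y ≡ just j → r ∈ A → s ∈ A → r ≢ s
        →
                     r ∈ adj x → s ∈ adj x → r ∈ adj y → s ∈ adj y → ⊥
    no-common-pair (suc m) {x} {y} {r} {s} (s≤s small) lx ly r∈A s∈A r≢s xr xs yr ys = cases (A⊎B ly wP) (A⊎B ly wQ)
      where
      l : Link x y
      l = linked (distinct lx ly) (¬∈⇒false {S = adj x} (non-adjacent lx ly))
      open Link l
      R-A : ∀ {p u} → p ∈ B → p ∈ adj y → u ∈ adj x → u ∈ adj p → u ∈ A
      R-A p∈B yp xu pu with A⊎B lx xu
      ... | inj₁ q = q
      ... | inj₂ q = ⊥-elim (non-adjacent (same-tree lx q xu) (same-tree ly p∈B yp) (adj-flip pu))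
      -- A neighbour of y in A adjacent to both R and S would be R or S itself.
      no-A : ∀ {q} → R ∈ A → S ∈ A → q ∈ A → q ∈ adj y → R ∈ adj q → S ∈ adj q → ⊥
      no-A R∈A S∈A q∈A yq qR qS with pair ly r∈A s∈A q∈A yr ys yq r≢s
      ... | inj₁ refl = loop (transfer lx R∈A S∈A r∈A uR uS xr R≢S qR qS)
      ... | inj₂ refl = loop (transfer lx R∈A S∈A s∈A uR uS xs R≢S qR qS)
      -- Here {R, S} = {r, s}, so `P` and `Q` have the same pair. They lie in the tree of y, and by
      -- `up` one of them has lower rank than y.
      lower-y : P ∈ B → Q ∈ B → R ∈ A → S ∈ A → ⊥
      lower-y P∈B Q∈B R∈A S∈A with rank y ≤? rank P | rank y ≤? rank Q
      ... | yes p | yes q = P≢Q (up ly P∈B Q∈B wP wQ p q)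
      ... | no p | _ = no-common-pair m (≤-trans (+-monoʳ-< (rank x) (≰⇒> p)) small) lx (same-tree ly P∈B wP) r∈A s∈A
          r≢s xr xs
                              (transfer lx R∈A S∈A r∈A uR uS xr R≢S PR PS) (transfer lx R∈A S∈A s∈A uR uS xs R≢S PR
                                  PS)
      ... | _ | no q = no-common-pair m (≤-trans (+-monoʳ-< (rank x) (≰⇒> q)) small) lx (same-tree ly Q∈B wQ) r∈A s∈A
          r≢s xr xs
                              (transfer lx R∈A S∈A r∈A uR uS xr R≢S QR QS) (transfer lx R∈A S∈A s∈A uR uS xs R≢S QR
                                  QS)
      no-A′ : ∀ {q} → P ∈ A → Q ∈ A → q ∈ A → q ∈ adj x → P ∈ adj q → Q ∈ adj q → ⊥
      no-A′ P∈A Q∈A q∈A xq qP qQ with pair lx r∈A s∈A q∈A xr xs xq r≢s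
      ... | inj₁ refl = loop (transfer ly P∈A Q∈A r∈A wP wQ yr P≢Q qP qQ)
      ... | inj₂ refl = loop (transfer ly P∈A Q∈A s∈A wP wQ ys P≢Q qP qQ)
      lower-x : P ∈ A → Q ∈ A → R ∈ B → S ∈ B → ⊥
      lower-x P∈A Q∈A R∈B S∈B with rank x ≤? rank R | rank x ≤? rank S
      ... | yes p | yes q = R≢S (up lx R∈B S∈B uR uS p q)
      ... | no p | _ = no-common-pair m (≤-trans (+-monoˡ-< (rank y) (≰⇒> p)) small) (same-tree lx R∈B uR) ly r∈A s∈A
          r≢s
                              (transfer ly P∈A Q∈A r∈A wP wQ yr P≢Q (adj-flip PR) (adj-flip QR)) (transfer ly P∈A Q∈A
                                  s∈A wP wQ ys P≢Q (adj-flip PR) (adj-flip QR)) yr ys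
      ... | _ | no q = no-common-pair m (≤-trans (+-monoˡ-< (rank y) (≰⇒> q)) small) (same-tree lx S∈B uS) ly r∈A s∈A
          r≢s
                              (transfer ly P∈A Q∈A r∈A wP wQ yr P≢Q (adj-flip PS) (adj-flip QS)) (transfer ly P∈A Q∈A
                                  s∈A wP wQ ys P≢Q (adj-flip PS) (adj-flip QS)) yr ys
      cases : P ∈ A ⊎ P ∈ B → Q ∈ A ⊎ Q ∈ B → ⊥
      cases (inj₂ P∈B) (inj₂ Q∈B) = lower-y P∈B Q∈B (R-A P∈B wP uR PR) (R-A P∈B wP uS PS)
      cases (inj₂ P∈B) (inj₁ Q∈A) = no-A (R-A P∈B wP uR PR) (R-A P∈B wP uS PS) Q∈A wQ QR QS
      cases (inj₁ P∈A) (inj₂ Q∈B) = no-A (R-A Q∈B wQ uR QR) (R-A Q∈B wQ uS QS) P∈A wP PR PS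
      cases (inj₁ P∈A) (inj₁ Q∈A) with A⊎B lx uR | A⊎B lx uS
      ... | inj₂ R∈B | inj₂ S∈B = lower-x P∈A Q∈A R∈B S∈B
      ... | inj₁ R∈A | _        = no-A′ P∈A Q∈A R∈A uR (adj-flip PR) (adj-flip QR)
      ... | _        | inj₁ S∈A = no-A′ P∈A Q∈A S∈A uS (adj-flip PS) (adj-flip QS)

    -- By `no-common-pair` all of `P`, `Q`, `R`, `S` in a link between x and y lie in `A`. Hence {R,
    -- S} is the pair of x, {P, Q} is that of y, and the link joins them completely.
    joined : ∀ {x y r s} → label x ≡ just i → label y ≡ just j → r ∈ A → s ∈ A → r ∈ adj x → s ∈ adj y → s ∈ adj r
    joined {x} {y} {r} {s} lx ly r∈A s∈A xr ys =
      adj-flip (transfer lx R∈A S∈A r∈A uR uS xr R≢S (s-adj PR QR) (s-adj PS QS))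
      where
      l : Link x y
      l = linked (distinct lx ly) (¬∈⇒false {S = adj x} (non-adjacent lx ly))
      open Link l
      R-A : ∀ {p u} → p ∈ B → p ∈ adj y → u ∈ adj x → u ∈ adj p → u ∈ A
      R-A p∈B yp xu pu with A⊎B lx xu
      ... | inj₁ q = q
      ... | inj₂ q = ⊥-elim (non-adjacent (same-tree lx q xu) (same-tree ly p∈B yp) (adj-flip pu))
      in-A : ∀ {p} → p ∈ adj y → R ∈ adj p → S ∈ adj p → p ∈ A
      in-A yp pR pS with A⊎B ly yp
      ... | inj₁ q = q
      ... | inj₂ q = ⊥-elim (no-common-pair _ ≤-refl lx (same-tree ly q yp) (R-A q yp uR pR) (R-A q yp uS pS) R≢S uR
          uS pR pS)
      P∈A = in-A wP PR PS
      Q∈A = in-A wQ QR QS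
      in-A′ : ∀ {p} → p ∈ adj x → P ∈ adj p → Q ∈ adj p → p ∈ A
      in-A′ xp pP pQ with A⊎B lx xp
      ... | inj₁ q = q
      ... | inj₂ q = ⊥-elim (no-common-pair _ ≤-refl (same-tree lx q xp) ly P∈A Q∈A P≢Q pP pQ wP wQ)
      R∈A = in-A′ uR (adj-flip PR) (adj-flip QR)
      S∈A = in-A′ uS (adj-flip PS) (adj-flip QS)
      s-adj : ∀ {t} → t ∈ adj P → t ∈ adj Q → t ∈ adj s
      s-adj Pt Qt = adj-flip (transfer ly P∈A Q∈A s∈A wP wQ ys P≢Q (adj-flip Pt) (adj-flip Qt))

  record Pair (i : Fin κ) : Set where
    field
      r s : Fin n
      r∈A : r ∈ A
      s∈A : s ∈ A
      xr  : r ∈ adj (rep i)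
      xs  : s ∈ adj (rep i)
      r≢s : r ≢ s

  pair-of : ∀ i → Pair i
  pair-of i =
    let r , s , p , q , r≢s = #≥2⇒∃ (A ∩ adj (rep i)) (2≤dA (O₁⇒O (label-∈ (rep-label i))))
    in record { r = r ; s = s ; r∈A = ∩ˡ A (adj (rep i)) p ; s∈A = ∩ˡ A (adj (rep i)) q ; xr = ∩ʳ A (adj (rep i)) p ;
        xs = ∩ʳ A (adj (rep i)) q ; r≢s = r≢s }

  module _ {k : ℕ} (k≤κ : k ≤ κ) where
    tree : Fin k → Fin κ
    tree i = Fin.inject≤ i k≤κ

    module P (i : Fin k) = Pair (pair-of (tree i))

    across : ∀ {i j} → i ≢ j → ∀ {r s} → r ∈ A → s ∈ A → r ∈ adj (rep (tree i)) → s ∈ adj (rep (tree j)) → s ∈ adj r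
    across i≢j = joined (i≢j ∘ Fin.inject≤-injective k≤κ k≤κ _ _) (rep-label _) (rep-label _)

    rr : ∀ {i j} → i ≢ j → P.r j ∈ adj (P.r i)
    rr {i} {j} p = across p (P.r∈A i) (P.r∈A j) (P.xr i) (P.xr j)

    rs : ∀ {i j} → i ≢ j → P.s j ∈ adj (P.r i)
    rs {i} {j} p = across p (P.r∈A i) (P.s∈A j) (P.xr i) (P.xs j)

    ss : ∀ {i j} → i ≢ j → P.s j ∈ adj (P.s i)
    ss {i} {j} p = across p (P.s∈A i) (P.s∈A j) (P.xs i) (P.xs j)

  -- Two whole pairs go on opposite sides, and each side is completed by one vertex of a further
  -- pair.
  not-4-trees : ¬ 4 ≤ κ
  not-4-trees 4≤κ =
    free (triple (r 0F) (s 0F) (r 2F)) (triple (r 1F) (s 1F) (r 3F))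
      (triple-injective (r≢s 0F) (adj⇒≢ (rr′ 0F 2F λ ())) (adj⇒≢ (adj-flip (rs′ 2F 0F λ ()))))
      (triple-injective (r≢s 1F) (adj⇒≢ (rr′ 1F 3F λ ())) (adj⇒≢ (adj-flip (rs′ 3F 1F λ ()))))
      λ { 0F 0F → rr′ 0F 1F λ () ; 0F 1F → rs′ 0F 1F λ () ; 0F 2F → rr′ 0F 3F λ ()
        ; 1F 0F → adj-flip (rs′ 1F 0F λ ()) ; 1F 1F → ss 4≤κ {0F} {1F} λ () ; 1F 2F → adj-flip (rs′ 3F 0F λ ())
        ; 2F 0F → rr′ 2F 1F λ () ; 2F 1F → rs′ 2F 1F λ () ; 2F 2F → rr′ 2F 3F λ () }
    where
    open P 4≤κ
    rr′ : ∀ i j → i ≢ j → r j ∈ adj (r i)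
    rr′ i j = rr 4≤κ {i} {j}
    rs′ : ∀ i j → i ≢ j → s j ∈ adj (r i)
    rs′ i j = rs 4≤κ {i} {j}

  ΣA-dA≥ : 2 * # A ≤ Σ A dA
  ΣA-dA≥ = Σ-⊑ A (dA ∷ []) (con 2) v0 (λ _ → 2≤dA ∘ A⇒O)

  -- A vertex of the first pair is adjacent to both vertices of the other two pairs: four neighbours
  -- in `A` instead of the guaranteed two.
  3-trees : 3 ≤ κ → 2 * # A + 2 ≤ Σ A dA
  3-trees 3≤κ = (deduce (# A ∷ # (A ∩ isnt (r 0F)) ∷ Σ A dA ∷ Σ (A ∩ isnt (r 0F)) dA ∷ dA (r 0F) ∷ []) ((0 ∣ 1 ∙ v2 ≋
      v4 ⊕ v3) ∷ (2 ∣ 0 ∙ v0 ≋ con 1 ⊕ v1) ∷ (1 ∙ 2 ⊙ v1 ⊑ v3) ∷ (1 ∙ con 4 ⊑ v4) ∷ []) 1 (2 ⊙ v0 ⊕ con 2) (v2)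
      (Σ-remove A dA {r 0F} (r∈A 0F)) (#-split A {r 0F} (r∈A 0F)) (Σ-⊑ (A ∩ isnt (r 0F)) (dA ∷ []) (con 2) v0 (λ _ →
      2≤dA ∘ A⇒O ∘ ∩ˡ A (isnt (r 0F)))) 4≤dA)
    where
    open P 3≤κ
    rr′ : ∀ i j → i ≢ j → r j ∈ adj (r i)
    rr′ i j = rr 3≤κ {i} {j}
    rs′ : ∀ i j → i ≢ j → s j ∈ adj (r i)
    rs′ i j = rs 3≤κ {i} {j}
    4≤dA : 4 ≤ dA (r 0F)
    4≤dA = length≤# (A ∩ adj (r 0F))
      ((r≢s 1F ∷ adj⇒≢ (rr′ 1F 2F λ ()) ∷ adj⇒≢ (rs′ 1F 2F λ ()) ∷ []) ∷ (adj⇒≢ (adj-flip (rs′ 2F 1F λ ())) ∷ adj⇒≢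
          (ss 3≤κ {1F} {2F} λ ()) ∷ []) ∷ (r≢s 2F ∷ []) ∷ [] ∷ [])
      ( ∩⁺ A (adj (r 0F)) (r∈A 1F) (rr′ 0F 1F λ ()) ∷ ∩⁺ A (adj (r 0F)) (s∈A 1F) (rs′ 0F 1F λ ())
      ∷ ∩⁺ A (adj (r 0F)) (r∈A 2F) (rr′ 0F 2F λ ()) ∷ ∩⁺ A (adj (r 0F)) (s∈A 2F) (rs′ 0F 2F λ ()) ∷ [])

  -- The 4 is the allowance for two trees; a third one is paid for by `3-trees`.
  few-trees : 2 * # A + 2 * κ ≤ Σ A dA + 4
  few-trees with 3 ≤? κ
  ... | yes p = (deduce (# A ∷ Σ A dA ∷ κ ∷ []) ((2 ∙ v2 ⊑ con 3) ∷ (1 ∙ 2 ⊙ v0 ⊕ con 2 ⊑ v1) ∷ []) 1 (2 ⊙ v0 ⊕ 2 ⊙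
      v2) (v1 ⊕ con 4) (≤-pred (≰⇒> not-4-trees)) (3-trees p))
  ... | no p = (deduce (# A ∷ Σ A dA ∷ κ ∷ []) ((2 ∙ v2 ⊑ con 2) ∷ (1 ∙ 2 ⊙ v0 ⊑ v1) ∷ []) 1 (2 ⊙ v0 ⊕ 2 ⊙ v2) (v1 ⊕
      con 4) (≤-pred (≰⇒> p)) ΣA-dA≥)

  degree-sum : 4 + Σ N dN + 2 * Σ O dN + Σ A dA + 2 * Σ B dA + Σ B dB ≤ sum d
  degree-sum = (deduce (sum d ∷ Σ N d ∷ Σ O d ∷ Σ N dN ∷ Σ N dO ∷ Σ O dN ∷ Σ O dO ∷ Σ A dO ∷ Σ B dO ∷ Σ A dA ∷ Σ A dB
      ∷ Σ B dA ∷ Σ B dB ∷ []) ((0 ∣ 1 ∙ v0 ≋ con 2 ⊕ (v1 ⊕ v2)) ∷ (0 ∣ 1 ∙ v1 ≋ con 2 ⊕ (v3 ⊕ v4)) ∷ (0 ∣ 1 ∙ v2 ≋ v5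
      ⊕ v6) ∷ (0 ∣ 1 ∙ v4 ≋ v5) ∷ (0 ∣ 1 ∙ v6 ≋ v7 ⊕ v8) ∷ (0 ∣ 1 ∙ v7 ≋ v9 ⊕ v10) ∷ (0 ∣ 1 ∙ v8 ≋ v11 ⊕ v12) ∷ (0 ∣ 1
      ∙ v10 ≋ v11) ∷ []) 1 (con 4 ⊕ v3 ⊕ 2 ⊙ v5 ⊕ v9 ⊕ 2 ⊙ v11 ⊕ v12) (v0) (trans (total d) (cong (_+ (Σ N d + Σ O d))
      dv)) (trans (Σ-≋ N (d ∷ dN ∷ dO ∷ []) v0 (con 1 ⊕ (v1 ⊕ v2)) (λ _ → d-N)) (cong (λ s → 1 * s + (Σ N dN + Σ N
      dO)) dv)) (Σ-≋ O (d ∷ dN ∷ dO ∷ []) v0 (v1 ⊕ v2) (λ _ → d-O)) (double-count N O) (Σ-split O (≥? 2 dN) dO) (Σ-≋ A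
      (dO ∷ dA ∷ dB ∷ []) v0 (v1 ⊕ v2) (λ x _ → deg-in-∩ O (≥? 2 dN) x)) (Σ-≋ B (dO ∷ dA ∷ dB ∷ []) v0 (v1 ⊕ v2) (λ x
      _ → deg-in-∩ O (≥? 2 dN) x)) (double-count A B))

  ΣO-dN≥ : 2 * # A + Σ B dN ≤ Σ O dN
  ΣO-dN≥ = (deduce (Σ O dN ∷ Σ A dN ∷ Σ B dN ∷ # A ∷ []) ((0 ∣ 1 ∙ v0 ≋ v1 ⊕ v2) ∷ (1 ∙ 2 ⊙ v3 ⊑ v1) ∷ []) 1 (2 ⊙ v3 ⊕
      v2) (v0) (Σ-split O (≥? 2 dN) dN) (Σ-⊑ A (dN ∷ []) (con 2) v0 (λ _ → A⇒2≤dN)))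

  size : n ≡ 3 + (# A + # B)
  size = trans order (cong₂ (λ s t → 1 + (s + t)) dv (#-∩∁ O (≥? 2 dN)))

  -- The 4 from the edges at v cancels the 4 of `few-trees`, and κ cancels against `count`. What is
  -- left is six per vertex of `A` and `B`, and only the three vertices of N[v] are missing.
  bound : 6 * n ≤ sum d + 18
  bound = (deduce (n ∷ # A ∷ # B ∷ sum d ∷ Σ N dN ∷ Σ O dN ∷ Σ A dA ∷ Σ B dA ∷ Σ B dB ∷ Σ B dN ∷ κ ∷ Σ B wt ∷ Σ B (λ x
      → 2 * wt x + dB x) ∷ []) ((6 ∣ 0 ∙ v0 ≋ con 3 ⊕ (v1 ⊕ v2)) ∷ (1 ∙ con 4 ⊕ v4 ⊕ 2 ⊙ v5 ⊕ v6 ⊕ 2 ⊙ v7 ⊕ v8 ⊑ v3) ∷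
      (2 ∙ 2 ⊙ v1 ⊕ v9 ⊑ v5) ∷ (1 ∙ 2 ⊙ v1 ⊕ 2 ⊙ v10 ⊑ v6 ⊕ con 4) ∷ (1 ∙ 2 ⊙ v2 ⊑ v12 ⊕ 2 ⊙ v10) ∷ (1 ∣ 0 ∙ v12 ≋ 2 ⊙
      v11 ⊕ v8) ∷ (2 ∣ 0 ∙ v11 ⊕ 2 ⊙ v2 ≋ v9 ⊕ v7) ∷ []) 1 (6 ⊙ v0) (v3 ⊕ con 18) size degree-sum ΣO-dN≥ few-trees
      count (Σ-≋ B ((λ x → 2 * wt x + dB x) ∷ wt ∷ dB ∷ []) v0 (2 ⊙ v1 ⊕ v2) (λ _ _ → refl)) (Σ-≋ B (wt ∷ dN ∷ dA ∷
      []) (v0 ⊕ con 2) (v1 ⊕ v2) (λ _ → wt+2 ∘ O₁⇒O)))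

-- Minimum degree two, construction

allF anyF : ∀ {n} → Sub n → Bool
allF {zero}  S = true
allF {suc n} S = if S zero then allF (S ∘ suc) else false
anyF {zero}  S = false
anyF {suc n} S = if S zero then true else anyF (S ∘ suc)

allF-sound : ∀ {n} {S : Sub n} → allF S ≡ true → ∀ x → x ∈ S
allF-sound {suc n} {S} p x with S zero in q
allF-sound {suc n} {S} p zero    | true = q
allF-sound {suc n} {S} p (suc x) | true = allF-sound {S = S ∘ suc} p x

anyF-sound : ∀ {n} {S : Sub n} → anyF S ≡ true → ∃[ x ] x ∈ S
anyF-sound {suc n} {S} p with S zero in q
... | true  = zero , q
... | false = let x , r = anyF-sound {S = S ∘ suc} p in suc x , r

anyF-complete : ∀ {n} {S : Sub n} x → x ∈ S → anyF S ≡ true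
anyF-complete {suc n} {S} zero    p rewrite p = refl
anyF-complete {suc n} {S} (suc x) p with S zero
... | true  = refl
... | false = anyF-complete {S = S ∘ suc} x p

T⇒ : ∀ {b} → T b → b ≡ true
T⇒ {true} _ = refl

∧-intro : ∀ {a b} → a ≡ true → b ≡ true → a ∧ b ≡ true
∧-intro refl refl = refl

_or_ : Bool → Bool → Bool
true  or b = true
false or b = b

or-sound : ∀ {a b} → a or b ≡ true → a ≡ true ⊎ b ≡ true
or-sound {true}  p = inj₁ refl
or-sound {false} p = inj₂ p

∧-sound : ∀ {a b} → a ∧ b ≡ true → a ≡ true × b ≡ true
∧-sound {true} p = refl , p

-- The list at index i contains the neighbours of i that are larger than i.
module Construct {n : ℕ} (larger : Vec (List ℕ) n) where
  private
    e : Fin n → Fin n → Bool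
    e x y = any (Fin.toℕ y ≡ᵇ_) (Vec.lookup larger x)

  fromLists : Graph n
  fromLists = record
    { _~_ = λ x y → T (isnt x y ∧ (e x y or e y x)) ; _~?_ = λ x y → T? (isnt x y ∧ (e x y or e y x))
    ; ~-sym = λ {x} {y} p → subst T (cong₂ _∧_ (lem x y) (or-comm (e x y) (e y x))) p
    ; ~-irrefl = λ { {x} refl p → subst (λ b → T (not b ∧ (e x x or e x x))) (is-refl x) p } }
    where
    or-comm : ∀ a b → a or b ≡ b or a
    or-comm true  true  = refl
    or-comm true  false = refl
    or-comm false true  = refl
    or-comm false false = refl
    lem : ∀ x y → isnt x y ≡ isnt y x
    lem x y with x Fin.≟ y
    ... | yes refl = cong not (sym (is-refl x))
    ... | no p     = sym (≢⇒isnt (p ∘ sym))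

3≤# : ∀ {n} (S : Sub n) (b : Fin 3 → Fin n) → (∀ {i j} → b i ≡ b j → i ≡ j) → (∀ j → b j ∈ S) → 3 ≤ # S
3≤# S b inj h = length≤# S {b 0F ∷ b 1F ∷ b 2F ∷ []} (((≢-b λ ()) ∷ (≢-b λ ()) ∷ []) ∷ ((≢-b λ ()) ∷ []) ∷ [] ∷ []) (h
    0F ∷ h 1F ∷ h 2F ∷ [])
  where
  ≢-b : ∀ {i j} → i ≢ j → b i ≢ b j
  ≢-b p q = p (inj q)

module Check {n : ℕ} (G : Graph n) where
  open Adjacency G

  -- A pair with at most two common neighbours is settled before any third vertex is tried, which
  -- keeps the evaluation short.
  free₁ free₂ : Fin n → Sub n
  free₃ : Fin n → Fin n → Sub n
  free₁ x y   = is x y or free₂ x y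
  free₂ x y   = (# (adj x ∩ adj y) ≤ᵇ 2) or allF (free₃ x y)
  free₃ x y z = is x z or (is y z or (# (adj x ∩ adj y ∩ adj z) ≤ᵇ 2))

  linkQ : (u w R S P : Fin n) → Sub n
  linkQ u w R S P Q = adj w Q ∧ (isnt u Q ∧ (isnt P Q ∧ (adj Q R ∧ adj Q S)))

  linkP : (u w R S : Fin n) → Sub n
  linkP u w R S P = adj w P ∧ (isnt u P ∧ (adj P R ∧ (adj P S ∧ anyF (linkQ u w R S P))))

  linkS : (u w R : Fin n) → Sub n
  linkS u w R S = adj u S ∧ (isnt w S ∧ (isnt R S ∧ anyF (linkP u w R S)))

  linkR : (u w : Fin n) → Sub n
  linkR u w R = adj u R ∧ (isnt w R ∧ anyF (linkS u w R))

  link₁ : Fin n → Sub n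
  link₁ u w = is u w or (adj u w or anyF (linkR u w))

  free? linked? : Bool
  free?   = allF λ x → allF (free₁ x)
  linked? = allF λ u → allF (link₁ u)

  free-sound : free? ≡ true → K₃₃-free
  free-sound p a b a-inj b-inj h = [ (λ q → distinct (λ ()) q) , second ]′ (or-sound {is x y} {free₂ x y} first)
    where
    x = a 0F
    y = a 1F
    z = a 2F
    first : free₁ x y ≡ true
    first = allF-sound {S = free₁ x} (allF-sound {S = λ x → allF (free₁ x)} p x) y
    distinct : ∀ {i j} → i ≢ j → is (a i) (a j) ≡ true → ⊥
    distinct {i} {j} i≢j q = i≢j (a-inj (is⇒≡ {x = a i} {a j} q))
    three-of : ∀ S → (∀ j → b j ∈ S) → (# S ≤ᵇ 2) ≡ true → ⊥
    three-of S h p = contradiction (3≤# S b b-inj h) (<⇒≱ (s≤s (≤ᵇ⇒≤ (# S) 2 (subst T (sym p) tt))))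
    xy : ∀ j → b j ∈ adj x ∩ adj y
    xy j = ∩⁺ (adj x) (adj y) {b j} (h 0F j) (h 1F j)
    xyz : ∀ j → b j ∈ adj x ∩ adj y ∩ adj z
    xyz j = ∩⁺ (adj x ∩ adj y) (adj z) {b j} (xy j) (h 2F j)
    third : free₃ x y z ≡ true → ⊥
    third q = [ distinct (λ ()) , (λ r → [ distinct (λ ()) , three-of (adj x ∩ adj y ∩ adj z) xyz ]′ (or-sound {is y
        z} r)) ]′ (or-sound {is x z} q)
    second : free₂ x y ≡ true → ⊥
    second q = [ three-of (adj x ∩ adj y) xy , (λ r → third (allF-sound {S = free₃ x y} r z)) ]′ (or-sound {# (adj x ∩
        adj y) ≤ᵇ 2} q)

  linked-sound : linked? ≡ true → Linked
  linked-sound p {u} {w} u≢w uw =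
    [ (λ q → contradiction (is⇒≡ {x = u} {w} q) u≢w) , (λ q → [ (λ r → contradiction (trans (sym uw) r) λ ()) , found
        ]′ (or-sound {adj u w} q)) ]′
      (or-sound {is u w} (allF-sound {S = link₁ u} (allF-sound {S = λ u → allF (link₁ u)} p u) w))
    where
    found : anyF (linkR u w) ≡ true → Link u w
    found r =
      let R , p₁ = anyF-sound {S = linkR u w} r
          uR , p₂ = ∧-sound {adj u R} p₁
          wR , p₃ = ∧-sound {isnt w R} p₂
          S , p₄ = anyF-sound {S = linkS u w R} p₃
          uS , p₅ = ∧-sound {adj u S} p₄
          wS , p₆ = ∧-sound {isnt w S} p₅
          RS , p₇ = ∧-sound {isnt R S} p₆
          P , p₈ = anyF-sound {S = linkP u w R S} p₇
          wP , p₉ = ∧-sound {adj w P} p₈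
          uP , q₁ = ∧-sound {isnt u P} p₉
          PR , q₂ = ∧-sound {adj P R} q₁
          PS , q₃ = ∧-sound {adj P S} q₂
          Q , q₄ = anyF-sound {S = linkQ u w R S P} q₃
          wQ , q₅ = ∧-sound {adj w Q} q₄
          uQ , q₆ = ∧-sound {isnt u Q} q₅
          PQ , q₇ = ∧-sound {isnt P Q} q₆
          QR , QS = ∧-sound {adj Q R} q₇
      in record { P = P ; Q = Q ; R = R ; S = S ; uR = uR ; uS = uS ; wP = wP ; wQ = wQ ; PR = PR ; PS = PS ; QR = QR
          ; QS = QS
                ; P≢Q = isnt⇒≢ {x = P} {Q} PQ ; R≢S = isnt⇒≢ {x = R} {S} RS ; P≢u = isnt⇒≢ {x = u} {P} uP ∘ sym ; Q≢u
                    = isnt⇒≢ {x = u} {Q} uQ ∘ sym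
                ; R≢w = isnt⇒≢ {x = w} {R} wR ∘ sym ; S≢w = isnt⇒≢ {x = w} {S} wS ∘ sym }

-- An invariant for attaching triangles: `attached` is what links a new vertex to each old vertex
-- other than the hubs, and `size` encodes 3n - 9 edges.
record Seed (n : ℕ) : Set₁ where
  field
    G      : Graph n
  open Adjacency G public
  field
    free   : K₃₃-free
    linked : Linked
    hub₁ hub₂ v : Fin n
    hub₁≢hub₂ : hub₁ ≢ hub₂
    hubs-apart : adj hub₁ hub₂ ≡ false
    v≢hub₁ : v ≢ hub₁
    v≢hub₂ : v ≢ hub₂
    dv     : d v ≡ 2
    2≤d    : ∀ x → 2 ≤ d x
    attached : ∀ x → x ≢ hub₁ → x ≢ hub₂ → (hub₁ ∈ adj x × hub₂ ∈ adj x) ⊎ 2 ≤ # (adj hub₁ ∩ adj hub₂ ∩ adj x)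
    size   : sum d + 18 ≡ 6 * n

seed : ∀ {n} (larger : Vec (List ℕ) n) → let G = Construct.fromLists larger ; open Adjacency G ; open Check G in
       (h₁ h₂ v : Fin n) → isnt h₁ h₂ ∧ (not (adj h₁ h₂) ∧ (isnt v h₁ ∧ (isnt v h₂ ∧ (d v ≡ᵇ 2)))) ≡ true →
       free? ≡ true → linked? ≡ true →
       allF (λ x → (2 ≤ᵇ d x) ∧ (is x h₁ or (is x h₂ or ((adj x h₁ ∧ adj x h₂) or (2 ≤ᵇ # (adj h₁ ∩ adj h₂ ∩ adj
           x)))))) ≡ true →
       sum d + 18 ≡ 6 * n → Seed n
seed larger h₁ h₂ v p f l q s = 
  let p₁ , p₂ = ∧-sound {isnt h₁ h₂} p
      p₃ , p₄ = ∧-sound {not (adj h₁ h₂)} p₂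
      p₅ , p₆ = ∧-sound {isnt v h₁} p₄
      p₇ , p₈ = ∧-sound {isnt v h₂} p₆
  in record
    { G = Construct.fromLists larger ; free = Check.free-sound (Construct.fromLists larger) f ; linked =
        Check.linked-sound (Construct.fromLists larger) l
    ; hub₁ = h₁ ; hub₂ = h₂ ; v = v ; hub₁≢hub₂ = isnt⇒≢ p₁ ; hubs-apart = not-injective p₃
    ; v≢hub₁ = isnt⇒≢ p₅ ; v≢hub₂ = isnt⇒≢ p₇ ; dv = ≡ᵇ⇒≡ (d v) 2 (subst T (sym p₈) tt)
    ; 2≤d = λ x → ≤ᵇ⇒≤ 2 (d x) (subst T (sym (proj₁ (∧-sound {2 ≤ᵇ d x} (allF-sound {S = good} q x)))) tt)
    ; attached = λ x x≢h₁ x≢h₂ → lem x x≢h₁ x≢h₂ (proj₂ (∧-sound {2 ≤ᵇ d x} (allF-sound {S = good} q x)))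
    ; size = s }
  where
  open Adjacency (Construct.fromLists larger)
  good : Fin _ → Bool
  good x = (2 ≤ᵇ d x) ∧ (is x h₁ or (is x h₂ or ((adj x h₁ ∧ adj x h₂) or (2 ≤ᵇ # (adj h₁ ∩ adj h₂ ∩ adj x)))))
  not-injective : ∀ {b} → not b ≡ true → b ≡ false
  not-injective {false} _ = refl
  lem : ∀ x → x ≢ h₁ → x ≢ h₂ → (is x h₁ or (is x h₂ or ((adj x h₁ ∧ adj x h₂) or (2 ≤ᵇ # (adj h₁ ∩ adj h₂ ∩ adj
      x))))) ≡ true →
        (h₁ ∈ adj x × h₂ ∈ adj x) ⊎ 2 ≤ # (adj h₁ ∩ adj h₂ ∩ adj x)
  lem x x≢h₁ x≢h₂ p with or-sound {is x h₁} p
  ... | inj₁ q = contradiction (is⇒≡ {x = x} q) x≢h₁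
  ... | inj₂ q with or-sound {is x h₂} q
  ...   | inj₁ r = contradiction (is⇒≡ {x = x} r) x≢h₂
  ...   | inj₂ r with or-sound {adj x h₁ ∧ adj x h₂} r
  ...     | inj₁ s = inj₁ (∧-sound {adj x h₁} s)
  ...     | inj₂ s = inj₂ (≤ᵇ⇒≤ 2 (# (adj h₁ ∩ adj h₂ ∩ adj x)) (subst T (sym s) tt))

-- A triangle joined to two nonadjacent hubs.
module Extension {n : ℕ} (F : Seed n) where
  open Seed F

  hub : Sub n
  hub x = is hub₁ x or is hub₂ x

  adj⁺ : Fin (3 + n) → Fin (3 + n) → Bool
  adj⁺ x y with Fin.splitAt 3 x | Fin.splitAt 3 y
  ... | inj₁ i | inj₁ j = isnt i j
  ... | inj₁ i | inj₂ y = hub y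
  ... | inj₂ x | inj₁ j = hub x
  ... | inj₂ x | inj₂ y = adj x y

  G⁺ : Graph (3 + n)
  G⁺ = record
    { _~_ = λ x y → T (adj⁺ x y) ; _~?_ = λ x y → T? (adj⁺ x y)
    ; ~-sym = λ {x} {y} → subst T (symm x y) ; ~-irrefl = λ { {x} refl → irr x } }
    where
    isnt-sym : ∀ {k} (x y : Fin k) → isnt x y ≡ isnt y x
    isnt-sym x y with x Fin.≟ y
    ... | yes refl = cong not (sym (is-refl x))
    ... | no p     = sym (≢⇒isnt (p ∘ sym))
    symm : ∀ x y → adj⁺ x y ≡ adj⁺ y x
    symm x y with Fin.splitAt 3 x | Fin.splitAt 3 y
    ... | inj₁ i | inj₁ j = isnt-sym i j
    ... | inj₁ i | inj₂ y = refl
    ... | inj₂ x | inj₁ j = refl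
    ... | inj₂ x | inj₂ y = adj-sym x y
    irr : ∀ x → ¬ T (adj⁺ x x)
    irr x p with Fin.splitAt 3 x
    ... | inj₁ i = subst T (cong not (is-refl i)) p
    ... | inj₂ y = subst T (adj-irrefl y) p

  private module A⁺ = Adjacency G⁺

  pattern old x = suc (suc (suc x))

  is-new : Sub (3 + n)
  is-new x = [ (λ _ → true) , (λ _ → false) ]′ (Fin.splitAt 3 x)

  #new : # is-new ≤ 3
  #new = s≤s (s≤s (s≤s (≤-reflexive (sum-0 {n} λ _ → refl))))

  hub⇒ : ∀ {x} → x ∈ hub → x ≡ hub₁ ⊎ x ≡ hub₂
  hub⇒ {x} p with or-sound {is hub₁ x} p
  ... | inj₁ q = inj₁ (sym (is⇒≡ {x = hub₁} q))
  ... | inj₂ q = inj₂ (sym (is⇒≡ {x = hub₂} q))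

  hub₁∈ : hub₁ ∈ hub
  hub₁∈ rewrite is-refl hub₁ = refl

  hub₂∈ : hub₂ ∈ hub
  hub₂∈ with is hub₁ hub₂
  ... | true  = refl
  ... | false = is-refl hub₂

  #hub : # hub ≡ 2
  #hub = ≤-antisym (≤-trans (≤-reflexive (#-split hub {hub₁} hub₁∈)) (s≤s (≤-trans (#-mono {S = hub ∩ isnt hub₁} {T =
      is hub₂} only₂) (≤-reflexive #is))))
                   (length≤# hub ((hub₁≢hub₂ ∷ []) ∷ [] ∷ []) (hub₁∈ ∷ hub₂∈ ∷ []))
    where
    only₂ : ∀ {x} → x ∈ hub ∩ isnt hub₁ → x ∈ is hub₂
    only₂ {x} p with hub⇒ {x} (∩ˡ hub (isnt hub₁) {x} p)
    ... | inj₁ refl = ⊥-elim (isnt⇒≢ {x = hub₁} (∩ʳ hub (isnt hub₁) {hub₁} p) refl)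
    ... | inj₂ refl = is-refl hub₂
    #is : # is hub₂ ≡ 1
    #is = trans (#-split (is hub₂) {hub₂} (is-refl hub₂)) (cong suc (#≡0 (is hub₂ ∩ isnt hub₂) λ x p → isnt⇒≢ {x =
        hub₂} (∩ʳ (is hub₂) (isnt hub₂) {x} p) (is⇒≡ {x = hub₂} (∩ˡ (is hub₂) (isnt hub₂) {x} p))))

  hub-independent : ∀ {x y} → x ∈ hub → y ∈ hub → ¬ y ∈ adj x
  hub-independent {x} {y} p q r with hub⇒ {x} p | hub⇒ {y} q
  ... | inj₁ refl | inj₁ refl = adj⇒≢ r refl
  ... | inj₁ refl | inj₂ refl = contradiction (trans (sym hubs-apart) r) λ ()
  ... | inj₂ refl | inj₁ refl = contradiction (trans (sym hubs-apart) (adj-flip r)) λ ()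
  ... | inj₂ refl | inj₂ refl = adj⇒≢ r refl

  data Kind : Fin (3 + n) → Set where
    new′ : ∀ {x} → x ∈ is-new → Kind x
    old′ : ∀ y → Kind (old y)

  kind : ∀ x → Kind x
  kind 0F      = new′ refl
  kind 1F      = new′ refl
  kind 2F      = new′ refl
  kind (old x) = old′ x

  new-old : ∀ {t y} → t ∈ is-new → old y ∈ A⁺.adj t → y ∈ hub
  new-old {0F} _ p = p
  new-old {1F} _ p = p
  new-old {2F} _ p = p

  -- A new vertex of K₃,₃ has a new vertex t and a hub y among its neighbours,
  -- but t and y have only two common neighbours.
  kill : (a b : Fin 3 → Fin (3 + n)) → (∀ {i j} → a i ≡ a j → i ≡ j) → (∀ {i j} → b i ≡ b j → i ≡ j) →
         (∀ i j → b j ∈ A⁺.adj (a i)) → ∀ i → a i ∈ is-new → ⊥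
  kill a b a-inj b-inj h i t-new with Fin.any? (λ j → ∈? is-new (b j)) | Fin.any? (λ j → ∈? (∁ is-new) (b j))
  ... | no none | _ = contradiction (≤-trans (3≤# hub (λ j → proj₁ (hubs j)) y-inj (λ j → proj₂ (proj₂ (hubs j))))
      (≤-reflexive #hub)) λ { (s≤s (s≤s ())) }
    where
    hubs : ∀ j → ∃[ y ] b j ≡ old y × y ∈ hub
    hubs j = go (b j) (kind (b j)) refl (h i j)
      where
      go : ∀ x → Kind x → b j ≡ x → x ∈ A⁺.adj (a i) → ∃[ y ] b j ≡ old y × y ∈ hub
      go x (new′ q) e _ = ⊥-elim (none (j , subst (_∈ is-new) (sym e) q))
      go _ (old′ y) e p = y , e , new-old {a i} t-new p
    y-inj : ∀ {j k} → proj₁ (hubs j) ≡ proj₁ (hubs k) → j ≡ k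
    y-inj {j} {k} e = b-inj (trans (proj₁ (proj₂ (hubs j))) (trans (cong (λ y → old y) e) (sym (proj₁ (proj₂ (hubs
        k))))))
  ... | _ | no none = contradiction (≤-trans (s≤s (3≤# (is-new ∩ isnt (a i)) b b-inj λ j → ∩⁺ is-new (isnt (a i)) {b
      j} (news j) (≢⇒isnt (A⁺.adj⇒≢ {a i} {b j} (h i j)))))
                        (≤-trans (≤-reflexive (sym (#-split is-new {a i} t-new))) #new)) λ { (s≤s (s≤s (s≤s ()))) }
    where
    news : ∀ j → b j ∈ is-new
    news j with ∈? is-new (b j)
    ... | yes p = p
    ... | no p  = ⊥-elim (none (j , ∁⁺ is-new {b j} p))
  ... | yes (j , s-new) | yes (k , y-old) = contradiction (≤-trans (s≤s (3≤# (is-new ∩ isnt (b j)) a a-inj λ i′ → ∩⁺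
      is-new (isnt (b j)) {a i′} (news i′) (≢⇒isnt {x = b j} {a i′} (A⁺.adj⇒≢ {a i′} {b j} (h i′ j) ∘ sym))))
                        (≤-trans (≤-reflexive (sym (#-split is-new {b j} s-new))) #new)) λ { (s≤s (s≤s (s≤s ()))) }
    where
    go : ∀ x y → Kind x → Kind y → y ∈ ∁ is-new → y ∈ A⁺.adj (a i) → x ∈ A⁺.adj (b j) → y ∈ A⁺.adj x → x ∈ is-new
    go x y (new′ p) _ _ _ _ _ = p
    go x y (old′ _) (new′ p) q _ _ _ = ⊥-elim (∁⁻ is-new {y} q p)
    go _ _ (old′ x) (old′ y) _ p q r = ⊥-elim (hub-independent (new-old {b j} s-new q) (new-old {a i} t-new p) r)
    news : ∀ i′ → a i′ ∈ is-new
    news i′ = go (a i′) (b k) (kind (a i′)) (kind (b k)) y-old (h i k) (A⁺.adj-flip {a i′} {b j} (h i′ j)) (h i′ k)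

  free⁺ : A⁺.K₃₃-free
  free⁺ a b a-inj b-inj h with Fin.any? (λ i → ∈? is-new (a i)) | Fin.any? (λ j → ∈? is-new (b j))
  ... | yes (i , p) | _ = kill a b a-inj b-inj h i p
  ... | _ | yes (j , p) = kill b a b-inj a-inj (λ i j → A⁺.adj-flip {a j} {b i} (h j i)) j p
  ... | no p | no q = free (λ i → proj₁ (olds a p i)) (λ j → proj₁ (olds b q j)) (inj a p a-inj) (inj b q b-inj)
                        λ i j → subst₂ (λ x y → y ∈ A⁺.adj x) (proj₂ (olds a p i)) (proj₂ (olds b q j)) (h i j)
    where
    olds : (f : Fin 3 → Fin (3 + n)) → ¬ (∃[ i ] f i ∈ is-new) → ∀ i → ∃[ y ] f i ≡ old y
    olds f none i with f i in e | kind (f i)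
    ... | 0F    | _ = ⊥-elim (none (i , subst (_∈ is-new) (sym e) refl))
    ... | 1F    | _ = ⊥-elim (none (i , subst (_∈ is-new) (sym e) refl))
    ... | 2F    | _ = ⊥-elim (none (i , subst (_∈ is-new) (sym e) refl))
    ... | old y | _ = y , refl
    inj : (f : Fin 3 → Fin (3 + n)) (none : ¬ (∃[ i ] f i ∈ is-new)) → (∀ {i j} → f i ≡ f j → i ≡ j) →
          ∀ {i j} → proj₁ (olds f none i) ≡ proj₁ (olds f none j) → i ≡ j
    inj f none f-inj {i} {j} e = f-inj (trans (proj₂ (olds f none i)) (trans (cong (λ y → old y) e) (sym (proj₂ (olds
        f none j)))))

  lift : ∀ {u w} → Link u w → A⁺.Link (old u) (old w)
  lift l = record
    { P = old P ; Q = old Q ; R = old R ; S = old S ; uR = uR ; uS = uS ; wP = wP ; wQ = wQ ; PR = PR ; PS = PS ; QR =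
        QR ; QS = QS
    ; P≢Q = P≢Q ∘ inj ; R≢S = R≢S ∘ inj ; P≢u = P≢u ∘ inj ; Q≢u = Q≢u ∘ inj ; R≢w = R≢w ∘ inj ; S≢w = S≢w ∘ inj }
    where
    open Link l
    inj : ∀ {x y} → _≡_ {A = Fin (3 + n)} (old x) (old y) → x ≡ y
    inj refl = refl

  -- If x sees both hubs, they are `P`, `Q` and the rest of the triangle is `R`, `S`. Otherwise the
  -- hubs are `R`, `S`, and two of their common neighbours adjacent to x are `P`, `Q`.
  link-new : ∀ {t s s′} → t ∈ is-new → s ∈ is-new → s′ ∈ is-new → s ∈ A⁺.adj t → s′ ∈ A⁺.adj t → s ≢ s′ →
             ∀ {x} → adj⁺ t (old x) ≡ false → A⁺.Link t (old x)
  link-new {t} {s} {s′} t-new s-new s′-new ts ts′ s≢s′ {x} tx = [ both , two ]′ (attached x (x≢ hub₁∈) (x≢ hub₂∈))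
    where
    hub-adj : ∀ {t y} → t ∈ is-new → y ∈ hub → old y ∈ A⁺.adj t
    hub-adj {0F} _ p = p
    hub-adj {1F} _ p = p
    hub-adj {2F} _ p = p
    x≢ : ∀ {c} → c ∈ hub → x ≢ c
    x≢ c∈hub refl = contradiction (trans (sym tx) (hub-adj {t} t-new c∈hub)) λ ()
    old≢ : ∀ {x y} → x ≢ y → _≢_ {A = Fin (3 + n)} (old x) (old y)
    old≢ p refl = p refl
    new≢old : ∀ {t y} → t ∈ is-new → t ≢ old y
    new≢old () refl
    both : hub₁ ∈ adj x × hub₂ ∈ adj x → A⁺.Link t (old x)
    both (p , q) = record
      { P = old hub₁ ; Q = old hub₂ ; R = s ; S = s′ ; uR = ts ; uS = ts′ ; wP = p ; wQ = q
      ; PR = A⁺.adj-flip {s} {old hub₁} (hub-adj {s} s-new hub₁∈) ; PS = A⁺.adj-flip {s′} {old hub₁} (hub-adj {s′}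
          s′-new hub₁∈)
      ; QR = A⁺.adj-flip {s} {old hub₂} (hub-adj {s} s-new hub₂∈) ; QS = A⁺.adj-flip {s′} {old hub₂} (hub-adj {s′}
          s′-new hub₂∈)
      ; P≢Q = old≢ hub₁≢hub₂ ; R≢S = s≢s′ ; P≢u = new≢old {t} t-new ∘ sym ; Q≢u = new≢old {t} t-new ∘ sym ; R≢w =
          new≢old {s} s-new ; S≢w = new≢old {s′} s′-new }
    two : 2 ≤ # (adj hub₁ ∩ adj hub₂ ∩ adj x) → A⁺.Link t (old x)
    two 2≤ =
      let p , q , p∈ , q∈ , p≢q = #≥2⇒∃ (adj hub₁ ∩ adj hub₂ ∩ adj x) 2≤
      in record
      { P = old p ; Q = old q ; R = old hub₁ ; S = old hub₂ ; uR = hub-adj {t} t-new hub₁∈ ; uS = hub-adj {t} t-new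
          hub₂∈
      ; wP = ∩ʳ (adj hub₁ ∩ adj hub₂) (adj x) {p} p∈ ; wQ = ∩ʳ (adj hub₁ ∩ adj hub₂) (adj x) {q} q∈
      ; PR = adj-flip {hub₁} {p} (h₁ p∈) ; PS = adj-flip {hub₂} {p} (h₂ p∈) ; QR = adj-flip {hub₁} {q} (h₁ q∈) ; QS =
          adj-flip {hub₂} {q} (h₂ q∈)
      ; P≢Q = old≢ p≢q ; R≢S = old≢ hub₁≢hub₂ ; P≢u = new≢old {t} t-new ∘ sym ; Q≢u = new≢old {t} t-new ∘ sym
      ; R≢w = old≢ (x≢ hub₁∈ ∘ sym) ; S≢w = old≢ (x≢ hub₂∈ ∘ sym) }
      where
      h₁ : ∀ {p} → p ∈ adj hub₁ ∩ adj hub₂ ∩ adj x → p ∈ adj hub₁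
      h₁ {p} r = ∩ˡ (adj hub₁) (adj hub₂) {p} (∩ˡ (adj hub₁ ∩ adj hub₂) (adj x) {p} r)
      h₂ : ∀ {p} → p ∈ adj hub₁ ∩ adj hub₂ ∩ adj x → p ∈ adj hub₂
      h₂ {p} r = ∩ʳ (adj hub₁) (adj hub₂) {p} (∩ˡ (adj hub₁ ∩ adj hub₂) (adj x) {p} r)

  linked⁺ : A⁺.Linked
  linked⁺ {0F} {0F} p _ = ⊥-elim (p refl)
  linked⁺ {1F} {1F} p _ = ⊥-elim (p refl)
  linked⁺ {2F} {2F} p _ = ⊥-elim (p refl)
  linked⁺ {0F} {old x} _ q = link-new {0F} {1F} {2F} refl refl refl refl refl (λ ()) q
  linked⁺ {1F} {old x} _ q = link-new {1F} {0F} {2F} refl refl refl refl refl (λ ()) q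
  linked⁺ {2F} {old x} _ q = link-new {2F} {0F} {1F} refl refl refl refl refl (λ ()) q
  linked⁺ {old x} {0F} _ q = A⁺.Link-sym (link-new {0F} {1F} {2F} refl refl refl refl refl (λ ()) q)
  linked⁺ {old x} {1F} _ q = A⁺.Link-sym (link-new {1F} {0F} {2F} refl refl refl refl refl (λ ()) q)
  linked⁺ {old x} {2F} _ q = A⁺.Link-sym (link-new {2F} {0F} {1F} refl refl refl refl refl (λ ()) q)
  linked⁺ {old x} {old y} p q = lift (linked (λ e → p (cong (λ y → old y) e)) q)

  d-old : ∀ x → A⁺.d (old x) ≡ 3 * ι (hub x) + d x
  d-old x with hub x
  ... | true  = refl
  ... | false = refl

  extend : Seed (3 + n)
  extend = record
    { G = G⁺ ; free = free⁺ ; linked = linked⁺ ; hub₁ = old hub₁ ; hub₂ = old hub₂ ; v = old v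
    ; hub₁≢hub₂ = hub₁≢hub₂ ∘ inj ; hubs-apart = hubs-apart ; v≢hub₁ = v≢hub₁ ∘ inj ; v≢hub₂ = v≢hub₂ ∘ inj
    ; dv = trans (d-old v) (trans (cong (λ b → 3 * ι b + d v) hub-v) dv) ; 2≤d = 2≤d⁺ ; attached = attached⁺ ; size =
        size⁺ }
    where
    inj : ∀ {x y} → _≡_ {A = Fin (3 + n)} (old x) (old y) → x ≡ y
    inj refl = refl
    hub-v : hub v ≡ false
    hub-v = ¬∈⇒false {S = hub} {v} λ p → [ v≢hub₁ , v≢hub₂ ]′ (hub⇒ {v} p)
    2≤d⁺ : ∀ x → 2 ≤ A⁺.d x
    2≤d⁺ 0F = s≤s (s≤s z≤n)
    2≤d⁺ 1F = s≤s (s≤s z≤n)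
    2≤d⁺ 2F = s≤s (s≤s z≤n)
    2≤d⁺ (old x) = ≤-trans (2≤d x) (≤-trans (m≤n+m (d x) (3 * ι (hub x))) (≤-reflexive (sym (d-old x))))
    attached⁺ : ∀ x → x ≢ old hub₁ → x ≢ old hub₂ → (old hub₁ ∈ A⁺.adj x × old hub₂ ∈ A⁺.adj x) ⊎ 2 ≤ # (A⁺.adj (old
        hub₁) ∩ A⁺.adj (old hub₂) ∩ A⁺.adj x)
    attached⁺ 0F _ _ = inj₁ (hub₁∈ , hub₂∈)
    attached⁺ 1F _ _ = inj₁ (hub₁∈ , hub₂∈)
    attached⁺ 2F _ _ = inj₁ (hub₁∈ , hub₂∈)
    attached⁺ (old x) p q = [ inj₁ , inj₂ ∘ grow ]′ (attached x (p ∘ cong (λ y → old y)) (q ∘ cong (λ y → old y)))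
      where
      grow : 2 ≤ # (adj hub₁ ∩ adj hub₂ ∩ adj x) → 2 ≤ # (A⁺.adj (old hub₁) ∩ A⁺.adj (old hub₂) ∩ A⁺.adj (old x))
      grow r = ≤-trans r (≤-trans (m≤n+m _ (c 0F)) (≤-trans (+-monoʳ-≤ (c 0F) (≤-trans (m≤n+m _ (c 1F)) (+-monoʳ-≤ (c
          1F) (m≤n+m _ (c 2F))))) ≤-refl))
        where
        c : Fin (3 + n) → ℕ
        c = ι ∘ (A⁺.adj (old hub₁) ∩ A⁺.adj (old hub₂) ∩ A⁺.adj (old x))
    -- The degree sum grows by 3 · 4 at the triangle and 2 · 3 at the hubs, which is 6 · 3.
    size⁺ : sum A⁺.d + 18 ≡ 6 * (3 + n)
    size⁺ = ≤-antisym (deduce (sum A⁺.d ∷ sum (λ x → A⁺.d (old x)) ∷ # hub ∷ sum (λ x → ι (hub x)) ∷ sum d ∷ n ∷ [])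
        ((1 ∣ 0 ∙ v0 ≋ con 2 ⊕ v3 ⊕ (con 2 ⊕ v3 ⊕ (con 2 ⊕ v3 ⊕ v1))) ∷ (1 ∣ 0 ∙ v1 ≋ 3 ⊙ v3 ⊕ v4) ∷ (6 ∣ 0 ∙ v3 ≋ v2)
        ∷ (6 ∣ 0 ∙ v2 ≋ con 2) ∷ (1 ∣ 0 ∙ v4 ⊕ con 18 ≋ 6 ⊙ v5) ∷ []) 1 (v0 ⊕ con 18) (6 ⊙ (con 3 ⊕ v5)) refl old-sum
        refl #hub size)
                      (deduce (sum A⁺.d ∷ sum (λ x → A⁺.d (old x)) ∷ # hub ∷ sum (λ x → ι (hub x)) ∷ sum d ∷ n ∷ [])
                          ((0 ∣ 1 ∙ v0 ≋ con 2 ⊕ v3 ⊕ (con 2 ⊕ v3 ⊕ (con 2 ⊕ v3 ⊕ v1))) ∷ (0 ∣ 1 ∙ v1 ≋ 3 ⊙ v3 ⊕ v4) ∷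
                          (0 ∣ 6 ∙ v3 ≋ v2) ∷ (0 ∣ 6 ∙ v2 ≋ con 2) ∷ (0 ∣ 1 ∙ v4 ⊕ con 18 ≋ 6 ⊙ v5) ∷ []) 1 (6 ⊙ (con
                          3 ⊕ v5)) (v0 ⊕ con 18) refl old-sum refl #hub size)
      where
      old-sum : sum (λ x → A⁺.d (old x)) ≡ 3 * sum (λ x → ι (hub x)) + sum d
      old-sum = trans (sum-cong d-old) (trans (sum-+ (λ x → 3 * ι (hub x)) d) (cong (_+ sum d) (sum-* 3 (λ x → ι (hub
          x)))))

-- The octahedron with antipodal pairs {0, 1}, {3, 4}, {5, 6}, and a vertex of degree two attached
-- to each pair.
seed₉ : Seed 9
seed₉ = seed ((2 ∷ 3 ∷ 4 ∷ 5 ∷ 6 ∷ []) ∷ (2 ∷ 3 ∷ 4 ∷ 5 ∷ 6 ∷ []) ∷ [] ∷ (5 ∷ 6 ∷ 7 ∷ []) ∷ (5 ∷ 6 ∷ 7 ∷ []) ∷ (8 ∷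
    []) ∷ (8 ∷ []) ∷ [] ∷ [] ∷ []) 0F 1F 7F refl refl refl refl refl

-- `seed₉` with a vertex joined to the octahedral face {0, 3, 5}.
seed₁₀ : Seed 10
seed₁₀ = seed ((2 ∷ 3 ∷ 4 ∷ 5 ∷ 6 ∷ 9 ∷ []) ∷ (2 ∷ 3 ∷ 4 ∷ 5 ∷ 6 ∷ []) ∷ [] ∷ (5 ∷ 6 ∷ 7 ∷ 9 ∷ []) ∷ (5 ∷ 6 ∷ 7 ∷ [])
    ∷ (8 ∷ 9 ∷ []) ∷ (8 ∷ []) ∷ [] ∷ [] ∷ [] ∷ []) 0F 1F 7F refl refl refl refl refl

-- `seed₁₀`, its face vertex now numbered 10, with a further vertex 9 joined to 0, 1 and 2, so that
-- 2 and 9 form an edge attached to the pair {0, 1}.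
seed₁₁ : Seed 11
seed₁₁ = seed ((2 ∷ 3 ∷ 4 ∷ 5 ∷ 6 ∷ 9 ∷ 10 ∷ []) ∷ (2 ∷ 3 ∷ 4 ∷ 5 ∷ 6 ∷ 9 ∷ []) ∷ (9 ∷ []) ∷ (5 ∷ 6 ∷ 7 ∷ 10 ∷ []) ∷
    (5 ∷ 6 ∷ 7 ∷ []) ∷ (8 ∷ 10 ∷ []) ∷ (8 ∷ []) ∷ [] ∷ [] ∷ [] ∷ [] ∷ []) 0F 1F 7F refl refl refl refl refl

-- At most eight vertices

infixr 5 _▹_
_▹_ : ∀ {A : Set} {k} → A → (Fin k → A) → Fin (suc k) → A
(x ▹ f) zero    = x
(x ▹ f) (suc i) = f i

∅ : ∀ {A : Set} → Fin 0 → A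
∅ ()

∅-injective : ∀ {A : Set} {i j : Fin 0} → ∅ {A} i ≡ ∅ j → i ≡ j
∅-injective {i = ()}

▹-injective : ∀ {A : Set} {k} {x : A} {f : Fin k → A} → (∀ i → x ≢ f i) → (∀ {i j} → f i ≡ f j → i ≡ j) → ∀ {i j} → (x
    ▹ f) i ≡ (x ▹ f) j → i ≡ j
▹-injective fresh inj {zero}  {zero}  e = refl
▹-injective fresh inj {zero}  {suc j} e = ⊥-elim (fresh j e)
▹-injective fresh inj {suc i} {zero}  e = ⊥-elim (fresh i (sym e))
▹-injective fresh inj {suc i} {suc j} e = cong suc (inj e)

-- If `f` were onto, choosing preimages would inject `Fin n` into the smaller `Fin k`.
fresh : ∀ {k n} (f : Fin k → Fin n) → k < n → ∃[ x ] ∀ i → x ≢ f i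
fresh {k} {n} f k<n with Fin.any? (λ x → Fin.all? (λ i → ¬? (x Fin.≟ f i)))
... | yes p = p
... | no ¬p = contradiction (Fin.injective⇒≤ {f = g} g-inj) (<⇒≱ k<n)
  where
  hit : ∀ x → ∃[ i ] x ≡ f i
  hit x with Fin.any? (λ i → x Fin.≟ f i)
  ... | yes q = q
  ... | no q  = ⊥-elim (¬p (x , λ i e → q (i , e)))
  g : Fin n → Fin k
  g x = proj₁ (hit x)
  g-inj : ∀ {x y} → g x ≡ g y → x ≡ y
  g-inj {x} {y} e = trans (proj₂ (hit x)) (trans (cong f e) (sym (proj₂ (hit y))))

sum-injective : ∀ {k n} (p : Fin k → Fin n) → (∀ {i j} → p i ≡ p j → i ≡ j) → (f : Fin n → ℕ) → sum (f ∘ p) ≤ sum f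
sum-injective {zero}  p inj f = z≤n
sum-injective {suc k} p inj f = ≤-trans (+-monoʳ-≤ (f (p zero)) (≤-trans (≤-reflexive (sum-cong λ i → sym (lem i)))
    (sum-injective (p ∘ suc) (Fin.suc-injective ∘ inj) (on (isnt (p zero)) f)))) (≤-reflexive (sym (sum-split (p zero)
        f)))
  where
  lem : ∀ i → on (isnt (p zero)) f (p (suc i)) ≡ f (p (suc i))
  lem i rewrite ≢⇒isnt {x = p zero} {p (suc i)} (λ e → contradiction (inj e) λ ()) = refl

-- Pulling G back along a permutation moves the copy of K₃,₃ minus an edge to the fixed positions
-- that the search assumes.
module Relabel {n : ℕ} (G : Graph n) (p : Fin n → Fin n) (p-inj : ∀ {i j} → p i ≡ p j → i ≡ j) where
  open Adjacency G
  open Graph G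

  G′ : Graph n
  G′ = record { _~_ = λ x y → p x ~ p y ; _~?_ = λ x y → p x ~? p y ; ~-sym = ~-sym ; ~-irrefl = ~-irrefl ∘ cong p }

  private
    module A′ = Adjacency G′

    -- A missed y would extend `p` to an injection from `Fin (suc n)` to `Fin n`.
    preimage : ∀ y → ∃[ x ] p x ≡ y
    preimage y with Fin.any? (λ x → p x Fin.≟ y)
    ... | yes q = q
    ... | no q  = contradiction (Fin.injective⇒≤ (▹-injective {x = y} {p} (λ i e → q (i , sym e)) p-inj)) (<⇒≱ ≤-refl)

    p⁻¹ : Fin n → Fin n
    p⁻¹ y = proj₁ (preimage y)

    p-p⁻¹ : ∀ y → p (p⁻¹ y) ≡ y
    p-p⁻¹ y = proj₂ (preimage y)

    p⁻¹-inj : ∀ {x y} → p⁻¹ x ≡ p⁻¹ y → x ≡ y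
    p⁻¹-inj {x} {y} e = trans (sym (p-p⁻¹ x)) (trans (cong p e) (p-p⁻¹ y))

  d≤d′ : ∀ x → d (p x) ≤ A′.d x
  d≤d′ x = ≤-trans (≤-reflexive (sum-cong λ y → cong (ι ∘ adj (p x)) (sym (p-p⁻¹ y)))) (sum-injective p⁻¹ p⁻¹-inj (ι ∘
      A′.adj x))

  d′≤d : ∀ x → A′.d x ≤ d (p x)
  d′≤d x = sum-injective p p-inj (ι ∘ adj (p x))

  sum-d′ : sum A′.d ≤ sum d
  sum-d′ = ≤-trans (sum-mono d′≤d) (sum-injective p p-inj d)

  linked′ : Linked → A′.Linked
  linked′ linked {u} {w} u≢w uw = record
    { P = p⁻¹ P ; Q = p⁻¹ Q ; R = p⁻¹ R ; S = p⁻¹ S ; uR = to uR ; uS = to uS ; wP = to wP ; wQ = to wQ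
    ; PR = to₂ PR ; PS = to₂ PS ; QR = to₂ QR ; QS = to₂ QS
    ; P≢Q = P≢Q ∘ p⁻¹-inj ; R≢S = R≢S ∘ p⁻¹-inj ; P≢u = apart P≢u ; Q≢u = apart Q≢u ; R≢w = apart R≢w ; S≢w = apart
        S≢w }
    where
    l : Link (p u) (p w)
    l = linked (u≢w ∘ p-inj) uw
    open Link l
    to : ∀ {x y} → y ∈ adj x → p (p⁻¹ y) ∈ adj x
    to {x} {y} = subst (_∈ adj x) (sym (p-p⁻¹ y))
    to₂ : ∀ {x y} → y ∈ adj x → p (p⁻¹ y) ∈ adj (p (p⁻¹ x))
    to₂ {x} {y} q = subst (λ x → p (p⁻¹ y) ∈ adj x) (sym (p-p⁻¹ x)) (to {x} {y} q)
    apart : ∀ {x y} → x ≢ p y → p⁻¹ x ≢ y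
    apart {x} x≢ e = x≢ (trans (sym (p-p⁻¹ x)) (cong p e))

-- Exhaustive search for a graph with given minimum degree and few edges in
-- which any two nonadjacent vertices are linked.  A state records what is known
-- about the adjacency matrix.
data Known : Set where
  edge non-edge unknown : Known

agrees : Known → Bool → Set
agrees edge     b = b ≡ true
agrees non-edge b = b ≡ false
agrees unknown  b = ⊤

State : ℕ → Set
State n = Vec (Vec Known n) n

module Search {n : ℕ} (δ : ℕ) (v : Fin n) where
  get : State n → Fin n → Fin n → Known
  get M i j = Vec.lookup (Vec.lookup M i) j

  set₁ : Fin n → Fin n → Known → State n → State n
  set₁ i j k M = M Vec.[ i ]%= (Vec._[ j ]≔ k)

  set : Fin n → Fin n → Known → State n → State n
  set i j k M = set₁ i j k (set₁ j i k M)

  certain possible : State n → Fin n → Sub n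
  certain M i j with get M i j
  ... | edge = true
  ... | _    = false
  possible M i j with get M i j
  ... | non-edge = false
  ... | _        = true

  -- `R` and `S` are interchangeable, so only R < S is tried, and the candidates for `P` and `Q` are
  -- counted instead of enumerated.
  viable′ : State n → (i j R S : Fin n) → Bool
  viable′ M i j R S = (Fin.toℕ R <ᵇ Fin.toℕ S) ∧ (possible M i S ∧ (isnt j S ∧
    (2 ≤ᵇ # (λ P → possible M j P ∧ (isnt i P ∧ (possible M P R ∧ possible M P S))))))

  viable : State n → (i j : Fin n) → Bool
  viable M i j = anyF λ R → possible M i R ∧ (isnt j R ∧ anyF (viable′ M i j R))

  unlinkable : State n → (i j : Fin n) → Bool
  unlinkable M i j = not (possible M i j) ∧ ((Fin.toℕ i <ᵇ Fin.toℕ j) ∧ not (viable M i j))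

  -- The degree sum is at most 4n - 2, so a lower bound of 4n - 1 already closes a branch; this is
  -- the `suc` of the second test. Every degree enters it with at least δ.
  closed : State n → Bool
  closed M = (suc δ ≤ᵇ # (certain M v)) or ((4 * n ≤ᵇ suc (sum λ i → δ ⊔ # (certain M i))) or
             (anyF (λ i → suc (# (possible M i)) ≤ᵇ δ) or anyF (λ i → anyF (unlinkable M i))))

  search : List (Fin n × Fin n) → State n → Bool
  search []             M = closed M
  search ((i , j) ∷ ps) M = closed M or (search ps (set i j edge M) ∧ search ps (set i j non-edge M))

  assume : List (Fin n × Fin n × Bool) → State n
  assume []                 = Vec.tabulate λ i → Vec.tabulate λ j → if is i j then non-edge else unknown
  assume ((i , j , b) ∷ fs) = set i j (if b then edge else non-edge) (assume fs)

  module Sound (G : Graph n) (linked : Adjacency.Linked G) (δ≤d : ∀ x → δ ≤ Adjacency.d G x)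
               (dv : Adjacency.d G v ≤ δ) (few : sum (Adjacency.d G) + 2 ≤ 4 * n) where
    open Adjacency G

    Fits : State n → Set
    Fits M = ∀ i j → agrees (get M i j) (adj i j)

    set₁-fits : ∀ {M} i j {k} → agrees k (adj i j) → Fits M → Fits (set₁ i j k M)
    set₁-fits {M} i j {k} a fits i′ j′ with i′ Fin.≟ i
    ... | no i′≢i rewrite lookup∘updateAt′ i′ i {Vec._[ j ]≔ k} i′≢i M = fits i′ j′
    ... | yes refl rewrite lookup∘updateAt i {Vec._[ j ]≔ k} M with j′ Fin.≟ j
    ...   | yes refl rewrite lookup∘update j (Vec.lookup M i) k = a
    ...   | no j′≢j rewrite lookup∘update′ j′≢j (Vec.lookup M i) k = fits i j′

    set-fits : ∀ {M} i j {k} → agrees k (adj i j) → Fits M → Fits (set i j k M)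
    set-fits {M} i j {k} a fits = set₁-fits {set₁ j i k M} i j a (set₁-fits {M} j i (subst (agrees k) (adj-sym i j) a)
        fits)

    assume-fits : ∀ {fs} → All (λ (i , j , b) → adj i j ≡ b) fs → Fits (assume fs)
    assume-fits {[]} [] i j rewrite lookup∘tabulate (λ i → Vec.tabulate λ j → if is i j then non-edge else unknown) i
                                  | lookup∘tabulate (λ j → if is i j then non-edge else unknown) j with i Fin.≟ j
    ... | yes refl = adj-irrefl i
    ... | no _     = tt
    assume-fits {(i , j , true) ∷ fs}  (p ∷ ps) = set-fits {assume fs} i j p (assume-fits ps)
    assume-fits {(i , j , false) ∷ fs} (p ∷ ps) = set-fits {assume fs} i j p (assume-fits ps)

    module _ {M : State n} (fits : Fits M) where
      certain⇒ : ∀ {i j} → j ∈ certain M i → j ∈ adj i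
      certain⇒ {i} {j} p with get M i j | fits i j
      ... | edge | q = q

      ⇒possible : ∀ {i j} → j ∈ adj i → j ∈ possible M i
      ⇒possible {i} {j} p with get M i j | fits i j
      ... | edge     | _ = refl
      ... | unknown  | _ = refl
      ... | non-edge | q = contradiction (trans (sym p) q) λ ()

      impossible⇒ : ∀ {i j} → not (possible M i j) ≡ true → adj i j ≡ false
      impossible⇒ {i} {j} p = ¬∈⇒false {S = adj i} {j} λ q → ∁⁻ (possible M i) {j} p (⇒possible q)

      linkable : ∀ {i j} → Link i j → viable M i j ≡ true
      linkable {i} {j} l = [ (λ lt → found R S lt uR uS R≢w S≢w PR PS QR QS) , (λ gt → found S R gt uS uR S≢w R≢w PS
          PR QS QR) ]′ order
        where
        open Link l
        order : Fin.toℕ R < Fin.toℕ S ⊎ Fin.toℕ S < Fin.toℕ R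
        order with <-cmp (Fin.toℕ R) (Fin.toℕ S)
        ... | tri< p _ _ = inj₁ p
        ... | tri≈ _ p _ = ⊥-elim (R≢S (Fin.toℕ-injective p))
        ... | tri> _ _ p = inj₂ p
        found : ∀ R S → Fin.toℕ R < Fin.toℕ S → R ∈ adj i → S ∈ adj i → R ≢ j → S ≢ j →
                R ∈ adj P → S ∈ adj P → R ∈ adj Q → S ∈ adj Q → viable M i j ≡ true
        found R S lt iR iS R≢j S≢j PR PS QR QS = anyF-complete {S = λ R → possible M i R ∧ (isnt j R ∧ anyF (viable′ M
            i j R))} R
          (∧-intro (⇒possible iR) (∧-intro (≢⇒isnt (R≢j ∘ sym)) (anyF-complete {S = viable′ M i j R} S
            (∧-intro (T⇒ (<⇒<ᵇ lt)) (∧-intro (⇒possible iS) (∧-intro (≢⇒isnt (S≢j ∘ sym)) (T⇒ (≤⇒≤ᵇ (length≤# X ((P≢Q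
                ∷ []) ∷ [] ∷ [])
              (∧-intro (⇒possible wP) (∧-intro (≢⇒isnt (P≢u ∘ sym)) (∧-intro (⇒possible PR) (⇒possible PS))) ∷
               ∧-intro (⇒possible wQ) (∧-intro (≢⇒isnt (Q≢u ∘ sym)) (∧-intro (⇒possible QR) (⇒possible QS))) ∷
                   []))))))))))
          where
          X : Sub n
          X P = possible M j P ∧ (isnt i P ∧ (possible M P R ∧ possible M P S))

      closed-sound : closed M ≡ true → ⊥
      closed-sound p with or-sound {suc δ ≤ᵇ # (certain M v)} p
      ... | inj₁ q = contradiction (≤-trans (≤ᵇ⇒≤ (suc δ) _ (subst T (sym q) tt)) (≤-trans (#-mono {S = certain M v}
          {T = adj v} certain⇒) dv)) (<⇒≱ ≤-refl)
      ... | inj₂ q with or-sound {4 * n ≤ᵇ suc (sum λ i → δ ⊔ # (certain M i))} q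
      ... | inj₁ r = (refute (n ∷ sum d ∷ sum (λ i → δ ⊔ # (certain M i)) ∷ []) ((1 ∙ v1 ⊕ con 2 ⊑ 4 ⊙ v0) ∷ (1 ∙ 4 ⊙
          v0 ⊑ con 1 ⊕ v2) ∷ (1 ∙ v2 ⊑ v1) ∷ []) few (≤ᵇ⇒≤ (4 * n) _ (subst T (sym r) tt)) (sum-mono λ i → ⊔-lub (δ≤d
          i) (#-mono {S = certain M i} {T = adj i} certain⇒)))
      ...   | inj₂ r with or-sound {anyF (λ i → suc (# (possible M i)) ≤ᵇ δ)} r
      ...     | inj₁ s = let i , t = anyF-sound {S = λ i → suc (# (possible M i)) ≤ᵇ δ} s in
                         contradiction (≤-trans (≤ᵇ⇒≤ _ δ (subst T (sym t) tt)) (≤-trans (δ≤d i) (#-mono {S = adj i}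
                             {T = possible M i} ⇒possible))) (<⇒≱ ≤-refl)
      ...     | inj₂ s =
        let i , t = anyF-sound {S = λ i → anyF (unlinkable M i)} s
            j , u = anyF-sound {S = unlinkable M i} t
            non , w = ∧-sound {not (possible M i j)} u
            i<j , bad = ∧-sound {Fin.toℕ i <ᵇ Fin.toℕ j} w
        in ∁⁻ (viable M i) {j} bad (linkable (linked (<⇒≢ (<ᵇ⇒< (Fin.toℕ i) _ (subst T (sym i<j) tt)) ∘ cong Fin.toℕ)
            (impossible⇒ {i} {j} non)))

    search-sound : ∀ ps M → Fits M → search ps M ≡ true → ⊥
    search-sound []             M fits p = closed-sound {M} fits p
    search-sound ((i , j) ∷ ps) M fits p with or-sound {closed M} p
    ... | inj₁ q = closed-sound {M} fits q
    ... | inj₂ q with adj i j in e | ∧-sound {search ps (set i j edge M)} q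
    ...   | true  | r , _ = search-sound ps (set i j edge M) (set-fits {M} i j e fits) r
    ...   | false | _ , r = search-sound ps (set i j non-edge M) (set-fits {M} i j e fits) r

-- The first k vertices are the ones outside the copy of K₃,₃ minus an edge
-- formed by the following v, R, S, x, P, Q.
facts : ∀ k → List (Fin (k + 6) × Fin (k + 6) × Bool)
facts k = (v , R , true) ∷ (v , S , true) ∷ (x , P , true) ∷ (x , Q , true) ∷ (P , R , true) ∷ (P , S , true) ∷ (Q , R
    , true) ∷ (Q , S , true) ∷ (v , x , false) ∷ []
  where
  v = k Fin.↑ʳ 0F
  R = k Fin.↑ʳ 1F
  S = k Fin.↑ʳ 2F
  x = k Fin.↑ʳ 3F
  P = k Fin.↑ʳ 4F
  Q = k Fin.↑ʳ 5F

start : ∀ k → Fin (k + 6)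
start k = k Fin.↑ʳ 0F

Searched : ∀ k → List (Fin (k + 6) × Fin (k + 6)) → ℕ → Set
Searched k ps δ = Search.search δ (start k) ps (Search.assume δ (start k) (facts k)) ≡ true

argmin : ∀ {n} (f : Fin n → ℕ) → Fin n → ∃[ v ] ∀ x → f v ≤ f x
argmin {suc zero}    f _ = zero , λ { zero → ≤-refl }
argmin {suc (suc n)} f _ with argmin (f ∘ suc) zero
... | v , least with f zero ≤? f (suc v)
...   | yes p = zero , λ { zero → ≤-refl ; (suc x) → ≤-trans p (least x) }
...   | no p  = suc v , λ { zero → <⇒≤ (≰⇒> p) ; (suc x) → least x }

extend-injective : ∀ {j n} k (f : Fin j → Fin n) → (∀ {a b} → f a ≡ f b → a ≡ b) → k + j ≤ n →
                   Σ[ g ∈ (Fin (k + j) → Fin n) ] (∀ {a b} → g a ≡ g b → a ≡ b) × (∀ i → g (k Fin.↑ʳ i) ≡ f i)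
extend-injective zero    f inj le = f , inj , λ _ → refl
extend-injective (suc k) f inj le =
  let g , g-inj , g-f = extend-injective k f inj (<⇒≤ le)
      x , x-fresh = fresh g le
  in x ▹ g , ▹-injective x-fresh g-inj , g-f

module SmallBound (k : ℕ) (G : Graph (k + 6)) (linked : Adjacency.Linked G) (v : Fin (k + 6))
                  (least : ∀ x → Adjacency.d G v ≤ Adjacency.d G x) (few : sum (Adjacency.d G) + 2 ≤ 4 * (k + 6))
                      where
  open Adjacency G
  open Rooted G v

  -- Fewer than two edges per vertex make the average degree less than four.
  d≤3 : d v ≤ 3
  d≤3 = ≮⇒≥ λ 4≤d → (refute (sum d ∷ 4 * (k + 6) ∷ []) ((1 ∙ v0 ⊕ con 2 ⊑ v1) ∷ (1 ∙ v1 ⊑ v0) ∷ []) few (≤-trans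
      (≤-reflexive (sym (sum-const (k + 6) 4))) (sum-mono λ x → ≤-trans 4≤d (least x))))

  outside : ∃[ x ] x ∈ O
  outside = #≥1⇒∃ O (deduce (# O ∷ # N ∷ k ∷ []) ((1 ∣ 0 ∙ v2 ⊕ con 6 ≋ con 1 ⊕ (v1 ⊕ v0)) ∷ (1 ∙ v1 ⊑ con 3) ∷ []) 1
      (con 1) (v0) order d≤3)

  module _ (p : Fin (k + 6) → Fin (k + 6)) (p-inj : ∀ {i j} → p i ≡ p j → i ≡ j) (p-v : p (start k) ≡ v) where
    open Relabel G p p-inj

    open Search {k + 6} (d v) (start k)
    open Sound G′ (linked′ linked) (λ x → ≤-trans (least (p x)) (d≤d′ x))
               (≤-trans (d′≤d (start k)) (≤-reflexive (cong d p-v))) (≤-trans (+-monoˡ-≤ 2 sum-d′) few)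

    refuted : All (λ (i , j , b) → adj (p i) (p j) ≡ b) (facts k) → ∀ ps → Searched k ps (d v) → ⊥
    refuted facts-hold ps = search-sound ps (assume (facts k)) (assume-fits facts-hold)

  module _ {x : Fin (k + 6)} (x∈O : x ∈ O) (l : Link v x) where
    open Link l

    2-or-3 : d v ≡ 2 ⊎ d v ≡ 3
    2-or-3 with d v ≟ 3
    ... | yes q = inj₂ q
    ... | no q  = inj₁ (≤-antisym (≤-pred (≤∧≢⇒< d≤3 q)) (length≤# N ((R≢S ∷ []) ∷ [] ∷ []) (uR ∷ uS ∷ [])))

    base : Fin 6 → Fin (k + 6)
    base = v ▹ R ▹ S ▹ x ▹ P ▹ Q ▹ ∅

    base-inj : ∀ {i j} → base i ≡ base j → i ≡ j
    base-inj = ▹-injective (λ { 0F → adj⇒≢ uR ; 1F → adj⇒≢ uS ; 2F → O⇒≢ x∈O ∘ sym ; 3F → P≢u ∘ sym ; 4F → Q≢u ∘ sym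
        })
               (▹-injective (λ { 0F → R≢S ; 1F → R≢w ; 2F → adj⇒≢ PR ∘ sym ; 3F → adj⇒≢ QR ∘ sym })
               (▹-injective (λ { 0F → S≢w ; 1F → adj⇒≢ PS ∘ sym ; 2F → adj⇒≢ QS ∘ sym })
               (▹-injective (λ { 0F → adj⇒≢ wP ; 1F → adj⇒≢ wQ })
               (▹-injective (λ { 0F → P≢Q })
               (▹-injective {f = ∅} (λ ()) λ {i} → ∅-injective {i = i})))))

    module _ (p : Fin (k + 6) → Fin (k + 6)) (p-base : ∀ i → p (k Fin.↑ʳ i) ≡ base i) where
      fact : ∀ i j {b} → adj (base i) (base j) ≡ b → adj (p (k Fin.↑ʳ i)) (p (k Fin.↑ʳ j)) ≡ b
      fact i j e = trans (cong₂ adj (p-base i) (p-base j)) e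

      facts-hold : All (λ (i , j , b) → adj (p i) (p j) ≡ b) (facts k)
      facts-hold = fact 0F 1F uR ∷ fact 0F 2F uS ∷ fact 3F 4F wP ∷ fact 3F 5F wQ ∷ fact 4F 1F PR ∷ fact 4F 2F PS ∷
          fact 5F 1F QR ∷ fact 5F 2F QS
                 ∷ fact 0F 3F (O⇒∉N x∈O) ∷ []

    contra : ∀ ps → (∀ {δ} → δ ≡ 2 ⊎ δ ≡ 3 → Searched k ps δ) → ⊥
    contra ps searched =
      let p , p-inj , p-base = extend-injective k base base-inj ≤-refl
      in refuted p p-inj (p-base 0F) (facts-hold p p-base) ps (searched 2-or-3)

small-lower : ∀ k ps → (∀ {δ} → δ ≡ 2 ⊎ δ ≡ 3 → Searched k ps δ) → IsLowerBound (SatSizes (k + 6) (K 3 3)) (2 * (k +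
    6))
small-lower k ps searched m (G , sat , refl) = ≮⇒≥ λ m<2n →
  let linked = Adjacency.saturated⇒linked G sat
      v , least = argmin (Adjacency.d G) (start k)
      few = (deduce (sum (Adjacency.d G) ∷ Graph.edgeCount G ∷ k ∷ []) ((1 ∣ 0 ∙ v0 ≋ 2 ⊙ v1) ∷ (2 ∙ con 1 ⊕ v1 ⊑ 2 ⊙
          (v2 ⊕ con 6)) ∷ []) 1 (v0 ⊕ con 2) (4 ⊙ (v2 ⊕ con 6)) (Adjacency.handshake G) m<2n)
      x , x∈O = SmallBound.outside k G linked v least few
  in SmallBound.contra k G linked v least few x∈O (Rooted.link-O G v linked x∈O) ps searched

-- All pairs left open by `facts`, beginning with those at v, whose degree is prescribed. The order
-- affects only how early branches close.
order₀ : List (Fin 6 × Fin 6)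
order₀ = (0F , 5F) ∷ (0F , 4F) ∷ (4F , 5F) ∷ (1F , 2F) ∷ (1F , 3F) ∷ (2F , 3F) ∷ []

order₁ : List (Fin 7 × Fin 7)
order₁ = (1F , 6F) ∷ (1F , 5F) ∷ (1F , 0F) ∷ (5F , 6F) ∷ (2F , 3F) ∷ (2F , 4F) ∷ (3F , 4F) ∷ (5F , 0F) ∷ (6F , 0F) ∷
    (3F , 0F) ∷ (2F , 0F) ∷ (4F , 0F) ∷ []

order₂ : List (Fin 8 × Fin 8)
order₂ = (2F , 7F) ∷ (2F , 6F) ∷ (2F , 1F) ∷ (2F , 0F) ∷ (6F , 7F) ∷ (3F , 4F) ∷ (3F , 5F) ∷ (7F , 1F) ∷ (4F , 5F) ∷
    (6F , 1F) ∷ (6F , 0F) ∷ (7F , 0F) ∷ (4F , 0F) ∷ (4F , 1F) ∷ (3F , 0F) ∷ (5F , 0F) ∷ (0F , 1F) ∷ (5F , 1F) ∷ (3F ,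
    1F) ∷ []

search₆ : ∀ {δ} → δ ≡ 2 ⊎ δ ≡ 3 → Searched 0 order₀ δ
search₆ (inj₁ refl) = refl
search₆ (inj₂ refl) = refl

search₇ : ∀ {δ} → δ ≡ 2 ⊎ δ ≡ 3 → Searched 1 order₁ δ
search₇ (inj₁ refl) = refl
search₇ (inj₂ refl) = refl

search₈ : ∀ {δ} → δ ≡ 2 ⊎ δ ≡ 3 → Searched 2 order₂ δ
search₈ (inj₁ refl) = refl
search₈ (inj₂ refl) = refl

-- Small extremal graphs and assembly of the bounds

small-graph : ∀ {n} (larger : Vec (List ℕ) n) → let G = Construct.fromLists larger in
              Check.free? G ≡ true → Check.linked? G ≡ true → Graph.edgeCount G ≡ 2 * n → SatSizes n (K 3 3) (2 * n)
small-graph larger p q size = G , linked⇒saturated G (Check.free-sound G p) (Check.linked-sound G q) , size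
  where G = Construct.fromLists larger

-- The octahedron, with a vertex of degree two attached to none, one or two
-- antipodal pairs.
sat-small : ∀ n → 6 ≤ n → n ≤ 8 → IsMinimum (SatSizes n (K 3 3)) (2 * n)
sat-small n 6≤n n≤8 with n ≟ 6 | n ≟ 7 | n ≟ 8
... | yes refl | _ | _ = small-graph ((2 ∷ 3 ∷ 4 ∷ 5 ∷ []) ∷ (2 ∷ 3 ∷ 4 ∷ 5 ∷ []) ∷ (4 ∷ 5 ∷ []) ∷ (4 ∷ 5 ∷ []) ∷ [] ∷
    [] ∷ []) refl refl refl
                       , small-lower 0 order₀ search₆
... | _ | yes refl | _ = small-graph ((2 ∷ 3 ∷ 4 ∷ 5 ∷ 6 ∷ []) ∷ (2 ∷ 3 ∷ 4 ∷ 5 ∷ 6 ∷ []) ∷ (4 ∷ 5 ∷ []) ∷ (4 ∷ 5 ∷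
    []) ∷ [] ∷ [] ∷ [] ∷ []) refl refl refl
                       , small-lower 1 order₁ search₇
... | _ | _ | yes refl = small-graph ((2 ∷ 3 ∷ 4 ∷ 5 ∷ 6 ∷ []) ∷ (2 ∷ 3 ∷ 4 ∷ 5 ∷ 6 ∷ []) ∷ (4 ∷ 5 ∷ 7 ∷ []) ∷ (4 ∷ 5
    ∷ 7 ∷ []) ∷ [] ∷ [] ∷ [] ∷ [] ∷ []) refl refl refl
                       , small-lower 2 order₂ search₈
... | no ≢6 | no ≢7 | no ≢8 = contradiction (≤-antisym n≤8 (≤∧≢⇒< (≤∧≢⇒< 6≤n (≢6 ∘ sym)) (≢7 ∘ sym))) ≢8

-- An extension adds three vertices, so one starting graph is needed for each residue modulo 3.
seeds : ∀ k → Seed (9 + k)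
seeds 0 = seed₉
seeds 1 = seed₁₀
seeds 2 = seed₁₁
seeds (suc (suc (suc k))) = Extension.extend (seeds k)

sat₂-upper : ∀ {n} → Seed n → SatSizesδ 2 n (K 3 3) (3 * n ∸ 9)
sat₂-upper {n} F = G , linked⇒saturated G free linked ,
  ((v , trans (degree≡d v) dv) , λ x → subst (2 ≤_) (sym (degree≡d x)) (2≤d x)) ,
  trans (sym (m+n∸n≡m (Graph.edgeCount G) 9)) (cong (_∸ 9) E+9)
  where
  open Seed F
  E+9 : Graph.edgeCount G + 9 ≡ 3 * n
  E+9 = ≤-antisym (deduce (sum d ∷ Graph.edgeCount G ∷ n ∷ []) ((0 ∣ 1 ∙ v0 ≋ 2 ⊙ v1) ∷ (1 ∣ 0 ∙ v0 ⊕ con 18 ≋ 6 ⊙ v2)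
      ∷ []) 2 (v1 ⊕ con 9) (3 ⊙ v2) handshake size)
                  (deduce (sum d ∷ Graph.edgeCount G ∷ n ∷ []) ((1 ∣ 0 ∙ v0 ≋ 2 ⊙ v1) ∷ (0 ∣ 1 ∙ v0 ⊕ con 18 ≋ 6 ⊙ v2)
                      ∷ []) 2 (3 ⊙ v2) (v1 ⊕ con 9) handshake size)

sat₂-lower : ∀ n → IsLowerBound (SatSizesδ 2 n (K 3 3)) (3 * n ∸ 9)
sat₂-lower n m (G , sat , ((v , dv) , _) , refl) = m≤n+o⇒m∸n≤o (3 * n) 9
  (deduce (sum d ∷ Graph.edgeCount G ∷ n ∷ []) ((1 ∣ 0 ∙ v0 ≋ 2 ⊙ v1) ∷ (1 ∙ 6 ⊙ v2 ⊑ v0 ⊕ con 18) ∷ []) 2 (3 ⊙ v2)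
      (con 9 ⊕ v1) handshake (Two.bound G (saturated⇒linked sat) (K₃₃-free⇐ (proj₁ sat)) v (trans (sym (degree≡d v))
      dv)))
  where open Adjacency G

sat₅-lower : ∀ n → 9 ≤ n → IsLowerBound (SatSizesδ 5 n (K 3 3)) (3 * n ∸ 9)
sat₅-lower n 9≤n m (G , sat , ((v , dv) , 5≤degree) , refl) = ≮⇒≥ λ few →
  Five.impossible G (saturated⇒linked sat) (λ x → subst (5 ≤_) (degree≡d x) (5≤degree x))
    (deduce (sum d ∷ Graph.edgeCount G ∷ n ∷ 3 * n ∸ 9 ∷ []) ((1 ∣ 0 ∙ v0 ≋ 2 ⊙ v1) ∷ (2 ∙ con 1 ⊕ v1 ⊑ v3) ∷ (2 ∣ 0 ∙
        v3 ⊕ con 9 ≋ 3 ⊙ v2) ∷ []) 1 (v0 ⊕ con 20) (6 ⊙ v2) handshake few (m∸n+n≡m (≤-trans 9≤n (m≤n*m n 3))))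
    v (trans (sym (degree≡d v)) dv)
  where open Adjacency G

theorem1p3 : (∀ (n : ℕ) → 6 ≤ n → n ≤ 8 → IsMinimum (SatSizes n (K 3 3)) (2 * n))
    × (∀ (n : ℕ) → 9 ≤ n →
    IsMinimum (SatSizesδ 2 n (K 3 3)) (3 * n ∸ 9)
    × IsLowerBound (SatSizesδ 5 n (K 3 3)) (3 * n ∸ 9))
theorem1p3 = sat-small , λ n 9≤n →
  (sat₂-upper (subst Seed (m+[n∸m]≡n 9≤n) (seeds (n ∸ 9))) , sat₂-lower n) , sat₅-lower n 9≤n
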